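{- Suppose $T$ is an $\mathsf{O}$-reduced tableau with only one row for an involution $z \in I_\infty$ that has no descents greater than $n$. Let $i_1 < i_2 < i_3 < \cdots < i_k$ be the entries of the tableau obtained from $T$ by removing all primes, and define the weak composition $\alpha^{\mathsf{O}}(T) := k\,\mathbf{e}_{i_1} + \mathbf{e}_{i_2} + \mathbf{e}_{i_3} + \cdots + \mathbf{e}_{i_k}$. Then $\mathrm{BRF}^{\mathsf{O}}_n(T) \cong \mathrm{BRF}^{\mathsf{O}}_n(\alpha^{\mathsf{O}}(T))$ as $\mathfrak{q}^+_n$-crystals.
   Context: Notation. $I_\infty$ is the set of involutions of $\mathbb{P}=\{1,2,\dots\}$ moving finitely many points; $i$ is a descent of $z$ if $z(i)>z(i+1)$. $\mathbf{e}_i$ is the $i$-th standard basis vector; weak compositions are finitely supported sequences in $\mathbb{N}$. Primed numbers are elements of $\mathbb{Z}' = \mathbb{Z}-\tfrac12$, written $x' = x - \tfrac12$, with $1'<1<2'<2<\cdots$; $\lceil\cdot\rceil$ removes primes. For $i\in\mathbb{Z}$, $s_i=s_{i'}=(i\ i{+}1)$. Primed involution words. A primed word $i_1\cdots i_\ell$ belongs to $\mathcal{R}^{\mathsf{O}}(z)$ iff, setting $z_1=1$ and $z_{j+1}=s_{i_j}z_j$ if $z_j$ preserves $\{\lceil i_j\rceil,\lceil i_j\rceil+1\}$ and $z_{j+1}=s_{i_j}z_js_{i_j}$ otherwise, one has $z_{\ell+1}=z$, $z_j(\lceil i_j\rceil)<z_j(\lceil i_j\rceil+1)$ for all $j$,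 and whenever $i_j$ is primed both $\lceil i_j\rceil$ and $\lceil i_j\rceil+1$ are fixed by $z_j$. Orthogonal Coxeter--Knuth equivalence $\overset{\mathsf{O}}{\sim}$ is generated by: $\cdots ACB\cdots\sim\cdots CAB\cdots$ and $\cdots BCA\cdots\sim\cdots BAC\cdots$ when $\lceil A\rceil<\lceil B\rceil<\lceil C\rceil$; for $a,b\in\mathbb{Z}$ with $|a-b|=1$: $aba\sim bab$, $a'b'a'\sim b'a'b'$, $a'ba\sim bab'$, $ab'a\sim ba'b$, $a'b'a\sim ba'b'$, $a'ba'\sim b'ab'$ (in any position); and, affecting only the first letters of a word, $a\cdots\sim a'\cdots$, $ab\cdots\sim ba\cdots$, $ab'\cdots\sim ba'\cdots$, $a'b\cdots\sim b'a\cdots$, $a'b'\cdots\sim b'a'\cdots$ for all $a,b\in\mathbb{Z}$. $\mathsf{O}$-reduced tableaux. An $\mathsf{O}$-reduced tableau for $z$ is a shifted tableau with no primed entries on the main diagonal, with strictly increasing rows and columns or strictly decreasing rows and columns, whose row reading word (rows read left to right, starting from the last row) lies in $\mathcal{R}^{\mathsf{O}}(z)$. Crystals. $\mathrm{RF}^{\mathsf{O}}_n(z)$ is the set of tuples $a=(a^1,\dots,a^n)$ of strictly decreasing primed words with $a^1a^2\cdots a^n\in\mathcal{R}^{\mathsf{O}}(z)$, with weight $(\ell(a^1),\dots,\ell(a^n))$; it carries the normal $\mathfrak{q}^+_n$-crystal structure of Marberg--Tong (operators $e_i,f_i$ for $i\in[n-1]$ given by the Morse--Schilling pairing rule on consecutive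 factors with swapping of primes on paired letters; $e_{\bar1},f_{\bar1}$ moving the maximal letter between the first two factors and toggling primes; $e_{1'},f_{1'}$ removing/adding a prime on $\max(a^1)$; the remaining operators obtained by conjugating with the Weyl group action $\sigma_i$). $\mathrm{RF}^{\mathsf{O}}_n(T)$ is the subset with $a^1\cdots a^n\overset{\mathsf{O}}{\sim}\mathrm{row}(T)$, and $\mathrm{BRF}^{\mathsf{O}}_n(T)$ is its subset of factorizations bounded by the standard flag, i.e. every letter $m$ in $a^i$ satisfies $i\le\lceil m\rceil$. For a symmetric weak composition $\alpha$ (i.e. $\lambda(\alpha)$, the sorted partition, equals its transpose) with $u(\alpha)\in S_n$, where $u(\alpha)$ is the shortest permutation with $\alpha=u(\alpha)\lambda(\alpha)$, define $\mathrm{BRF}^{\mathsf{O}}_n(\alpha):=\mathfrak{D}_{j_1}\cdots\mathfrak{D}_{j_m}\,\mathrm{BRF}^{\mathsf{O}}_n(w_{\lambda(\alpha)})$, where $w_\lambda$ is the dominant (132-avoiding) permutation whose Rothe diagram is the Young diagram of $\lambda$, $j_1\cdots j_m$ is a reduced word for $u(\alpha)$, and $\mathfrak{D}_j\mathcal{X}=\{b\in\mathrm{RF}^{\mathsf{O}}_n(w_{\lambda}) : e_j^kb\in\mathcal{X}\text{ for some }k\ge0\}$ is the crystal Demazure operator. -}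

module Defs where

open import Data.Bool using (Bool; true; false; if_then_else_; _∧_; _∨_; not)
open import Data.Nat using (ℕ; zero; suc; _+_; _∸_; _*_; _≤_; _<_; _≡ᵇ_; _<ᵇ_; _≤ᵇ_; _⊓_; _⊔_)
open import Data.List using (List; []; _∷_; _++_; length; reverse; map; foldr; concat; upTo)
open import Data.Vec as V using (Vec)
open import Data.Vec.Relation.Unary.All as VAll using ()
open import Data.List.Relation.Unary.All as LAll using ()
open import Data.Fin using (Fin; toℕ)
open import Data.Maybe using (Maybe; just; nothing)
open import Data.Product using (Σ; _×_; _,_; proj₁; proj₂)
open import Data.Sum using (_⊎_)
open import Data.Unit using (⊤)
open import Function.Bundles using (_⇔_)
open import Relation.Binary.PropositionalEquality using (_≡_)
open import Relation.Binary.Construct.Closure.Equivalence using (EqClosure)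

-- Primed letters.  lt m false  is the integer m,
--                  lt m true   is the primed number m' = m - 1/2.
-- ⌈lt m p⌉ = m.  The total order 1' < 1 < 2' < 2 < ... is given by key.

record Letter : Set where
  constructor lt
  field
    val    : ℕ
    primed : Bool
open Letter public

un : ℕ → Letter
un a = lt a false

pm : ℕ → Letter
pm a = lt a true

key : Letter → ℕ
key (lt v false) = 2 * v
key (lt v true)  = 2 * v ∸ 1

-- Involutions of P = {1,2,...} are represented by functions ℕ → ℕ
-- (only the values on P matter).  s_m = (m m+1).

swap : ℕ → ℕ → ℕ
swap m x = if x ≡ᵇ m then suc m else (if x ≡ᵇ suc m then m else x)

inPair : ℕ → ℕ → Bool
inPair m x = (x ≡ᵇ m) ∨ (x ≡ᵇ suc m)

-- one step of the process defining primed involution words: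
-- given z_j and the letter i_j, returns z_{j+1}, or nothing if one of the
-- conditions ( z_j(m) < z_j(m+1);  m, m+1 fixed if i_j primed ) fails.
step : (ℕ → ℕ) → Letter → Maybe (ℕ → ℕ)
step z (lt zero p) = nothing
step z (lt (suc k) p) =
  if not (z (suc k) <ᵇ z (suc (suc k))) then nothing
  else if p ∧ not ((z (suc k) ≡ᵇ suc k) ∧ (z (suc (suc k)) ≡ᵇ suc (suc k))) then nothing
  else if inPair (suc k) (z (suc k)) ∧ inPair (suc k) (z (suc (suc k)))
       then just (λ x → swap (suc k) (z x))
       else just (λ x → swap (suc k) (z (swap (suc k) x)))

runFrom : (ℕ → ℕ) → List Letter → Maybe (ℕ → ℕ)
runFrom z [] = just z
runFrom z (l ∷ w) with step z l
... | nothing = nothing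
... | just z′ = runFrom z′ w

InvWordO : (ℕ → ℕ) → List Letter → Set
InvWordO z w = Σ (ℕ → ℕ) λ f → (runFrom (λ x → x) w ≡ just f) × (∀ x → 1 ≤ x → f x ≡ z x)

NoDescentsAbove : ℕ → (ℕ → ℕ) → Set
NoDescentsAbove n z = ∀ i → n < i → z i < z (suc i)

StrictDec : List Letter → Set
StrictDec [] = ⊤
StrictDec (x ∷ []) = ⊤
StrictDec (x ∷ y ∷ w) = key y < key x × StrictDec (y ∷ w)

StrictInc : List Letter → Set
StrictInc [] = ⊤
StrictInc (x ∷ []) = ⊤
StrictInc (x ∷ y ∷ w) = key x < key y × StrictInc (y ∷ w)

Adj : ℕ → ℕ → Set
Adj a b = suc a ≡ b ⊎ suc b ≡ a

data OStep : List Letter → List Letter → Set where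
  knuth-acb : ∀ u v A B C → val A < val B → val B < val C →
              OStep (u ++ A ∷ C ∷ B ∷ v) (u ++ C ∷ A ∷ B ∷ v)
  knuth-bca : ∀ u v A B C → val A < val B → val B < val C →
              OStep (u ++ B ∷ C ∷ A ∷ v) (u ++ B ∷ A ∷ C ∷ v)
  br-aba     : ∀ u v a b → Adj a b → OStep (u ++ un a ∷ un b ∷ un a ∷ v) (u ++ un b ∷ un a ∷ un b ∷ v)
  br-a'b'a'  : ∀ u v a b → Adj a b → OStep (u ++ pm a ∷ pm b ∷ pm a ∷ v) (u ++ pm b ∷ pm a ∷ pm b ∷ v)
  br-a'ba    : ∀ u v a b → Adj a b → OStep (u ++ pm a ∷ un b ∷ un a ∷ v) (u ++ un b ∷ un a ∷ pm b ∷ v)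
  br-ab'a    : ∀ u v a b → Adj a b → OStep (u ++ un a ∷ pm b ∷ un a ∷ v) (u ++ un b ∷ pm a ∷ un b ∷ v)
  br-a'b'a   : ∀ u v a b → Adj a b → OStep (u ++ pm a ∷ pm b ∷ un a ∷ v) (u ++ un b ∷ pm a ∷ pm b ∷ v)
  br-a'ba'   : ∀ u v a b → Adj a b → OStep (u ++ pm a ∷ un b ∷ pm a ∷ v) (u ++ pm b ∷ un a ∷ pm b ∷ v)
  ini-a      : ∀ v a → OStep (un a ∷ v) (pm a ∷ v)
  ini-ab     : ∀ v a b → OStep (un a ∷ un b ∷ v) (un b ∷ un a ∷ v)
  ini-ab'    : ∀ v a b → OStep (un a ∷ pm b ∷ v) (un b ∷ pm a ∷ v)
  ini-a'b    : ∀ v a b → OStep (pm a ∷ un b ∷ v) (pm b ∷ un a ∷ v)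
  ini-a'b'   : ∀ v a b → OStep (pm a ∷ pm b ∷ v) (pm b ∷ pm a ∷ v)

_∼O_ : List Letter → List Letter → Set
_∼O_ = EqClosure OStep

-- One-row O-reduced tableaux.  A one-row shifted tableau is its row
-- (a list of entries, left to right); its only diagonal box is the first.

OneRowOReduced : (ℕ → ℕ) → List Letter → Set
OneRowOReduced z T =
  Σ Letter λ t → Σ (List Letter) λ r →
    (T ≡ t ∷ r) × (primed t ≡ false) × (StrictInc T ⊎ StrictDec T) × InvWordO z T

Fact : ℕ → Set
Fact n = Vec (List Letter) n

word : ∀ {n} → Fact n → List Letter
word a = concat (V.toList a)

weight : ∀ {n} → Fact n → Vec ℕ n
weight a = V.map length a

RF : (n : ℕ) → (ℕ → ℕ) → Fact n → Set
RF n z a = VAll.All StrictDec a × InvWordO z (word a)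

RFT : (n : ℕ) → (ℕ → ℕ) → List Letter → Fact n → Set
RFT n z rowT a = RF n z a × (word a ∼O rowT)

Bounded : ∀ {n} → Fact n → Set
Bounded {n} a = ∀ (i : Fin n) → LAll.All (λ m → suc (toℕ i) ≤ val m) (V.lookup a i)

BRFT : (n : ℕ) → (ℕ → ℕ) → List Letter → Fact n → Set
BRFT n z rowT a = RFT n z rowT a × Bounded a

-- Access to factors by 1-based index

getF : ∀ {n} → Fact n → ℕ → List Letter
getF V.[] _ = []
getF (x V.∷ xs) zero = []
getF (x V.∷ xs) (suc zero) = x
getF (x V.∷ xs) (suc (suc k)) = getF xs (suc k)

setF : ∀ {n} → Fact n → ℕ → List Letter → Fact n
setF V.[] _ _ = V.[]
setF (x V.∷ xs) zero _ = x V.∷ xs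
setF (x V.∷ xs) (suc zero) y = y V.∷ xs
setF (x V.∷ xs) (suc (suc k)) y = x V.∷ setF xs (suc k) y

hasVal : List Letter → ℕ → Bool
hasVal [] v = false
hasVal (l ∷ w) v = (val l ≡ᵇ v) ∨ hasVal w v

primeOf : List Letter → ℕ → Bool
primeOf [] v = false
primeOf (l ∷ w) v = if val l ≡ᵇ v then primed l else primeOf w v

removeVal : ℕ → List Letter → List Letter
removeVal v [] = []
removeVal v (l ∷ w) = if val l ≡ᵇ v then w else l ∷ removeVal v w

insertDec : Letter → List Letter → List Letter
insertDec x [] = x ∷ []
insertDec x (l ∷ w) = if key l <ᵇ key x then x ∷ l ∷ w else l ∷ insertDec x w

lastL : List Letter → Maybe Letter
lastL [] = nothing
lastL (x ∷ []) = just x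
lastL (x ∷ y ∷ w) = lastL (y ∷ w)

-- remove the first (= largest, for a decreasing list) letter with ⌈·⌉ < v
removeFirstBelow : ℕ → List Letter → Maybe (List Letter)
removeFirstBelow v [] = nothing
removeFirstBelow v (a ∷ w) with val a <ᵇ v
... | true = just w
... | false with removeFirstBelow v w
...   | nothing = nothing
...   | just w′ = just (a ∷ w′)

-- Morse–Schilling pairing.  The letters b of the right factor are processed
-- in increasing order; b is paired with the largest unpaired letter a of the
-- left factor with ⌈a⌉ < ⌈b⌉.  Returns (unpaired left letters, decreasing;
-- unpaired right letters, increasing).
pairUp : List Letter → List Letter → List Letter × List Letter
pairUp Lu [] = Lu , []
pairUp Lu (b ∷ bs) with removeFirstBelow (val b) Lu
... | just Lu′ = pairUp Lu′ bs
... | nothing = proj₁ (pairUp Lu bs) , b ∷ proj₂ (pairUp Lu bs)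

pairing : List Letter → List Letter → List Letter × List Letter
pairing L R = pairUp L (reverse R)

-- number t with x-1, ..., x-t ∈ ⌈L⌉ and x-t-1 ∉ ⌈L⌉  (first argument = fuel)
runDown : ℕ → List Letter → ℕ → ℕ
runDown zero L x = 0
runDown (suc f) L zero = 0
runDown (suc f) L (suc y) = if hasVal L y then suc (runDown f L y) else 0

runUp : ℕ → List Letter → ℕ → ℕ
runUp zero R y = 0
runUp (suc f) R y = if hasVal R (suc y) then suc (runUp f R (suc y)) else 0

-- f_i on the pair of consecutive factors (L, R) = (a^i, a^{i+1}):
-- move the smallest unpaired letter x of L to R as x-t, swapping primes of
-- the paired letters x-j ∈ L and x-j+1 ∈ R (1 ≤ j ≤ t).
fPair : List Letter → List Letter → Maybe (List Letter × List Letter)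
fPair L R with lastL (proj₁ (pairing L R))
... | nothing = nothing
... | just x = just (L′ , R′)
  where
    lo : ℕ
    lo = val x ∸ runDown (length L) L (val x)
    L′ : List Letter
    L′ = map (λ l → if (lo ≤ᵇ val l) ∧ (val l <ᵇ val x)
                    then lt (val l) (primeOf R (suc (val l))) else l)
             (removeVal (val x) L)
    R′ : List Letter
    R′ = insertDec (lt lo (primed x))
           (map (λ l → if (lo <ᵇ val l) ∧ (val l ≤ᵇ val x)
                       then lt (val l) (primeOf L (val l ∸ 1)) else l) R)

-- e_i on (L, R): move the largest unpaired letter y of R to L as y+t.
ePair : List Letter → List Letter → Maybe (List Letter × List Letter)
ePair L R with lastL (proj₂ (pairing L R))
... | nothing = nothing
... | just y = just (L′ , R′)
  where
    hi : ℕ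
    hi = val y + runUp (length R) R (val y)
    R′ : List Letter
    R′ = map (λ l → if (val y <ᵇ val l) ∧ (val l ≤ᵇ hi)
                    then lt (val l) (primeOf L (val l ∸ 1)) else l)
             (removeVal (val y) R)
    L′ : List Letter
    L′ = insertDec (lt hi (primed y))
           (map (λ l → if (val y ≤ᵇ val l) ∧ (val l <ᵇ hi)
                       then lt (val l) (primeOf R (suc (val l))) else l) L)

applyPair : ∀ {n} → ℕ → Fact n → Maybe (List Letter × List Letter) → Maybe (Fact n)
applyPair i a nothing = nothing
applyPair i a (just (L′ , R′)) = just (setF (setF a i L′) (suc i) R′)

eOp : ∀ {n} → ℕ → Fact n → Maybe (Fact n)
eOp {n} i a = if (1 ≤ᵇ i) ∧ (i <ᵇ n) then applyPair i a (ePair (getF a i) (getF a (suc i))) else nothing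

fOp : ∀ {n} → ℕ → Fact n → Maybe (Fact n)
fOp {n} i a = if (1 ≤ᵇ i) ∧ (i <ᵇ n) then applyPair i a (fPair (getF a i) (getF a (suc i))) else nothing

-- e_{\bar 1}, f_{\bar 1}: move the maximal letter between a^1 and a^2
-- (the primes of the moved letter and of the next letter of a^1 are exchanged,
-- i.e. the prime attached to the first position of the word is kept)
fbar1 : ∀ {n} → Fact n → Maybe (Fact n)
fbar1 {n} a with 2 ≤ᵇ n | getF a 1 | getF a 2
... | false | _ | _ = nothing
... | true | [] | _ = nothing
... | true | x ∷ [] | [] = just (setF (setF a 1 []) 2 (x ∷ []))
... | true | x ∷ [] | m ∷ a2 =
        if val m <ᵇ val x then just (setF (setF a 1 []) 2 (x ∷ m ∷ a2)) else nothing
... | true | x ∷ y ∷ r | [] =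
        just (setF (setF a 1 (lt (val y) (primed x) ∷ r)) 2 (lt (val x) (primed y) ∷ []))
... | true | x ∷ y ∷ r | m ∷ a2 =
        if val m <ᵇ val x
        then just (setF (setF a 1 (lt (val y) (primed x) ∷ r)) 2 (lt (val x) (primed y) ∷ m ∷ a2))
        else nothing

ebar1 : ∀ {n} → Fact n → Maybe (Fact n)
ebar1 {n} a with 2 ≤ᵇ n | getF a 1 | getF a 2
... | false | _ | _ = nothing
... | true | _ | [] = nothing
... | true | [] | y ∷ r2 = just (setF (setF a 1 (y ∷ [])) 2 r2)
... | true | x ∷ r | y ∷ r2 =
        if val x <ᵇ val y
        then just (setF (setF a 1 (lt (val y) (primed x) ∷ lt (val x) (primed y) ∷ r)) 2 r2)
        else nothing

fpr1 : ∀ {n} → Fact n → Maybe (Fact n)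
fpr1 a with getF a 1
... | [] = nothing
... | lt v false ∷ r = just (setF a 1 (lt v true ∷ r))
... | lt v true ∷ r = nothing

epr1 : ∀ {n} → Fact n → Maybe (Fact n)
epr1 a with getF a 1
... | [] = nothing
... | lt v true ∷ r = just (setF a 1 (lt v false ∷ r))
... | lt v false ∷ r = nothing

_>=>_ : {A : Set} → (A → Maybe A) → (A → Maybe A) → A → Maybe A
(g >=> h) a with g a
... | nothing = nothing
... | just b = h b
infixr 5 _>=>_

iterM : {A : Set} → ℕ → (A → Maybe A) → A → Maybe A
iterM zero g a = just a
iterM (suc k) g a with g a
... | nothing = nothing
... | just b = iterM k g b

σ : ∀ {n} → ℕ → Fact n → Maybe (Fact n)
σ i a = if length (getF a (suc i)) ≤ᵇ length (getF a i)
        then iterM (length (getF a i) ∸ length (getF a (suc i))) (fOp i) a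
        else iterM (length (getF a (suc i)) ∸ length (getF a i)) (eOp i) a

ebarOp : ∀ {n} → ℕ → Fact n → Maybe (Fact n)
ebarOp zero = λ _ → nothing
ebarOp (suc zero) = ebar1
ebarOp (suc (suc k)) = σ (suc k) >=> σ (suc (suc k)) >=> ebarOp (suc k) >=> σ (suc (suc k)) >=> σ (suc k)

fbarOp : ∀ {n} → ℕ → Fact n → Maybe (Fact n)
fbarOp zero = λ _ → nothing
fbarOp (suc zero) = fbar1
fbarOp (suc (suc k)) = σ (suc k) >=> σ (suc (suc k)) >=> fbarOp (suc k) >=> σ (suc (suc k)) >=> σ (suc k)

eprOp : ∀ {n} → ℕ → Fact n → Maybe (Fact n)
eprOp zero = λ _ → nothing
eprOp (suc zero) = epr1
eprOp (suc (suc k)) = σ (suc k) >=> eprOp (suc k) >=> σ (suc k)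

fprOp : ∀ {n} → ℕ → Fact n → Maybe (Fact n)
fprOp zero = λ _ → nothing
fprOp (suc zero) = fpr1
fprOp (suc (suc k)) = σ (suc k) >=> fprOp (suc k) >=> σ (suc k)

data OpIx : Set where
  ix  : ℕ → OpIx
  bar : ℕ → OpIx
  prm : ℕ → OpIx

ValidIx : ℕ → OpIx → Set
ValidIx n (ix i)  = 1 ≤ i × i < n
ValidIx n (bar i) = 1 ≤ i × i < n
ValidIx n (prm i) = 1 ≤ i × i ≤ n

raise : ∀ {n} → OpIx → Fact n → Maybe (Fact n)
raise (ix i)  = eOp i
raise (bar i) = ebarOp i
raise (prm i) = eprOp i

lower : ∀ {n} → OpIx → Fact n → Maybe (Fact n)
lower (ix i)  = fOp i
lower (bar i) = fbarOp i
lower (prm i) = fprOp i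

-- Isomorphism of the q^+_n-crystals carried by subsets X, Y of
-- factorizations (each with the induced structure: an operator is
-- undefined at x if its value leaves the subset).

record CrystalIso {n : ℕ} (X Y : Fact n → Set) : Set where
  field
    φ ψ    : Fact n → Fact n
    φ-into : ∀ a → X a → Y (φ a)
    ψ-into : ∀ b → Y b → X (ψ b)
    ψ∘φ    : ∀ a → X a → ψ (φ a) ≡ a
    φ∘ψ    : ∀ b → Y b → φ (ψ b) ≡ b
    wt-φ   : ∀ a → X a → weight (φ a) ≡ weight a
    raise-φ : ∀ j → ValidIx n j → ∀ a a′ → X a → X a′ →
              (raise j a ≡ just a′) ⇔ (raise j (φ a) ≡ just (φ a′))
    lower-φ : ∀ j → ValidIx n j → ∀ a a′ → X a → X a′ →
              (lower j a ≡ just a′) ⇔ (lower j (φ a) ≡ just (φ a′))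

-- Weak compositions: finite lists (α_1, α_2, ...), extended by zeros.

Comp : Set
Comp = List ℕ

at : Comp → ℕ → ℕ
at [] _ = 0
at (x ∷ xs) zero = 0
at (x ∷ xs) (suc zero) = x
at (x ∷ xs) (suc (suc k)) = at xs (suc k)

_≈c_ : Comp → Comp → Set
α ≈c β = ∀ p → at α p ≡ at β p

sAct : ℕ → Comp → Comp
sAct zero α = α
sAct (suc j) α = map (λ p → at α (swap (suc j) (suc p))) (upTo (length α ⊔ suc (suc j)))

applyWord : List ℕ → Comp → Comp
applyWord js α = foldr sAct α js

insertN : ℕ → List ℕ → List ℕ
insertN x [] = x ∷ []
insertN x (y ∷ ys) = if y <ᵇ x then x ∷ y ∷ ys else y ∷ insertN x ys

lambdaOf : Comp → Comp
lambdaOf α = foldr insertN [] α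

-- js is a reduced word for u(α), the shortest permutation with α = u(α)λ(α):
-- equivalently, js is a shortest word with s_{j_1}⋯s_{j_m}·λ(α) = α.
IsRedWordU : Comp → List ℕ → Set
IsRedWordU α js =
  (applyWord js (lambdaOf α) ≈c α) ×
  (∀ ks → applyWord ks (lambdaOf α) ≈c α → length js ≤ length ks)

-- α^O(T) = k e_{i_1} + e_{i_2} + ... + e_{i_k}, with i_1 < ... < i_k the
-- unprimed entries of the one-row tableau T
minVal : List Letter → ℕ
minVal [] = 0
minVal (t ∷ r) = foldr (λ l m → val l ⊓ m) (val t) r

maxVal : List Letter → ℕ
maxVal T = foldr (λ l m → val l ⊔ m) 0 T

countVal : ℕ → List Letter → ℕ
countVal p T = foldr (λ l c → if val l ≡ᵇ p then suc c else c) 0 T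

alphaO : List Letter → Comp
alphaO T = map (λ q → countVal (suc q) T + (if suc q ≡ᵇ minVal T then length T ∸ 1 else 0))
               (upTo (maxVal T))

-- w is the dominant permutation w_λ: a permutation of P, fixing all but
-- finitely many points, whose Rothe diagram
--   D(w) = {(i,j) ∈ P×P : j < w(i), i < w⁻¹(j)}
-- is the Young diagram {(i,j) : 1 ≤ j ≤ λ_i} of λ.
IsDominantPerm : Comp → (ℕ → ℕ) → Set
IsDominantPerm lam w =
  Σ (ℕ → ℕ) λ winv →
    (∀ i → 1 ≤ i → 1 ≤ w i) × (∀ i → 1 ≤ i → 1 ≤ winv i) ×
    (∀ i → 1 ≤ i → winv (w i) ≡ i) × (∀ i → 1 ≤ i → w (winv i) ≡ i) ×
    (Σ ℕ λ N → ∀ i → N < i → w i ≡ i) ×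
    (∀ i j → 1 ≤ i → 1 ≤ j → ((j < w i × i < winv j) ⇔ (j ≤ at lam i)))

BRF : (n : ℕ) → (ℕ → ℕ) → Fact n → Set
BRF n w a = RF n w a × Bounded a

Dem : ∀ {n} → (ℕ → ℕ) → ℕ → (Fact n → Set) → Fact n → Set
Dem {n} wλ j X b = RF n wλ b × Σ ℕ λ k → Σ (Fact n) λ b′ → (iterM k (eOp j) b ≡ just b′) × X b′

BRFα : (n : ℕ) → (ℕ → ℕ) → List ℕ → Fact n → Set
BRFα n wλ js = foldr (Dem wλ) (BRF n wλ) js

{-# OPTIONS --safe #-}
-- The words equivalent to row(T) are exactly those whose first letter is any
-- entry of T and in which every later letter is the next entry above or below
-- the interval of entries already used; the prime of a later letter depends
-- only on the entry and the side from which it is reached, while the first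
-- prime is free.  For w_λ, the transposition (1 k+1), all primed involution
-- words have this shape, with entries 1, ..., k and no primes after the first
-- letter.  Replacing c by i_c and inserting the forced primes is therefore a
-- bijection from factorizations of w_λ to RF(T).  It commutes with all crystal
-- operators, since on these words they depend only on the order of the letters
-- and carry the first prime along.
--
-- By induction along a reduced word of u(α), the Demazure operators cut out the
-- factorizations in which letter c lies in a factor of index at most the
-- current position of the c-th part.  A shortest word only moves parts up into
-- empty places, so the final positions are i_1, ..., i_k, and the condition
-- becomes boundedness by the standard flag after c is replaced by i_c.

module Submission where

open import Defs
open import Data.Bool using (Bool; true; false; if_then_else_; _∧_)
open import Data.Bool.Properties using (∧-zeroʳ)
open import Data.Nat using (ℕ; zero; suc; _+_; _∸_; _*_; _≤_; _<_; _≡ᵇ_; _<ᵇ_; _≤ᵇ_; _⊓_; _⊔_; z≤n; s≤s; _≟_; _<?_; _≤?_)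
open import Data.Nat.Properties
open import Data.List using (List; []; _∷_; _++_; _∷ʳ_; length; reverse; map; foldr; upTo; applyUpTo; replicate)
open import Data.Nat.ListAction using (sum)
open import Data.List.Reverse using (Reverse; reverseView; []; _∶_∶ʳ_)
import Data.List.Properties as L
import Algebra.Properties.CommutativeSemigroup as CommutativeSemigroup
open import Data.List.Relation.Unary.All as LAll using (All; []; _∷_)
import Data.List.Relation.Unary.All.Properties as LAllₚ
open import Data.List.Relation.Unary.AllPairs using (AllPairs; []; _∷_)
open import Data.Vec as V using ([]; _∷_)
open import Data.Vec.Relation.Unary.All as VAll using ([]; _∷_)
open import Data.Fin as F using (toℕ)
open import Data.Maybe using (Maybe; just; nothing)
import Data.Maybe as M
open import Data.Maybe.Properties using (just-injective)
open import Data.Product using (∃; _×_; _,_; proj₁; proj₂)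
open import Data.Sum using (_⊎_; inj₁; inj₂)
open import Data.Unit using (⊤; tt)
open import Data.Empty using (⊥; ⊥-elim)
open import Function using (_∘_; id; case_of_)
open import Function.Bundles using (_⇔_; mk⇔; Equivalence)
open import Relation.Nullary using (¬_; Dec; yes; no; contradiction)
open import Relation.Nullary.Decidable using (dec-true; dec-false)
open import Relation.Binary.Definitions using (tri<; tri≈; tri>)
open import Relation.Binary.PropositionalEquality using (_≡_; _≢_; _≗_; refl; sym; trans; cong; cong₂; subst; subst₂)
import Relation.Binary.Construct.Closure.Equivalence as Eq
open import Relation.Binary.Construct.Closure.ReflexiveTransitive using (ε; _◅_; _◅◅_)
open import Relation.Binary.Construct.Closure.Symmetric using (SymClosure; fwd; bwd)

open CommutativeSemigroup +-commutativeSemigroup using () renaming (interchange to +-interchange)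

-- The initial relations exchange the values of the first two letters and leave the primes where
-- they are. So a prime cannot belong to an entry. Attached to a gap it is the same from both sides,
-- and increasing and decreasing tableaux get one description. In general e_i and f_i shift the
-- moved letter by the length t of a run of consecutive values, a quantity that replacing c by i_c
-- does not preserve. The interval shape of the words forces t = 0, and only this makes the
-- operators depend on order alone. The barred and primed operators of higher index are conjugates
-- by σ_i, so compatibility with the relabelling is formulated in a way that survives composition.
-- That a reduced word of u(α) wastes no letter is seen from the sum of the positions of the k
-- parts. Each letter raises it by at most 1, and an explicit word whose length is the total rise
-- bounds the minimal length from above.

≡ᵇ-true : ∀ {a b} → a ≡ b → (a ≡ᵇ b) ≡ true
≡ᵇ-true {a} {b} = dec-true (a ≟ b)

≡ᵇ-false : ∀ {a b} → a ≢ b → (a ≡ᵇ b) ≡ false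
≡ᵇ-false {a} {b} = dec-false (a ≟ b)

<ᵇ-true : ∀ {a b} → a < b → (a <ᵇ b) ≡ true
<ᵇ-true {a} {b} = dec-true (a <? b)

<ᵇ-false : ∀ {a b} → ¬ a < b → (a <ᵇ b) ≡ false
<ᵇ-false {a} {b} = dec-false (a <? b)

≤ᵇ-true : ∀ {a b} → a ≤ b → (a ≤ᵇ b) ≡ true
≤ᵇ-true {a} {b} = dec-true (a ≤? b)

≤ᵇ-false : ∀ {a b} → ¬ a ≤ b → (a ≤ᵇ b) ≡ false
≤ᵇ-false {a} {b} = dec-false (a ≤? b)

-- Adjacent transpositions

swap-l : ∀ m → swap m m ≡ suc m
swap-l m rewrite ≡ᵇ-true {m} refl = refl

swap-r : ∀ m → swap m (suc m) ≡ m
swap-r m rewrite ≡ᵇ-false {suc m} {m} 1+n≢n | ≡ᵇ-true {m} refl = refl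

swap-other : ∀ {m x} → x ≢ m → x ≢ suc m → swap m x ≡ x
swap-other p q rewrite ≡ᵇ-false p | ≡ᵇ-false q = refl

data SwapView (m x : ℕ) : Set where
  isL   : x ≡ m → swap m x ≡ suc m → SwapView m x
  isR   : x ≡ suc m → swap m x ≡ m → SwapView m x
  other : x ≢ m → x ≢ suc m → swap m x ≡ x → SwapView m x

swapView : ∀ m x → SwapView m x
swapView m x with x ≟ m
... | yes refl = isL refl (swap-l m)
... | no p with x ≟ suc m
...   | yes refl = isR refl (swap-r m)
...   | no q = other p q (swap-other p q)

swap-below : ∀ {m x} → x < m → swap m x ≡ x
swap-below x<m = swap-other (<⇒≢ x<m) (<⇒≢ (m<n⇒m<1+n x<m))

swap-above : ∀ {m x} → suc m < x → swap m x ≡ x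
swap-above m<x = swap-other (>⇒≢ (<⇒≤ m<x)) (>⇒≢ m<x)

swap-involutive : ∀ m x → swap m (swap m x) ≡ x
swap-involutive m x with swapView m x
... | isL refl e rewrite e = swap-r m
... | isR refl e rewrite e = swap-l m
... | other p q e rewrite e = e

swap-injective : ∀ m {x y} → swap m x ≡ swap m y → x ≡ y
swap-injective m {x} {y} e =
  trans (sym (swap-involutive m x)) (trans (cong (swap m) e) (swap-involutive m y))

swap-comm : ∀ {a b} → suc a < b → ∀ x → swap a (swap b x) ≡ swap b (swap a x)
swap-comm {a} {b} a<b x with swapView b x
... | isL refl e rewrite e | swap-above a<b | swap-l b = swap-above (m<n⇒m<1+n a<b)
... | isR refl e rewrite e | swap-above a<b | swap-above (m<n⇒m<1+n a<b) | swap-r b = refl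
... | other p q e rewrite e with swapView a x
...   | isL refl e′ rewrite e′ = sym (swap-below a<b)
...   | isR refl e′ rewrite e′ = sym (swap-below (<⇒≤ a<b))
...   | other _ _ e′ rewrite e′ = sym e

swap-braid : ∀ a x → swap a (swap (suc a) (swap a x)) ≡ swap (suc a) (swap a (swap (suc a) x))
swap-braid a x with swapView a x
... | isL refl e rewrite e | swap-l (suc a) | swap-below {suc a} {a} (n<1+n a) | e | swap-l (suc a) =
  swap-above (n<1+n (suc a))
... | isR refl e rewrite e | swap-below {suc a} {a} (n<1+n a) | swap-l a | swap-l (suc a)
    | swap-above {a} {suc (suc a)} (n<1+n (suc a)) = sym (swap-r (suc a))
... | other p q e rewrite e with swapView (suc a) x
...   | isL r _ = contradiction r q
...   | isR refl e′ rewrite e′ | swap-r a = sym (swap-below (n<1+n a))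
...   | other p′ q′ e′ rewrite e′ | e = sym e′

swap-> : ∀ {a j y} → a < j → a < y → a < swap j y
swap-> {a} {j} {y} a<j a<y with swapView j y
... | isL refl e rewrite e = m<n⇒m<1+n a<j
... | isR refl e rewrite e = a<j
... | other _ _ e rewrite e = a<y

swap-positive : ∀ j {y} → 1 ≤ j → 1 ≤ y → 1 ≤ swap j y
swap-positive j 1≤j 1≤y = swap-> 1≤j 1≤y

-- The entries of the tableau are iv 1 < ... < iv k; iv is continued past k in
-- an irrelevant strictly increasing way.  The flag g c belongs to the gap
-- between iv c and iv (suc c): it is the prime carried by whichever of these
-- two entries comes second in a word equivalent to the tableau.
record Spec : Set where
  field
    k      : ℕ
    iv     : ℕ → ℕ
    g      : ℕ → Bool
    1≤k    : 1 ≤ k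
    iv-suc : ∀ c → iv c < iv (suc c)
    gap    : ∀ c → g c ≡ true → suc (iv c) < iv (suc c)
open Spec public

-- Words growing an interval, and their orthogonal Coxeter-Knuth class

module _ (D : Spec) where

  iv-mono-≤ : ∀ {c d} → c ≤ d → iv D c ≤ iv D d
  iv-mono-≤ {c} {d} c≤d with m≤n⇒m<n∨m≡n c≤d
  ... | inj₂ refl = ≤-refl
  iv-mono-≤ {c} {suc d} c≤d | inj₁ (s≤s c≤d′) = ≤-trans (iv-mono-≤ c≤d′) (<⇒≤ (iv-suc D d))

  iv-mono-< : ∀ {c d} → c < d → iv D c < iv D d
  iv-mono-< {c} c<d = <-≤-trans (iv-suc D c) (iv-mono-≤ c<d)

  iv-cancel-< : ∀ {c d} → iv D c < iv D d → c < d
  iv-cancel-< {c} {d} p = ≰⇒> (λ d≤c → <⇒≱ p (iv-mono-≤ d≤c))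

  iv-injective : ∀ {c d} → iv D c ≡ iv D d → c ≡ d
  iv-injective {c} {d} e with <-cmp c d
  ... | tri< c<d _ _ = contradiction e (<⇒≢ (iv-mono-< c<d))
  ... | tri≈ _ c≡d _ = c≡d
  ... | tri> _ _ d<c = contradiction e (>⇒≢ (iv-mono-< d<c))

  iv-positive : ∀ c → 1 ≤ iv D (suc c)
  iv-positive c = ≤-trans (s≤s z≤n) (iv-suc D c)

  iv-≥ : ∀ c → c ≤ iv D c
  iv-≥ zero    = z≤n
  iv-≥ (suc c) = ≤-<-trans (iv-≥ c) (iv-suc D c)

  -- Words extending the interval of entries with indices a+1, ..., hi to all
  -- of 1, ..., k by letters each of which is a new maximum or a new minimum.
  data Sh : ℕ → ℕ → List Letter → Set where
    done : Sh 0 (k D) []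
    up   : ∀ {a hi u} → Sh a (suc hi) u → Sh a hi (lt (iv D (suc hi)) (g D hi) ∷ u)
    dn   : ∀ {a hi u} → Sh a hi u → Sh (suc a) hi (lt (iv D (suc a)) (g D (suc a)) ∷ u)

  data ClassW : List Letter → Set where
    start : ∀ {a p u} → Sh a (suc a) u → ClassW (lt (iv D (suc a)) p ∷ u)

  In Out : ℕ → ℕ → Letter → Set
  In  a hi l = iv D (suc a) ≤ val l × val l ≤ iv D hi
  Out a hi l = val l < iv D (suc a) ⊎ iv D hi < val l

  In-Out : ∀ {a hi l l′} → In a hi l → Out a hi l′ → val l ≢ val l′
  In-Out (p , q) (inj₁ r) e = <⇒≱ r (subst (_ ≤_) e p)
  In-Out (p , q) (inj₂ r) e = <⇒≱ r (subst (_≤ _) e q)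

  Sh-bound : ∀ {a hi u} → Sh a hi u → hi ≤ k D
  Sh-bound done = ≤-refl
  Sh-bound (up s) = <⇒≤ (Sh-bound s)
  Sh-bound (dn s) = Sh-bound s

  Sh-out : ∀ {a hi u} → Sh a hi u → All (Out a hi) u
  Sh-out done = []
  Sh-out (up s) = inj₂ (iv-suc D _) ∷
    LAll.map (λ { (inj₁ p) → inj₁ p ; (inj₂ p) → inj₂ (<-trans (iv-suc D _) p) }) (Sh-out s)
  Sh-out (dn s) = inj₁ (iv-suc D _) ∷
    LAll.map (λ { (inj₁ p) → inj₁ (<-trans p (iv-suc D _)) ; (inj₂ p) → inj₂ p }) (Sh-out s)

  -- A cut through a word of the class: the letters before it lie in the interval a+1, ..., hi, and
  -- any other completion of that interval may replace the rest. `rebuild` turns a local change of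
  -- the tail into membership of the whole word. The context is abstract so that the record serves
  -- both `Sh` and `ClassW`.
  record Rest (ctx : List Letter → Set) (pre v : List Letter) : Set where
    constructor rest
    field
      {a hi}  : ℕ
      a<hi    : a < hi
      sh      : Sh a hi v
      ins     : All (In a hi) pre
      rebuild : ∀ {v′} → Sh a hi v′ → ctx (pre ++ v′)

  In-up : ∀ {a hi l} → In a hi l → In a (suc hi) l
  In-up (p , q) = p , ≤-trans q (<⇒≤ (iv-suc D _))

  In-dn : ∀ {a hi l} → In (suc a) hi l → In a hi l
  In-dn (p , q) = ≤-trans (<⇒≤ (iv-suc D _)) p , q

  -- The accumulated prefix `done′` is needed for the bounds `In` but is not covered by the
  -- derivation of `Sh`. The context therefore speaks of the word after `done′`, which left
  -- cancellation recovers.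
  Sh-split : ∀ {a hi} done′ u {v} → a < hi → All (In a hi) done′ → Sh a hi (u ++ v) →
             Rest (λ w → ∀ {w′} → w ≡ done′ ++ w′ → Sh a hi w′) (done′ ++ u) v
  Sh-split d [] a<hi ins s =
    rest a<hi s (subst (All _) (sym (L.++-identityʳ d)) ins)
      λ {v′} s′ e → subst (Sh _ _) (L.++-cancelˡ d _ _ (trans (cong (_++ v′) (sym (L.++-identityʳ d))) e)) s′
  Sh-split d (x ∷ u) a<hi ins (up s)
    with Sh-split (d ++ x ∷ []) u (m<n⇒m<1+n a<hi)
           (LAllₚ.++⁺ (LAll.map (λ {l} → In-up {l = l}) ins) ((iv-mono-≤ (s≤s (<⇒≤ a<hi)) , ≤-refl) ∷ [])) s
  ... | rest p s′ i r = rest p s′ (subst (All _) (L.++-assoc d _ u) i)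
        λ {v′} t {w′} e → subst (Sh _ _) (L.++-cancelˡ d (x ∷ u ++ v′) _ (trans (sym (L.++-assoc d (x ∷ u) v′)) e))
          (up (r t (L.++-assoc (d ++ x ∷ []) u v′)))
  Sh-split d (x ∷ u) a<hi ins (dn s)
    with Sh-split (d ++ x ∷ []) u (<-trans (n<1+n _) a<hi)
           (LAllₚ.++⁺ (LAll.map (λ {l} → In-dn {l = l}) ins) ((≤-refl , iv-mono-≤ (<⇒≤ a<hi)) ∷ [])) s
  ... | rest p s′ i r = rest p s′ (subst (All _) (L.++-assoc d _ u) i)
        λ {v′} t {w′} e → subst (Sh _ _) (L.++-cancelˡ d (x ∷ u ++ v′) _ (trans (sym (L.++-assoc d (x ∷ u) v′)) e))
          (dn (r t (L.++-assoc (d ++ x ∷ []) u v′)))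

  ClassW-split : ∀ x pre {v} → ClassW (x ∷ pre ++ v) → Rest ClassW (x ∷ pre) v
  ClassW-split x pre (start {a} s) with Sh-split (x ∷ []) pre (n<1+n a) ((≤-refl , ≤-refl) ∷ []) s
  ... | rest p s′ i r = rest p s′ i λ t → start (r t refl)

  ClassW-split₁ : ∀ pre B {v} → ClassW (pre ++ B ∷ v) → Rest ClassW (pre ++ B ∷ []) v
  ClassW-split₁ [] B c = ClassW-split B [] c
  ClassW-split₁ (x ∷ pre) B {v} c =
    ClassW-split x (pre ++ B ∷ []) (subst (λ w → ClassW (x ∷ w)) (sym (L.++-assoc pre (B ∷ []) v)) c)

  -- Once x and y are used, the interval spans everything between them, while z has to lie outside
  -- it. This excludes the relation ACB ~ CAB and, through `ClassW-nonrepeating`, every braid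
  -- relation.
  ClassW-extreme : ∀ pre x y z v → ClassW (pre ++ x ∷ y ∷ z ∷ v) →
                   (val x ≤ val z × val z ≤ val y) ⊎ (val y ≤ val z × val z ≤ val x) → ⊥
  ClassW-extreme pre x y z v c bet
    with ClassW-split₁ (pre ++ x ∷ []) y (subst ClassW (sym (L.++-assoc pre (x ∷ []) (y ∷ z ∷ v))) c)
  ... | rest _ s i _ with LAllₚ.++⁻ʳ (pre ++ x ∷ []) i | LAllₚ.++⁻ʳ pre (LAllₚ.++⁻ˡ (pre ++ x ∷ []) i) | Sh-out s
  ...   | (yl , yh) ∷ [] | (xl , xh) ∷ [] | inj₁ zl ∷ _ = case bet of λ
            { (inj₁ (p , q)) → <⇒≱ zl (≤-trans xl p) ; (inj₂ (p , q)) → <⇒≱ zl (≤-trans yl p) }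
  ...   | (yl , yh) ∷ [] | (xl , xh) ∷ [] | inj₂ zh ∷ _ = case bet of λ
            { (inj₁ (p , q)) → <⇒≱ zh (≤-trans q yh) ; (inj₂ (p , q)) → <⇒≱ zh (≤-trans q xh) }

  ClassW-nonrepeating : ∀ pre x y z v → val x ≡ val z → ¬ ClassW (pre ++ x ∷ y ∷ z ∷ v)
  ClassW-nonrepeating pre x y z v e c with ≤-total (val x) (val y)
  ... | inj₁ p = ClassW-extreme pre x y z v c (inj₁ (≤-reflexive e , subst (_≤ val y) e p))
  ... | inj₂ p = ClassW-extreme pre x y z v c (inj₂ (subst (val y ≤_) e p , ≤-reflexive (sym e)))

  -- After B the interval grows once at each end. The two extensions commute, since each prime is
  -- attached to a gap at its own end and does not see the other.
  ClassW-bca : ∀ pre v A B C → val A < val B → val B < val C →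
               ClassW (pre ++ B ∷ C ∷ A ∷ v) → ClassW (pre ++ B ∷ A ∷ C ∷ v)
  ClassW-bca pre v A B C A<B B<C c with ClassW-split₁ pre B c
  ... | rest {a} {hi} _ s i r with s | LAllₚ.++⁻ʳ pre i
  ...   | up (up _) | (_ , B≤hi) ∷ [] =
            contradiction (<-≤-trans A<B B≤hi) (<⇒≯ (iv-mono-< (m<n⇒m<1+n (n<1+n hi))))
  ...   | up (dn t) | _ = subst ClassW (L.++-assoc pre _ _) (r (dn (up t)))
  ...   | dn _ | (lo≤B , _) ∷ [] = contradiction (<-≤-trans (iv-suc D _) lo≤B) (<⇒≯ B<C)

  ClassW-bac : ∀ pre v A B C → val A < val B → val B < val C →
               ClassW (pre ++ B ∷ A ∷ C ∷ v) → ClassW (pre ++ B ∷ C ∷ A ∷ v)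
  ClassW-bac pre v A B C A<B B<C c with ClassW-split₁ pre B c
  ... | rest {a} {hi} _ s i r with s | LAllₚ.++⁻ʳ pre i
  ...   | dn (dn _) | (lo≤B , _) ∷ [] =
            contradiction (<-≤-trans (iv-mono-< (m<n⇒m<1+n (n<1+n _))) lo≤B) (<⇒≯ B<C)
  ...   | dn (up t) | _ = subst ClassW (L.++-assoc pre _ _) (r (up (dn t)))
  ...   | up _ | (_ , B≤hi) ∷ [] = contradiction (<-≤-trans A<B B≤hi) (<⇒≯ (iv-suc D _))

  ClassW-prime : ∀ {m p q v} → ClassW (lt m p ∷ v) → ClassW (lt m q ∷ v)
  ClassW-prime (start s) = start s

  -- The first two letters are neighbouring entries, and the gap between them owns the second prime
  -- whichever of the two comes second. All four initial relations on two letters are instances.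
  ClassW-swap : ∀ {m m′ p q v} → ClassW (lt m p ∷ lt m′ q ∷ v) → ClassW (lt m′ p ∷ lt m q ∷ v)
  ClassW-swap (start (up s)) = start (dn s)
  ClassW-swap (start (dn s)) = start (up s)

  ClassW-step : ∀ {w w′} → SymClosure OStep w w′ → ClassW w → ClassW w′
  ClassW-step (fwd (knuth-acb u v A B C p q)) c =
    ⊥-elim (ClassW-extreme u A C B v c (inj₁ (<⇒≤ p , <⇒≤ q)))
  ClassW-step (bwd (knuth-acb u v A B C p q)) c =
    ⊥-elim (ClassW-extreme u C A B v c (inj₂ (<⇒≤ p , <⇒≤ q)))
  ClassW-step (fwd (knuth-bca u v A B C p q)) c = ClassW-bca u v A B C p q c
  ClassW-step (bwd (knuth-bca u v A B C p q)) c = ClassW-bac u v A B C p q c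
  ClassW-step (fwd (br-aba u v a b _)) c = ⊥-elim (ClassW-nonrepeating u _ _ _ v refl c)
  ClassW-step (bwd (br-aba u v a b _)) c = ⊥-elim (ClassW-nonrepeating u _ _ _ v refl c)
  ClassW-step (fwd (br-a'b'a' u v a b _)) c = ⊥-elim (ClassW-nonrepeating u _ _ _ v refl c)
  ClassW-step (bwd (br-a'b'a' u v a b _)) c = ⊥-elim (ClassW-nonrepeating u _ _ _ v refl c)
  ClassW-step (fwd (br-a'ba u v a b _)) c = ⊥-elim (ClassW-nonrepeating u _ _ _ v refl c)
  ClassW-step (bwd (br-a'ba u v a b _)) c = ⊥-elim (ClassW-nonrepeating u _ _ _ v refl c)
  ClassW-step (fwd (br-ab'a u v a b _)) c = ⊥-elim (ClassW-nonrepeating u _ _ _ v refl c)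
  ClassW-step (bwd (br-ab'a u v a b _)) c = ⊥-elim (ClassW-nonrepeating u _ _ _ v refl c)
  ClassW-step (fwd (br-a'b'a u v a b _)) c = ⊥-elim (ClassW-nonrepeating u _ _ _ v refl c)
  ClassW-step (bwd (br-a'b'a u v a b _)) c = ⊥-elim (ClassW-nonrepeating u _ _ _ v refl c)
  ClassW-step (fwd (br-a'ba' u v a b _)) c = ⊥-elim (ClassW-nonrepeating u _ _ _ v refl c)
  ClassW-step (bwd (br-a'ba' u v a b _)) c = ⊥-elim (ClassW-nonrepeating u _ _ _ v refl c)
  ClassW-step (fwd (ini-a _ _)) c = ClassW-prime c
  ClassW-step (bwd (ini-a _ _)) c = ClassW-prime c
  ClassW-step (fwd (ini-ab _ _ _)) c = ClassW-swap c
  ClassW-step (bwd (ini-ab _ _ _)) c = ClassW-swap c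
  ClassW-step (fwd (ini-ab' _ _ _)) c = ClassW-swap c
  ClassW-step (bwd (ini-ab' _ _ _)) c = ClassW-swap c
  ClassW-step (fwd (ini-a'b _ _ _)) c = ClassW-swap c
  ClassW-step (bwd (ini-a'b _ _ _)) c = ClassW-swap c
  ClassW-step (fwd (ini-a'b' _ _ _)) c = ClassW-swap c
  ClassW-step (bwd (ini-a'b' _ _ _)) c = ClassW-swap c

  ClassW-∼O : ∀ {w w′} → w ∼O w′ → ClassW w → ClassW w′
  ClassW-∼O ε c = c
  ClassW-∼O (s ◅ ss) c = ClassW-∼O ss (ClassW-step s c)

  -- The next new minimum can be moved to the front by the relation BCA ~ BAC.
  minimum-first : ∀ {a hi u} → Sh (suc a) hi u → ∃ λ u′ → Sh a hi u′ ×
    (∀ pre B → iv D (suc a) < val B → val B ≤ iv D hi →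
      (pre ++ B ∷ u) ∼O (pre ++ B ∷ lt (iv D (suc a)) (g D (suc a)) ∷ u′))
  minimum-first (dn s) = _ , s , λ _ _ _ _ → ε
  minimum-first {a} {hi} (up s) with minimum-first s
  ... | u′ , s′ , conn = _ , up s′ , λ pre B A<B B≤hi →
    subst₂ _∼O_ (L.++-assoc pre (B ∷ []) _) (L.++-assoc pre (B ∷ []) _)
      (conn (pre ++ B ∷ []) (lt (iv D (suc hi)) (g D hi)) (<-trans A<B (≤-<-trans B≤hi (iv-suc D hi))) ≤-refl)
    ◅◅ fwd (knuth-bca pre u′ _ B _ A<B (≤-<-trans B≤hi (iv-suc D hi))) ◅ ε

  remove-prime : ∀ m p v → (lt m p ∷ v) ∼O (lt m false ∷ v)
  remove-prime m false v = ε
  remove-prime m true  v = bwd (ini-a v m) ◅ ε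

  swap-first : ∀ m m′ q v → (lt m false ∷ lt m′ q ∷ v) ∼O (lt m′ false ∷ lt m q ∷ v)
  swap-first m m′ false v = fwd (ini-ab v m m′) ◅ ε
  swap-first m m′ true  v = fwd (ini-ab' v m m′) ◅ ε

  -- The next minimum is brought to second place and exchanged with the first letter, which lowers a
  -- by one. At a = 0 only new maxima are left, so by `Sh0-unique` all words of the class reach the
  -- same form.
  increasing-form : ∀ a {p u} → Sh a (suc a) u →
    ∃ λ v → Sh 0 1 v × ((lt (iv D (suc a)) p ∷ u) ∼O (lt (iv D 1) false ∷ v))
  increasing-form zero {p} s = _ , s , remove-prime _ p _
  increasing-form (suc a) {p} s with minimum-first s
  ... | u′ , s′ , conn with increasing-form a {false} (up s′)
  ...   | v , t , e = v , t ,
    (remove-prime _ p _ ◅◅ conn [] (lt (iv D (suc (suc a))) false) (iv-suc D _) ≤-refl ◅◅ swap-first _ _ _ _ ◅◅ e)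

  Sh0-unique : ∀ {hi u v} → Sh 0 hi u → Sh 0 hi v → u ≡ v
  Sh0-unique done done = refl
  Sh0-unique done (up t) = contradiction (Sh-bound t) (<⇒≱ (n<1+n _))
  Sh0-unique (up s) done = contradiction (Sh-bound s) (<⇒≱ (n<1+n _))
  Sh0-unique (up s) (up t) = cong (_ ∷_) (Sh0-unique s t)

  ClassW-connected : ∀ {w w′} → ClassW w → ClassW w′ → w ∼O w′
  ClassW-connected (start s) (start t) with increasing-form _ s | increasing-form _ t
  ... | u , su , eu | v , sv , ev rewrite Sh0-unique su sv = eu ◅◅ Eq.symmetric _ ev

-- The involution produced by a word of the class

FixesPair : (ℕ → ℕ) → ℕ → Set
FixesPair z m = z m ≡ m × z (suc m) ≡ suc m

-- Under the ascent condition, preserving the pair means fixing both of its points. Hence the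
-- multiplication branch of `step` is taken exactly for `FixesPair`, which is also what a primed
-- letter demands.
inPair-increasing : ∀ {m x y} → inPair m x ∧ inPair m y ≡ true → x < y → x ≡ m × y ≡ suc m
inPair-increasing {m} {x} {y} e x<y with x ≟ m | x ≟ suc m | y ≟ m | y ≟ suc m
... | yes p | _ | _ | yes q = p , q
... | yes refl | _ | yes refl | _ = contradiction x<y (<-irrefl refl)
... | no p | yes refl | yes refl | _ = contradiction x<y (<⇒≯ (n<1+n m))
... | no p | yes refl | _ | yes refl = contradiction x<y (<-irrefl refl)
... | no p | no q | _ | _ rewrite ≡ᵇ-false p | ≡ᵇ-false q = case e of λ ()
... | yes refl | _ | no p | no q rewrite ≡ᵇ-false p | ≡ᵇ-false q | ≡ᵇ-true {x} refl = case e of λ ()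
... | no _ | yes refl | no p | no q rewrite ≡ᵇ-false p | ≡ᵇ-false q | ≡ᵇ-true {m} refl
    | ≡ᵇ-false {suc m} {m} 1+n≢n = case e of λ ()

step-fixed : ∀ {z m p} → 1 ≤ m → FixesPair z m → step z (lt m p) ≡ just (λ x → swap m (z x))
step-fixed {z} {suc j} {p} _ (e₁ , e₂) rewrite e₁ | e₂ | <ᵇ-true (n<1+n j) | ≡ᵇ-true {j} refl
  | ≡ᵇ-false {suc j} {j} 1+n≢n | ∧-zeroʳ p = refl

step-conjugate : ∀ z {m} → 1 ≤ m → z m < z (suc m) → ¬ FixesPair z m →
                 step z (lt m false) ≡ just (λ x → swap m (z (swap m x)))
step-conjugate z {suc j} _ asc nf rewrite <ᵇ-true asc
  with inPair (suc j) (z (suc j)) ∧ inPair (suc j) (z (suc (suc j))) in e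
... | true  = contradiction (inPair-increasing e asc) nf
... | false = refl

record StepView (z : ℕ → ℕ) (m : ℕ) (p : Bool) (z′ : ℕ → ℕ) : Set where
  constructor sv
  field
    1≤m   : 1 ≤ m
    asc   : z m < z (suc m)
    prime : p ≡ true → FixesPair z m
    value : (FixesPair z m × z′ ≡ (λ x → swap m (z x))) ⊎
            (¬ FixesPair z m × z′ ≡ (λ x → swap m (z (swap m x))))

stepView : ∀ {z m p z′} → step z (lt m p) ≡ just z′ → StepView z m p z′
stepView {z} {suc j} {p} e with z (suc j) <? z (suc (suc j))
... | no na rewrite <ᵇ-false na = case e of λ ()
... | yes asc with z (suc j) ≟ suc j | z (suc (suc j)) ≟ suc (suc j)
...   | yes f₁ | yes f₂ =
        sv (s≤s z≤n) asc (λ _ → f₁ , f₂)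
           (inj₁ ((f₁ , f₂) , just-injective (trans (sym e) (step-fixed {z} {suc j} {p} (s≤s z≤n) (f₁ , f₂)))))
stepView {z} {suc j} {false} e | yes asc | no n | _ =
  sv (s≤s z≤n) asc (λ ()) (inj₂ ((λ f → n (proj₁ f)) ,
    just-injective (trans (sym e) (step-conjugate z (s≤s z≤n) asc (λ f → n (proj₁ f))))))
stepView {z} {suc j} {true} e | yes asc | no n | _ rewrite <ᵇ-true asc | ≡ᵇ-false n = case e of λ ()
stepView {z} {suc j} {false} e | yes asc | yes _ | no n =
  sv (s≤s z≤n) asc (λ ()) (inj₂ ((λ f → n (proj₂ f)) ,
    just-injective (trans (sym e) (step-conjugate z (s≤s z≤n) asc (λ f → n (proj₂ f))))))
stepView {z} {suc j} {true} e | yes asc | yes f₁ | no n rewrite <ᵇ-true asc | ≡ᵇ-true f₁ | ≡ᵇ-false n = case e of λ ()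

runFrom-step : ∀ z l {z′} w → step z l ≡ just z′ → runFrom z (l ∷ w) ≡ runFrom z′ w
runFrom-step z l w e with step z l
runFrom-step z l w refl | just _ = refl

-- The Boolean selects the branch of `step`: conjugation for an entry adjacent to one already used,
-- multiplication for a separated one.
ext : ℕ → Bool → (ℕ → ℕ) → ℕ → ℕ
ext j true  z x = swap j (z (swap j x))
ext j false z x = swap j (z x)

ext-cong : ∀ j b {z z′} → z ≗ z′ → ext j b z ≗ ext j b z′
ext-cong j true  e x = cong (swap j) (e _)
ext-cong j false e x = cong (swap j) (e _)

ext-comm : ∀ {i j} b c z → suc i < j → ext i b (ext j c z) ≗ ext j c (ext i b z)
ext-comm {i} {j} true  true  z p x =
  trans (swap-comm p (z (swap j (swap i x)))) (cong (swap j ∘ swap i ∘ z) (sym (swap-comm p x)))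
ext-comm {i} {j} true  false z p x = swap-comm p (z (swap i x))
ext-comm {i} {j} false true  z p x = swap-comm p (z (swap j x))
ext-comm {i} {j} false false z p x = swap-comm p (z x)

module _ (D : Spec) where

  adjacent : ℕ → Bool
  adjacent c = suc (iv D c) ≡ᵇ iv D (suc c)

  -- The involution reached once the entries with indices a+1, ..., a+1+t have been used.
  reached : ℕ → ℕ → ℕ → ℕ
  reached a zero    = swap (iv D (suc a))
  reached a (suc t) = ext (iv D (suc t + suc a)) (adjacent (t + suc a)) (reached a t)

  -- `reached` adds entries at the upper end, so this is what makes the involution independent of
  -- the order of growth. For two entries it is the braid relation or a commutation. With more
  -- entries the two ends are far enough apart to commute.
  reached-extend-left : ∀ a t →
    ext (iv D (suc a)) (adjacent (suc a)) (reached (suc a) t) ≗ reached a (suc t)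
  reached-extend-left a zero x with suc (iv D (suc a)) ≟ iv D (suc (suc a))
  ... | yes e rewrite ≡ᵇ-true e | sym e = swap-braid (iv D (suc a)) x
  ... | no n rewrite ≡ᵇ-false n = swap-comm (≤∧≢⇒< (iv-suc D (suc a)) n) x
  reached-extend-left a (suc t) x =
    trans (ext-comm (adjacent (suc a)) (adjacent (t + suc (suc a))) (reached (suc a) t)
             (≤-<-trans (iv-suc D (suc a)) (iv-mono-< D (s≤s (m≤n+m (suc (suc a)) t)))) x)
      (trans (ext-cong (iv D (suc (t + suc (suc a)))) (adjacent (t + suc (suc a))) (reached-extend-left a t) x)
        (cong (λ s → ext (iv D (suc s)) (adjacent s) (reached a (suc t)) x) (+-suc t (suc a))))

  -- Exactly what the next `step` inspects. The fixed points outside decide the case of a separated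
  -- entry; `top` and `bot` give the ascent, and refute that both points are fixed, for an adjacent
  -- one.
  record Reached (a hi : ℕ) (z : ℕ → ℕ) : Set where
    field
      below : ∀ {x} → x < iv D (suc a) → z x ≡ x
      above : ∀ {x} → suc (iv D hi) < x → z x ≡ x
      top   : z (suc (iv D hi)) < suc (iv D hi)
      bot   : iv D (suc a) < z (iv D (suc a))
  open Reached

  reached-Reached : ∀ a t → Reached a (t + suc a) (reached a t)
  reached-Reached a zero = record
    { below = swap-below
    ; above = swap-above
    ; top   = subst (_< suc (iv D (suc a))) (sym (swap-r _)) (n<1+n _)
    ; bot   = subst (iv D (suc a) <_) (sym (swap-l _)) (n<1+n _) }
  reached-Reached a (suc t) with suc (iv D (t + suc a)) ≟ iv D (suc t + suc a)
  ... | yes e rewrite ≡ᵇ-true e = record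
    { below = λ x<A → trans (cong (swap j ∘ reached a t) (swap-below (<-trans x<A A<j)))
                        (trans (cong (swap j) (below IH x<A)) (swap-below (<-trans x<A A<j)))
    ; above = λ j<x → trans (cong (swap j ∘ reached a t) (swap-above j<x))
                        (trans (cong (swap j) (above IH (<-trans (s≤s (iv-suc D _)) j<x))) (swap-above j<x))
    ; top   = subst (_< suc j) (sym (trans (cong (swap j ∘ reached a t) (swap-r j)) (swap-below zj<j)))
                (m<n⇒m<1+n zj<j)
    ; bot   = subst (A <_) (cong (swap j ∘ reached a t) (sym (swap-below A<j))) (swap-> A<j (bot IH)) }
    where
      IH = reached-Reached a t
      A j : ℕ
      A = iv D (suc a)
      j = iv D (suc t + suc a)
      A<j : A < j
      A<j = iv-mono-< D (s≤s (m≤n+m (suc a) t))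
      zj<j : reached a t j < j
      zj<j = subst (λ y → reached a t y < y) e (top IH)
  ... | no n rewrite ≡ᵇ-false n = record
    { below = λ x<A → trans (cong (swap _) (below IH x<A)) (swap-below (<-trans x<A A<j))
    ; above = λ j<x → trans (cong (swap _) (above IH (<-trans B<j (<⇒≤ j<x)))) (swap-above j<x)
    ; top   = subst (_< suc j) (sym (trans (cong (swap j) (above IH (m<n⇒m<1+n B<j))) (swap-r j))) (n<1+n j)
    ; bot   = swap-> A<j (bot IH) }
    where
      IH = reached-Reached a t
      A j : ℕ
      A = iv D (suc a)
      j = iv D (suc t + suc a)
      A<j : A < j
      A<j = iv-mono-< D (s≤s (m≤n+m (suc a) t))
      B<j : suc (iv D (t + suc a)) < j
      B<j = ≤∧≢⇒< (iv-suc D (t + suc a)) n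

  Reached-resp : ∀ {a hi z z′} → z ≗ z′ → Reached a hi z′ → Reached a hi z
  Reached-resp {a} {hi} e r = record
    { below = λ p → trans (e _) (below r p)
    ; above = λ p → trans (e _) (above r p)
    ; top   = subst (_< suc (iv D hi)) (sym (e _)) (top r)
    ; bot   = subst (iv D (suc a) <_) (sym (e _)) (bot r) }

  step-up : ∀ {a hi z} → Reached a hi z →
            ∃ λ z′ → step z (lt (iv D (suc hi)) (g D hi)) ≡ just z′ × z′ ≗ ext (iv D (suc hi)) (adjacent hi) z
  step-up {a} {hi} {z} r with suc (iv D hi) ≟ iv D (suc hi)
  ... | no n rewrite ≡ᵇ-false n =
    _ , step-fixed (iv-positive D hi) (above r B<j , above r (m<n⇒m<1+n B<j)) , λ _ → refl
    where B<j = ≤∧≢⇒< (iv-suc D hi) n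
  ... | yes e with g D hi in eg
  -- An adjacent entry is conjugated and may carry no prime, which is what `gap` provides.
  ...   | true = contradiction (gap D hi eg) (<-irrefl e)
  ...   | false rewrite ≡ᵇ-true e | sym e =
    _ , step-conjugate z (s≤s z≤n)
          (<-trans (top r) (subst (suc (iv D hi) <_) (sym (above r (n<1+n _))) (n<1+n _)))
          (λ { (f , _) → <⇒≢ (top r) f }) , λ _ → refl

  step-dn : ∀ {a hi z} → Reached (suc a) hi z →
            ∃ λ z′ → step z (lt (iv D (suc a)) (g D (suc a))) ≡ just z′ × z′ ≗ ext (iv D (suc a)) (adjacent (suc a)) z
  step-dn {a} {hi} {z} r with suc (iv D (suc a)) ≟ iv D (suc (suc a))
  ... | no n rewrite ≡ᵇ-false n =
    _ , step-fixed (iv-positive D a) (below r (iv-suc D _) , below r (≤∧≢⇒< (iv-suc D _) n)) , λ _ → refl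
  ... | yes e with g D (suc a) in eg
  ...   | true = contradiction (gap D (suc a) eg) (<-irrefl e)
  ...   | false rewrite ≡ᵇ-true e =
    _ , step-conjugate z (iv-positive D a)
          (subst₂ _<_ (sym (below r (iv-suc D _))) (cong z (sym e))
            (<-trans (subst (iv D (suc a) <_) e (n<1+n _)) (bot r)))
          (λ { (_ , f) → >⇒≢ (bot r) (trans (cong z (sym e)) (trans f e)) }) , λ _ → refl

  runFrom-Sh : ∀ {a hi u} t {z} → Sh D a hi u → hi ≡ t + suc a → z ≗ reached a t →
               ∃ λ f → runFrom z u ≡ just f × f ≗ reached 0 (k D ∸ 1)
  runFrom-Sh t {z} done e z≗ rewrite e =
    -- Here a = 0 and k = t + 1, whence the index `k D ∸ 1` in the conclusion.
    z , refl , λ x → trans (z≗ x) (cong (λ s → reached 0 s x) (sym (m+n∸n≡m t 1)))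
  runFrom-Sh {a} t {z} (up {u = u} s) refl z≗ with step-up (Reached-resp z≗ (reached-Reached a t))
  ... | z′ , e , z′≗ with runFrom-Sh (suc t) s refl
                            (λ x → trans (z′≗ x) (ext-cong (iv D (suc (t + suc a))) (adjacent (t + suc a)) z≗ x))
  ...   | f , r , f≗ = f , trans (runFrom-step z (lt (iv D (suc (t + suc a))) (g D (t + suc a))) u e) r , f≗
  runFrom-Sh t {z} (dn {a} {u = u} s) refl z≗ with step-dn (Reached-resp z≗ (reached-Reached (suc a) t))
  ... | z′ , e , z′≗ with runFrom-Sh (suc t) s (+-suc t (suc a))
                            (λ x → trans (z′≗ x) (trans (ext-cong (iv D (suc a)) (adjacent (suc a)) z≗ x)
                                     (reached-extend-left a t x)))
  ...   | f , r , f≗ = f , trans (runFrom-step z (lt (iv D (suc a)) (g D (suc a))) u e) r , f≗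

  ClassW-run : ∀ {w} → ClassW D w → ∃ λ f → runFrom (λ x → x) w ≡ just f × f ≗ reached 0 (k D ∸ 1)
  ClassW-run (start {a} {p} {u} s)
    with runFrom-Sh 0 {swap (iv D (suc a))} s refl (λ _ → refl)
  ... | f , r , f≗ = f , trans (runFrom-step (λ x → x) (lt (iv D (suc a)) p) u (step-fixed {λ x → x} {p = p} (iv-positive D a) (refl , refl))) r , f≗

  InvWordO-value : ∀ {z w} → ClassW D w → InvWordO z w → ∀ x → 1 ≤ x → reached 0 (k D ∸ 1) x ≡ z x
  InvWordO-value c (f , r , f≈z) x 1≤x with ClassW-run c
  ... | f′ , r′ , f′≗ rewrite just-injective (trans (sym r) r′) = trans (sym (f′≗ x)) (f≈z x 1≤x)

  ClassW-InvWordO : ∀ {z w} → (∀ x → 1 ≤ x → reached 0 (k D ∸ 1) x ≡ z x) → ClassW D w → InvWordO z w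
  ClassW-InvWordO e c with ClassW-run c
  ... | f , r , f≗ = f , r , λ x 1≤x → trans (f≗ x) (e x 1≤x)

-- Reading entries and gap flags off a one-row tableau

key-< : ∀ {m v} p q → m < v → key (lt m p) < key (lt v q)
key-< {m} {suc v} p q (s≤s m≤v) = ≤-<-trans (upper p) (<-≤-trans mid (lower′ q))
  where
    upper : ∀ p → key (lt m p) ≤ 2 * m
    upper false = ≤-refl
    upper true  = m∸n≤m (2 * m) 1
    mid : 2 * m < 2 * suc v ∸ 1
    mid = +-mono-≤-< m≤v (s≤s (+-monoˡ-≤ 0 m≤v))
    lower′ : ∀ q → 2 * suc v ∸ 1 ≤ key (lt (suc v) q)
    lower′ false = m∸n≤m (2 * suc v) 1
    lower′ true  = ≤-refl

key-cancel : ∀ {m v} p q → key (lt m p) < key (lt v q) → m ≤ v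
key-cancel p q e = ≮⇒≥ (λ v<m → <-asym e (key-< q p v<m))

runFrom-∷ : ∀ {z l w f} → runFrom z (l ∷ w) ≡ just f → ∃ λ z′ → step z l ≡ just z′ × runFrom z′ w ≡ just f
runFrom-∷ {z} {l} e with step z l
... | just z′ = z′ , refl , e

-- The condition on primed letters is the future `gap`: a primed entry is not adjacent to its
-- predecessor.
IncFrom : ℕ → List Letter → Set
IncFrom v []       = ⊤
IncFrom v (l ∷ ls) = v < val l × (primed l ≡ true → suc v < val l) × IncFrom (val l) ls

DecFrom : ℕ → List Letter → Set
DecFrom v []       = ⊤
DecFrom v (l ∷ ls) = val l < v × (primed l ≡ true → suc (val l) < v) × 1 ≤ val l × DecFrom (val l) ls

-- `StrictInc` compares keys and so admits one value twice, primed and then unprimed; the descent of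
-- `z` at the previous letter rules this out. A primed letter needs two fixed points, and
-- `z (suc v) < suc v` denies them to an adjacent one.
incFrom : ∀ z v q ls {f} → (∀ {x} → suc v < x → z x ≡ x) → z (suc v) < suc v → z (suc v) < z v →
          StrictInc (lt v q ∷ ls) → runFrom z ls ≡ just f → IncFrom v ls
incFrom z v q [] ab tp ds si e = tt
incFrom z v q (lt m p ∷ ls) ab tp ds (k< , si) e with runFrom-∷ {z} {lt m p} e
... | z′ , e₁ , e₂ with stepView {z} {m} {p} e₁ | m≤n⇒m<n∨m≡n (key-cancel q p k<)
...   | sv _ asc _ _ | inj₂ refl = contradiction asc (<⇒≯ ds)
...   | sv _ asc pr (inj₁ ((f₁ , f₂) , refl)) | inj₁ v<m =
        v<m , (λ _ → v+1<m) ,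
        incFrom z′ m p ls (λ m<x → trans (cong (swap m) (ab (<-trans v+1<m (<⇒≤ m<x)))) (swap-above m<x))
          (subst (_< suc m) (sym e-r) (n<1+n m)) (subst₂ _<_ (sym e-r) (sym e-l) (n<1+n m)) si e₂
        where
          v+1<m : suc v < m
          v+1<m = ≤∧≢⇒< v<m (λ { refl → <⇒≢ tp f₁ })
          e-r : swap m (z (suc m)) ≡ m
          e-r = trans (cong (swap m) f₂) (swap-r m)
          e-l : swap m (z m) ≡ suc m
          e-l = trans (cong (swap m) f₁) (swap-l m)
...   | sv _ asc pr (inj₂ (nf , refl)) | inj₁ v<m with m≤n⇒m<n∨m≡n v<m
...     | inj₁ v+1<m = contradiction (ab v+1<m , ab (m<n⇒m<1+n v+1<m)) nf
...     | inj₂ refl =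
        v<m , (λ t → contradiction (pr t) nf) ,
        incFrom z′ m p ls
          (λ m<x → trans (cong (swap m ∘ z) (swap-above m<x)) (trans (cong (swap m) (ab (<⇒≤ m<x))) (swap-above m<x)))
          (subst (_< suc m) (sym e-r) (m<n⇒m<1+n tp)) (subst₂ _<_ (sym e-r) (sym e-l) tp) si e₂
        where
          e-r : swap m (z (swap m (suc m))) ≡ z m
          e-r = trans (cong (swap m ∘ z) (swap-r m)) (swap-below tp)
          e-l : swap m (z (swap m m)) ≡ m
          e-l = trans (cong (swap m ∘ z) (swap-l m)) (trans (cong (swap m) (ab (n<1+n m))) (swap-r m))

decFrom : ∀ z v q ls {f} → (∀ {x} → x < v → z x ≡ x) → v < z v → z (suc v) < z v →
          StrictDec (lt v q ∷ ls) → runFrom z ls ≡ just f → DecFrom v ls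
decFrom z v q [] be bt ds sd e = tt
decFrom z v q (lt m p ∷ ls) be bt ds (k< , sd) e with runFrom-∷ {z} {lt m p} e
... | z′ , e₁ , e₂ with stepView {z} {m} {p} e₁ | m≤n⇒m<n∨m≡n (key-cancel p q k<)
...   | sv _ asc _ _ | inj₂ refl = contradiction asc (<⇒≯ ds)
...   | sv 1≤m asc pr (inj₁ ((f₁ , f₂) , refl)) | inj₁ m<v =
        m<v , (λ _ → m+1<v) , 1≤m ,
        decFrom z′ m p ls (λ x<m → trans (cong (swap m) (be (<-trans x<m m<v))) (swap-below x<m))
          (subst (m <_) (sym e-l) (n<1+n m)) (subst₂ _<_ (sym e-r) (sym e-l) (n<1+n m)) sd e₂
        where
          m+1<v : suc m < v
          m+1<v = ≤∧≢⇒< m<v (λ { refl → >⇒≢ bt f₂ })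
          e-r : swap m (z (suc m)) ≡ m
          e-r = trans (cong (swap m) f₂) (swap-r m)
          e-l : swap m (z m) ≡ suc m
          e-l = trans (cong (swap m) f₁) (swap-l m)
...   | sv 1≤m asc pr (inj₂ (nf , refl)) | inj₁ m<v with m≤n⇒m<n∨m≡n m<v
...     | inj₁ m+1<v = contradiction (be m<v , be m+1<v) nf
...     | inj₂ refl =
        m<v , (λ t → contradiction (pr t) nf) , 1≤m ,
        decFrom z′ m p ls
          (λ x<m → trans (cong (swap m ∘ z) (swap-below x<m)) (trans (cong (swap m) (be (<-trans x<m m<v))) (swap-below x<m)))
          (subst (m <_) (sym e-l) (<-trans m<v bt)) (subst₂ _<_ (sym e-r) (sym e-l) bt) sd e₂
        where
          e-r : swap m (z (swap m (suc m))) ≡ suc m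
          e-r = trans (cong (swap m ∘ z) (swap-r m)) (trans (cong (swap m) (be m<v)) (swap-l m))
          e-l : swap m (z (swap m m)) ≡ z (suc m)
          e-l = trans (cong (swap m ∘ z) (swap-l m)) (swap-above bt)

-- Index 0 holds the starting value, so that entries are numbered from 1. Past the last entry the
-- values continue in steps of 1 to remain strictly increasing.
ivInc : ℕ → List Letter → ℕ → ℕ
ivInc v []       c       = c + v
ivInc v (l ∷ ls) zero    = v
ivInc v (l ∷ ls) (suc c) = ivInc (val l) ls c

-- In an increasing row the upper entry of a gap comes second, so it is the one whose prime becomes
-- the flag.
gInc : List Letter → ℕ → Bool
gInc []       c       = false
gInc (l ∷ ls) zero    = primed l
gInc (l ∷ ls) (suc c) = gInc ls c

ivInc-zero : ∀ v ls → ivInc v ls 0 ≡ v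
ivInc-zero v []      = refl
ivInc-zero v (_ ∷ _) = refl

ivInc-suc : ∀ v ls → IncFrom v ls → ∀ c → ivInc v ls c < ivInc v ls (suc c)
ivInc-suc v []       _             c       = n<1+n _
ivInc-suc v (l ∷ ls) (v<l , _ , _) zero    = subst (v <_) (sym (ivInc-zero (val l) ls)) v<l
ivInc-suc v (l ∷ ls) (_ , _ , inc) (suc c) = ivInc-suc (val l) ls inc c

ivInc-gap : ∀ v ls → IncFrom v ls → ∀ c → gInc ls c ≡ true → suc (ivInc v ls c) < ivInc v ls (suc c)
ivInc-gap v (l ∷ ls) (_ , g , _)   zero    e = subst (suc v <_) (sym (ivInc-zero (val l) ls)) (g e)
ivInc-gap v (l ∷ ls) (_ , _ , inc) (suc c) e = ivInc-gap (val l) ls inc c e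

specInc : ∀ t r → IncFrom 0 (t ∷ r) → Spec
specInc t r inc = record
  { k = length (t ∷ r) ; iv = ivInc 0 (t ∷ r) ; g = gInc (t ∷ r) ; 1≤k = s≤s z≤n
  ; iv-suc = ivInc-suc 0 (t ∷ r) inc ; gap = ivInc-gap 0 (t ∷ r) inc }

Sh-increasing : ∀ D c v ls → (∀ j → iv D (j + c) ≡ ivInc v ls j) → (∀ j → g D (j + c) ≡ gInc ls j) →
                length ls + c ≡ k D → Sh D 0 c ls
Sh-increasing D c v [] _ _ refl = done
Sh-increasing D c v (lt m p ∷ ls) ei eg ek =
  subst₂ (λ x q → Sh D 0 c (lt x q ∷ ls)) (trans (ei 1) (ivInc-zero m ls)) (eg 0)
    (up (Sh-increasing D (suc c) m ls (λ j → trans (cong (iv D) (+-suc j c)) (ei (suc j)))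
          (λ j → trans (cong (g D) (+-suc j c)) (eg (suc j))) (trans (+-suc (length ls) c) ek)))

ClassW-increasing : ∀ t r (inc : IncFrom 0 (t ∷ r)) → ClassW (specInc t r inc) (t ∷ r)
ClassW-increasing t@(lt m p) r inc =
  subst (λ x → ClassW D (lt x p ∷ r)) (ivInc-zero m r)
    (start (Sh-increasing D 1 m r (λ j → cong (ivInc 0 (t ∷ r)) (+-comm j 1))
      (λ j → cong (gInc (t ∷ r)) (+-comm j 1)) (+-comm (length r) 1)))
  where D = specInc t r inc

-- A decreasing row ends with its smallest entry, so an index is compared with the number of letters
-- still to come. Indices beyond the row continue in steps of 1, and the empty list puts 0 at index
-- 0.
ivDec : List Letter → ℕ → ℕ
ivDec []       c = c
ivDec (l ∷ ls) c = if c ≤ᵇ length ls then ivDec ls c else (c ∸ suc (length ls)) + val l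

-- In a decreasing row the lower entry of a gap comes second. That is why `specDec` applies this to
-- the tail, where the letter of index c is the lower end of gap c.
gDec : List Letter → ℕ → Bool
gDec []       c = false
gDec (l ∷ ls) c = if c ≡ᵇ suc (length ls) then primed l else gDec ls c

ivDec-≤ : ∀ l {ls c} → c ≤ length ls → ivDec (l ∷ ls) c ≡ ivDec ls c
ivDec-≤ l c≤ rewrite ≤ᵇ-true c≤ = refl

ivDec-length : ∀ l ls → ivDec (l ∷ ls) (suc (length ls)) ≡ val l
ivDec-length l ls rewrite <ᵇ-false (<-irrefl {length ls} refl) | n∸n≡0 (length ls) = refl

ivDec-top : ∀ {v} ls → 1 ≤ v → DecFrom v ls → ivDec ls (length ls) < v
ivDec-top []       1≤v _         = 1≤v
ivDec-top (l ∷ ls) _   (l<v , _) = subst (_< _) (sym (ivDec-length l ls)) l<v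

ivDec-suc : ∀ {v} ls → DecFrom v ls → ∀ c → ivDec ls c < ivDec ls (suc c)
ivDec-suc []       _ c = n<1+n c
ivDec-suc (l ∷ ls) (_ , _ , 1≤l , dec) c with <-cmp c (length ls)
... | tri< c< _ _ rewrite ≤ᵇ-true (<⇒≤ c<) | <ᵇ-true c< = ivDec-suc ls dec c
... | tri≈ _ refl _ = subst₂ _<_ (sym (ivDec-≤ l {ls} ≤-refl)) (sym (ivDec-length l ls)) (ivDec-top ls 1≤l dec)
... | tri> _ _ c> rewrite ≤ᵇ-false (<⇒≱ c>) | <ᵇ-false (<⇒≯ c>) =
  +-monoˡ-< (val l) (∸-monoˡ-< (n<1+n c) c>)

gDec-bound : ∀ ls {c} → gDec ls c ≡ true → c ≤ length ls
gDec-bound (l ∷ ls) {c} e with c ≟ suc (length ls)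
... | yes refl = ≤-refl
... | no n rewrite ≡ᵇ-false n = m≤n⇒m≤1+n (gDec-bound ls e)

ivDec-gap : ∀ {v} t r → DecFrom v (t ∷ r) → ∀ c → gDec r c ≡ true →
            suc (ivDec (t ∷ r) c) < ivDec (t ∷ r) (suc c)
ivDec-gap t (l ∷ ls) (_ , _ , _ , dec@(_ , gp , _ , _)) c e with c ≟ suc (length ls)
... | yes refl rewrite ≡ᵇ-true {length ls} refl =
  subst₂ (λ x y → suc x < y) (sym (trans (ivDec-≤ t {l ∷ ls} ≤-refl) (ivDec-length l ls)))
    (sym (ivDec-length t (l ∷ ls))) (gp e)
... | no n rewrite ≡ᵇ-false n =
  subst₂ (λ x y → suc x < y) (sym (ivDec-≤ t {l ∷ ls} (m≤n⇒m≤1+n c≤))) (sym (ivDec-≤ t {l ∷ ls} (s≤s c≤)))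
    (ivDec-gap l ls dec c e)
  where c≤ = gDec-bound ls e

specDec : ∀ {v} t r → DecFrom v (t ∷ r) → Spec
specDec t r dec = record
  { k = length (t ∷ r) ; iv = ivDec (t ∷ r) ; g = gDec r ; 1≤k = s≤s z≤n
  ; iv-suc = ivDec-suc (t ∷ r) dec ; gap = ivDec-gap t r dec }

Sh-decreasing : ∀ D ls → (∀ {c} → c ≤ length ls → iv D c ≡ ivDec ls c) →
                (∀ {c} → c ≤ length ls → g D c ≡ gDec ls c) → Sh D (length ls) (k D) ls
Sh-decreasing D [] _ _ = done
Sh-decreasing D (lt m p ∷ ls) ei eg =
  subst₂ (λ x q → Sh D (suc (length ls)) (k D) (lt x q ∷ ls))
    (trans (ei ≤-refl) (ivDec-length (lt m p) ls))
    (trans (eg ≤-refl) (cong (λ b → if b then p else gDec ls (suc (length ls))) (≡ᵇ-true {length ls} refl)))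
    (dn (Sh-decreasing D ls (λ c≤ → trans (ei (m≤n⇒m≤1+n c≤)) (ivDec-≤ (lt m p) {ls} c≤))
          (λ {c} c≤ → trans (eg (m≤n⇒m≤1+n c≤)) (cong (λ b → if b then p else gDec ls c) (≡ᵇ-false (<⇒≢ (s≤s c≤)))))))

ClassW-decreasing : ∀ {v} t r (dec : DecFrom v (t ∷ r)) → ClassW (specDec t r dec) (t ∷ r)
ClassW-decreasing t@(lt m p) r dec =
  subst (λ x → ClassW (specDec t r dec) (lt x p ∷ r)) (ivDec-length t r)
    (start (Sh-decreasing (specDec t r dec) r (ivDec-≤ t {r}) (λ _ → refl)))

specOf : ∀ {z T} → OneRowOReduced z T → ∃ λ D → ClassW D T
specOf (lt m false , r , refl , refl , mono , f , run , _) with runFrom-∷ {λ x → x} {lt m false} {r} run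
... | z′ , e₁ , e₂ with stepView {λ x → x} {m} {false} e₁
...   | sv _ _ _ (inj₂ (nf , _)) = contradiction (refl , refl) nf
...   | sv 1≤m _ _ (inj₁ (_ , refl)) with mono
...     | inj₁ si = specInc (lt m false) r inc , ClassW-increasing (lt m false) r inc
  where
    inc : IncFrom 0 (lt m false ∷ r)
    inc = 1≤m , (λ ()) , incFrom (swap m) m false r swap-above
            (subst (_< suc m) (sym (swap-r m)) (n<1+n m))
            (subst₂ _<_ (sym (swap-r m)) (sym (swap-l m)) (n<1+n m)) si e₂
...     | inj₂ sd = specDec (lt m false) r dec , ClassW-decreasing (lt m false) r dec
  where
    dec : DecFrom (suc m) (lt m false ∷ r)
    dec = n<1+n m , (λ ()) , 1≤m , decFrom (swap m) m false r swap-below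
            (subst (m <_) (sym (swap-l m)) (n<1+n m))
            (subst₂ _<_ (sym (swap-r m)) (sym (swap-l m)) (n<1+n m)) sd e₂

-- Involution words of the transposition (1 k+1)

canon : ∀ k → 1 ≤ k → Spec
canon k 1≤k = record
  -- Neighbouring entries differ by 1, so `gap` leaves `false` as the only possible flag.
  { k = k ; iv = id ; g = λ _ → false ; 1≤k = 1≤k ; iv-suc = n<1+n ; gap = λ _ () }

transp : ℕ → ℕ → ℕ → ℕ
transp a b x = if x ≡ᵇ a then b else (if x ≡ᵇ b then a else x)

transp-l : ∀ a b → transp a b a ≡ b
transp-l a b rewrite ≡ᵇ-true {a} refl = refl

transp-r : ∀ {a b} → a ≢ b → transp a b b ≡ a
transp-r {a} {b} n rewrite ≡ᵇ-false (n ∘ sym) | ≡ᵇ-true {b} refl = refl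

transp-other : ∀ {a b x} → x ≢ a → x ≢ b → transp a b x ≡ x
transp-other p q rewrite ≡ᵇ-false p | ≡ᵇ-false q = refl

transp-conjugate-r : ∀ {a j} → a < j → ∀ x → swap j (transp a j (swap j x)) ≡ transp a (suc j) x
transp-conjugate-r {a} {j} a<j x with x ≟ a
... | yes refl = trans (cong (swap j ∘ transp a j) (swap-below a<j))
                   (trans (cong (swap j) (transp-l a j)) (trans (swap-l j) (sym (transp-l a (suc j)))))
... | no x≢a with swapView j x
...   | isL refl e = trans (cong (swap j ∘ transp a j) e)
                       (trans (cong (swap j) (transp-other (>⇒≢ (m<n⇒m<1+n a<j)) 1+n≢n))
                         (trans (swap-r j) (sym (transp-other x≢a (<⇒≢ (n<1+n j))))))
...   | isR refl e = trans (cong (swap j ∘ transp a j) e)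
                       (trans (cong (swap j) (transp-r (<⇒≢ a<j)))
                         (trans (swap-below a<j) (sym (transp-r (<⇒≢ (m<n⇒m<1+n a<j))))))
...   | other p q e = trans (cong (swap j ∘ transp a j) e)
                       (trans (cong (swap j) (transp-other x≢a p))
                         (trans e (sym (transp-other x≢a q))))

transp-conjugate-l : ∀ {a b} → suc a < b → ∀ x → swap a (transp a b (swap a x)) ≡ transp (suc a) b x
transp-conjugate-l {a} {b} a<b x with x ≟ b
... | yes refl = trans (cong (swap a ∘ transp a b) (swap-above a<b))
                   (trans (cong (swap a) (transp-r (<⇒≢ (<⇒≤ a<b))))
                     (trans (swap-l a) (sym (transp-r (<⇒≢ a<b)))))
... | no x≢b with swapView a x
...   | isL refl e = trans (cong (swap a ∘ transp a b) e)
                       (trans (cong (swap a) (transp-other 1+n≢n (<⇒≢ a<b)))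
                         (trans (swap-r a) (sym (transp-other (<⇒≢ (n<1+n a)) x≢b))))
...   | isR refl e = trans (cong (swap a ∘ transp a b) e)
                       (trans (cong (swap a) (transp-l a b))
                         (trans (swap-above a<b) (sym (transp-l (suc a) b))))
...   | other p q e = trans (cong (swap a ∘ transp a b) e)
                       (trans (cong (swap a) (transp-other p x≢b))
                         (trans e (sym (transp-other q x≢b))))

reached-canon : ∀ {k} 1≤k t → reached (canon k 1≤k) 0 t ≗ transp 1 (suc (suc t))
reached-canon 1≤k zero x = refl
reached-canon {k} 1≤k (suc t) x rewrite ≡ᵇ-true {t + 1} refl | +-comm t 1 =
  trans (cong (swap (suc (suc t))) (reached-canon 1≤k t (swap (suc (suc t)) x)))
    (transp-conjugate-r (s≤s (s≤s z≤n)) x)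

-- The same words, grown at the right end. The descents of the final involution reveal the last
-- letter, whereas `ClassW` is built from the front; `Prefix-ClassW` mediates.
data Prefix : ℕ → ℕ → List Letter → Set where
  one : ∀ {a p} → Prefix a (suc a) (lt (suc a) p ∷ [])
  up  : ∀ {a hi w} → Prefix a hi w → Prefix a (suc hi) (w ∷ʳ un (suc hi))
  dn  : ∀ {a hi w} → Prefix (suc a) hi w → Prefix a hi (w ∷ʳ un (suc a))

up′ : ∀ {a w} m → 1 ≤ m → (∀ h → m ≡ suc h → Prefix a h w) → Prefix a m (w ∷ʳ un m)
up′ (suc h) _ f = up (f h refl)

Prefix-ClassW : ∀ {k 1≤k a hi w u} → Prefix a hi w → Sh (canon k 1≤k) a hi u → ClassW (canon k 1≤k) (w ++ u)
Prefix-ClassW one s = start s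
Prefix-ClassW {u = u} (up {w = w} p) s = subst (ClassW _) (sym (L.++-assoc w _ u)) (Prefix-ClassW p (up s))
Prefix-ClassW {u = u} (dn {w = w} p) s = subst (ClassW _) (sym (L.++-assoc w _ u)) (Prefix-ClassW p (dn s))

runFrom-∷ʳ : ∀ {z} w {l f} → runFrom z (w ∷ʳ l) ≡ just f → ∃ λ z′ → runFrom z w ≡ just z′ × step z′ l ≡ just f
runFrom-∷ʳ {z} [] {l} e with step z l in eq
... | just z′ = z , refl , trans eq e
runFrom-∷ʳ {z} (x ∷ w) e with step z x
... | just z′ = runFrom-∷ʳ w e

_≗⁺_ : (ℕ → ℕ) → (ℕ → ℕ) → Set
f ≗⁺ h = ∀ x → 1 ≤ x → f x ≡ h x

run-identity : ∀ w {f} → Reverse w → runFrom (λ x → x) w ≡ just f → f ≗⁺ id → w ≡ []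
run-identity .[] [] _ _ = refl
run-identity .(w ∷ʳ lt m p) {f} (w ∶ _ ∶ʳ lt m p) e f≗ with runFrom-∷ʳ w e
... | z , _ , e₂ with stepView {z} {m} {p} e₂
...   | sv 1≤m _ _ (inj₁ ((f₁ , _) , refl)) =
        contradiction (trans (sym (trans (cong (swap m) f₁) (swap-l m))) (f≗ m 1≤m)) 1+n≢n
...   | sv 1≤m _ _ (inj₂ (nf , refl)) = contradiction (eq₁ , eq₂) nf
  where
    eq₁ : z m ≡ m
    eq₁ = swap-injective m (trans (cong (swap m ∘ z) (sym (swap-r m))) (trans (f≗ (suc m) (s≤s z≤n)) (sym (swap-l m))))
    eq₂ : z (suc m) ≡ suc m
    eq₂ = swap-injective m (trans (cong (swap m ∘ z) (sym (swap-l m))) (trans (f≗ m 1≤m) (sym (swap-r m))))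

-- Only a+1 and hi are descents of the transposition (a+1 hi+1), so the last
-- letter of an involution word for it is the minimum or the maximum.
run-transp : ∀ w {f} a hi → Reverse w → runFrom (λ x → x) w ≡ just f → a < hi →
             f ≗⁺ transp (suc a) (suc hi) → Prefix a hi w
run-transp .[] a hi [] refl a<hi f≗ =
  contradiction (trans (f≗ (suc a) (s≤s z≤n)) (transp-l (suc a) (suc hi))) (<⇒≢ (s≤s a<hi))
run-transp .(w ∷ʳ lt m p) {f} a hi (w ∶ rw ∶ʳ lt m p) e a<hi f≗ with runFrom-∷ʳ w e
... | z , e₁ , e₂ with stepView {z} {m} {p} e₂
run-transp .(w ∷ʳ lt m p) {f} a hi (w ∶ rw ∶ʳ lt m p) e a<hi f≗ | z , e₁ , e₂
  | sv 1≤m asc _ (inj₁ ((f₁ , f₂) , refl)) with m ≟ suc a | m ≟ suc hi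
... | no n | no n′ = contradiction
        (trans (sym (trans (cong (swap m) f₁) (swap-l m))) (trans (f≗ m 1≤m) (transp-other n n′))) 1+n≢n
... | no n | yes refl = contradiction
        (trans (sym (trans (cong (swap m) f₁) (swap-l m))) (trans (f≗ m 1≤m) (transp-r (<⇒≢ (s≤s a<hi)))))
        (>⇒≢ (m<n⇒m<1+n (s≤s a<hi)))
... | yes refl | _ with suc-injective (trans (sym (trans (cong (swap m) f₁) (swap-l m)))
                                        (trans (f≗ m 1≤m) (transp-l (suc a) (suc hi))))
...   | refl with run-identity w rw e₁ (λ x 1≤x → swap-injective m (f≗ x 1≤x))
...     | refl = one
run-transp .(w ∷ʳ lt m p) {f} a hi (w ∶ rw ∶ʳ lt m p) e a<hi f≗ | z , e₁ , e₂
  | sv 1≤m asc pr (inj₂ (nf , refl)) = go p pr (m ≟ suc a) (m ≟ suc hi) (suc m ≟ suc a) (suc m ≟ suc hi)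
  where
    lo b : ℕ
    lo = suc a
    b  = suc hi
    lo<b : lo < b
    lo<b = s≤s a<hi
    z≗ : ∀ x → 1 ≤ x → z x ≡ swap m (transp lo b (swap m x))
    z≗ x 1≤x = trans (sym (swap-involutive m (z x)))
      (cong (swap m) (trans (cong (swap m ∘ z) (sym (swap-involutive m x)))
        (f≗ (swap m x) (swap-positive m 1≤m 1≤x))))
    zm : z m ≡ swap m (transp lo b (suc m))
    zm = trans (z≗ m 1≤m) (cong (swap m ∘ transp lo b) (swap-l m))
    zsm : z (suc m) ≡ swap m (transp lo b m)
    zsm = trans (z≗ (suc m) (s≤s z≤n)) (cong (swap m ∘ transp lo b) (swap-r m))
    -- Serves the three positions of `m` at which undoing the conjugation does not give an
    -- involution with an ascent at `m`.
    bad : ∀ {x y} → transp lo b (suc m) ≡ x → transp lo b m ≡ y → swap m y ≤ swap m x → ⊥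
    bad ex ey le = <⇒≱ asc (subst₂ _≤_ (sym (trans zsm (cong (swap m) ey))) (sym (trans zm (cong (swap m) ex))) le)
    go : ∀ p → (p ≡ true → FixesPair z m) → Dec (m ≡ lo) → Dec (m ≡ b) → Dec (suc m ≡ lo) → Dec (suc m ≡ b) →
         Prefix a hi (w ∷ʳ lt m p)
    go true pr _ _ _ _ = contradiction (pr refl) nf
    go false _ (yes refl) _ _ (yes refl) = ⊥-elim (bad (transp-r (<⇒≢ lo<b)) (transp-l lo b)
      (subst₂ _≤_ (sym (swap-r m)) (sym (swap-l m)) (n≤1+n m)))
    go false _ (yes refl) _ _ (no n) = dn (run-transp w (suc a) hi rw e₁ (≤∧≢⇒< a<hi (n ∘ cong suc))
      (λ x 1≤x → trans (z≗ x 1≤x) (transp-conjugate-l (≤∧≢⇒< lo<b n) x)))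
    go false _ (no _) (yes refl) _ _ = ⊥-elim (bad (transp-other (>⇒≢ (m<n⇒m<1+n lo<b)) 1+n≢n) (transp-r (<⇒≢ lo<b))
      (subst₂ _≤_ (sym (swap-below lo<b)) (sym (swap-r m)) (<⇒≤ lo<b)))
    go false _ (no n) (no n′) (yes refl) _ = ⊥-elim (bad (transp-l lo b) (transp-other n n′)
      (subst₂ _≤_ (sym (swap-l m)) (sym (swap-above lo<b)) (<⇒≤ lo<b)))
    go false _ (no n) (no n′) (no _) (yes refl) = up′ m 1≤m λ h e → run-transp w a h rw e₁
      (≤-pred (subst (lo <_) e (≤∧≢⇒< a<hi (n ∘ sym)))) (subst (λ y → z ≗⁺ transp lo y) e
      λ x 1≤x → trans (z≗ x 1≤x) (trans (cong (swap m) (sym (transp-conjugate-r (≤∧≢⇒< a<hi (n ∘ sym)) (swap m x))))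
        (trans (swap-involutive m _) (cong (transp lo m) (swap-involutive m x)))))
    go false _ (no n) (no n′) (no n″) (no n‴) = contradiction
      (trans zm (trans (cong (swap m) (transp-other n″ n‴)) (swap-r m)) ,
       trans zsm (trans (cong (swap m) (transp-other n n′)) (swap-l m))) nf

canon-InvWordO : ∀ {k} 1≤k {wλ w} → wλ ≗⁺ transp 1 (suc k) → ClassW (canon k 1≤k) w → InvWordO wλ w
canon-InvWordO {suc k} 1≤k e = ClassW-InvWordO (canon (suc k) 1≤k)
  λ x 1≤x → trans (reached-canon 1≤k k x) (sym (e x 1≤x))

InvWordO-canon : ∀ {k} 1≤k {wλ w} → wλ ≗⁺ transp 1 (suc k) → InvWordO wλ w → ClassW (canon k 1≤k) w
InvWordO-canon {k} 1≤k {wλ} {w} e (f , r , f≗) =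
  subst (ClassW _) (L.++-identityʳ w)
    (Prefix-ClassW (run-transp w 0 k (reverseView w) r 1≤k (λ x 1≤x → trans (f≗ x 1≤x) (e x 1≤x))) done)

-- The dominant permutation of a hook

IsHook : ℕ → Comp → Set
IsHook k lam = at lam 1 ≡ k × (∀ i → 2 ≤ i → i ≤ k → at lam i ≡ 1) × (∀ i → k < i → at lam i ≡ 0)

-- The first row of the diagram forces w(1) = k+1 and the first column forces w(k+1) = 1. Any other
-- i is fixed by induction on i: the box (i,i) is not in the diagram, so w(i) > i would give i a
-- smaller preimage, and w(i) < i would repeat a value already taken.
dominant-transp : ∀ {k lam w} → 1 ≤ k → IsHook k lam → IsDominantPerm lam w → w ≗⁺ transp 1 (suc k)
dominant-transp {k} {lam} {w} 1≤k (h₁ , h₂ , h₃) (wi , pos , posi , wiw , wwi , _ , diag) = result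
  where
    into : ∀ {i j} → 1 ≤ i → 1 ≤ j → j ≤ at lam i → j < w i × i < wi j
    into 1≤i 1≤j = Equivalence.from (diag _ _ 1≤i 1≤j)
    outof : ∀ {i j} → 1 ≤ i → 1 ≤ j → at lam i < j → j < w i → wi j ≤ i
    outof 1≤i 1≤j λ<j j<w = ≮⇒≥ (λ i<wi → <⇒≱ λ<j (Equivalence.to (diag _ _ 1≤i 1≤j) (j<w , i<wi)))
    w1≥ : suc k ≤ w 1
    w1≥ = proj₁ (into ≤-refl 1≤k (≤-reflexive (sym h₁)))
    w1 : w 1 ≡ suc k
    w1 with m≤n⇒m<n∨m≡n w1≥
    ... | inj₂ e = sym e
    ... | inj₁ p = trans (cong w (sym (≤-antisym (outof ≤-refl (s≤s z≤n) (s≤s (≤-reflexive h₁)) p) (posi (suc k) (s≤s z≤n)))))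
                     (wwi (suc k) (s≤s z≤n))
    λk : 1 ≤ at lam k
    λk with m≤n⇒m<n∨m≡n 1≤k
    ... | inj₂ refl = ≤-reflexive (sym h₁)
    ... | inj₁ p = ≤-reflexive (sym (h₂ k p ≤-refl))
    wi1≥ : suc k ≤ wi 1
    wi1≥ = proj₂ (into 1≤k ≤-refl λk)
    wk : w (suc k) ≡ 1
    wk with m≤n⇒m<n∨m≡n (pos (suc k) (s≤s z≤n))
    ... | inj₂ e = sym e
    ... | inj₁ p = trans (cong w (≤-antisym wi1≥ (outof (s≤s z≤n) ≤-refl (s≤s (≤-reflexive (h₃ (suc k) ≤-refl))) p)))
                     (wwi 1 ≤-refl)
    w-inj : ∀ {i j} → 1 ≤ i → 1 ≤ j → w i ≡ w j → i ≡ j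
    w-inj {i} {j} p q e = trans (sym (wiw i p)) (trans (cong wi e) (wiw j q))
    λ<i : ∀ {i} → 2 ≤ i → at lam i < i
    λ<i {i} 2≤i with i ≤? k
    ... | yes i≤k = subst (_< i) (sym (h₂ i 2≤i i≤k)) 2≤i
    ... | no i≰k = subst (_< i) (sym (h₃ i (≰⇒> i≰k))) (<⇒≤ 2≤i)
    -- `n` bounds `i` and makes the mutual induction structural; `below n` serves `fixed (suc n)`.
    fixed : ∀ n i → i ≤ n → 2 ≤ i → i ≢ suc k → w i ≡ i
    below : ∀ n i j → i ≤ suc n → 2 ≤ i → i ≢ suc k → 1 ≤ j → j < i → w j ≢ i
    below n i j i≤n 2≤i i≢ 1≤j j<i e with j ≟ 1 | j ≟ suc k
    ... | yes refl | _ = i≢ (trans (sym e) w1)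
    ... | no _ | yes refl = <⇒≢ 2≤i (trans (sym wk) e)
    ... | no p | no q =
      <⇒≢ j<i (trans (sym (fixed n j (≤-pred (≤-trans j<i i≤n)) (≤∧≢⇒< 1≤j (p ∘ sym)) q)) e)
    fixed zero i i≤n 2≤i i≢ = contradiction (≤-trans 2≤i i≤n) (λ ())
    fixed (suc n) i i≤n 2≤i i≢ with <-cmp (w i) i
    ... | tri≈ _ e _ = e
    ... | tri> _ _ i<w with m≤n⇒m<n∨m≡n (outof (<⇒≤ 2≤i) (<⇒≤ 2≤i) (λ<i 2≤i) i<w)
    ...   | inj₁ wi<i = contradiction (wwi i (<⇒≤ 2≤i)) (below n i (wi i) i≤n 2≤i i≢ (posi i (<⇒≤ 2≤i)) wi<i)
    ...   | inj₂ e = trans (cong w (sym e)) (wwi i (<⇒≤ 2≤i))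
    fixed (suc n) i i≤n 2≤i i≢ | tri< w<i _ _ with w i ≟ 1 | w i ≟ suc k
    ... | yes e | _ = contradiction (w-inj (<⇒≤ 2≤i) (s≤s z≤n) (trans e (sym wk))) i≢
    ... | no _ | yes e = contradiction (w-inj (<⇒≤ 2≤i) ≤-refl (trans e (sym w1))) (>⇒≢ 2≤i)
    ... | no p | no q = w-inj (pos i (<⇒≤ 2≤i)) (<⇒≤ 2≤i)
      (fixed n (w i) (≤-pred (≤-trans w<i i≤n)) (≤∧≢⇒< (pos i (<⇒≤ 2≤i)) (p ∘ sym)) q)
    result : w ≗⁺ transp 1 (suc k)
    result x 1≤x with x ≟ 1 | x ≟ suc k
    ... | yes refl | _ = w1
    ... | no p | yes refl = trans wk (sym (transp-r (<⇒≢ (s≤s 1≤k))))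
    ... | no p | no q = trans (fixed x x ≤-refl (≤∧≢⇒< 1≤x (p ∘ sym)) q) (sym (transp-other p q))

-- The pairing rule on two consecutive factors

Below Above : Letter → List Letter → Set
Below y = All (λ l → val y < val l)
Above y = All (λ l → val l < val y)

Decr : List Letter → Set
Decr = AllPairs (λ a b → val b < val a)

hasVal-false : ∀ {v} R → All (λ l → val l ≢ v) R → hasVal R v ≡ false
hasVal-false []      []       = refl
hasVal-false (l ∷ R) (n ∷ ns) rewrite ≡ᵇ-false n = hasVal-false R ns

runUp-zero : ∀ f R v → hasVal R (suc v) ≡ false → runUp f R v ≡ 0
runUp-zero zero    R v e = refl
runUp-zero (suc f) R v e rewrite e = refl

runDown-zero : ∀ f L v → All (λ l → v ≤ val l) L → runDown f L v ≡ 0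
runDown-zero zero    L v       _ = refl
runDown-zero (suc f) L zero    _ = refl
runDown-zero (suc f) L (suc v) p rewrite hasVal-false {v} L (LAll.map (λ v<l → >⇒≢ v<l) p) = refl

-- For t = 0 the range of letters that exchange primes is empty, so the maps inside `ePair` and
-- `fPair` do nothing.
map-unguarded : ∀ (c : Letter → Bool) (f : Letter → Letter) → (∀ l → c l ≡ false) →
                ∀ ls → map (λ l → if c l then f l else l) ls ≡ ls
map-unguarded c f e []       = refl
map-unguarded c f e (l ∷ ls) rewrite e l = cong (l ∷_) (map-unguarded c f e ls)

empty-interval : ∀ a v → (a <ᵇ v) ∧ (v ≤ᵇ a) ≡ false
empty-interval a v with a <? v
... | yes p rewrite <ᵇ-true p = ≤ᵇ-false (<⇒≱ p)
... | no p rewrite <ᵇ-false p = refl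

empty-interval′ : ∀ a v → (a ≤ᵇ v) ∧ (v <ᵇ a) ≡ false
empty-interval′ a v with a ≤? v
... | yes p rewrite ≤ᵇ-true p = <ᵇ-false (≤⇒≯ p)
... | no p rewrite ≤ᵇ-false p = refl

ePair-just : ∀ L R {y} → lastL (proj₂ (pairing L R)) ≡ just y → hasVal R (suc (val y)) ≡ false →
             ePair L R ≡ just (insertDec y L , removeVal (val y) R)
ePair-just L R e h with lastL (proj₂ (pairing L R))
ePair-just L R {y} refl h | just .y rewrite runUp-zero (length R) R (val y) h | +-identityʳ (val y) =
  cong just (cong₂ _,_
    (cong (insertDec y) (map-unguarded _ _ (λ l → empty-interval′ (val y) (val l)) L))
    (map-unguarded _ _ (λ l → empty-interval (val y) (val l)) _))

ePair-nothing : ∀ L R → lastL (proj₂ (pairing L R)) ≡ nothing → ePair L R ≡ nothing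
ePair-nothing L R e with lastL (proj₂ (pairing L R))
ePair-nothing L R refl | nothing = refl

fPair-just : ∀ L R {x} → lastL (proj₁ (pairing L R)) ≡ just x → All (λ l → val x ≤ val l) L →
             fPair L R ≡ just (removeVal (val x) L , insertDec x R)
fPair-just L R e h with lastL (proj₁ (pairing L R))
fPair-just L R {x} refl h | just .x rewrite runDown-zero (length L) L (val x) h =
  cong just (cong₂ _,_
    (map-unguarded _ _ (λ l → empty-interval′ (val x) (val l)) _)
    (cong (insertDec x) (map-unguarded _ _ (λ l → empty-interval (val x) (val l)) R)))

fPair-nothing : ∀ L R → lastL (proj₁ (pairing L R)) ≡ nothing → fPair L R ≡ nothing
fPair-nothing L R e with lastL (proj₁ (pairing L R))
fPair-nothing L R refl | nothing = refl

removeFirstBelow-nothing : ∀ b {L} → Below b L → removeFirstBelow (val b) L ≡ nothing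
removeFirstBelow-nothing b [] = refl
removeFirstBelow-nothing b {l ∷ L} (p ∷ ps)
  rewrite <ᵇ-false (<⇒≯ p) | removeFirstBelow-nothing b ps = refl

pairUp-low : ∀ {L} bs → All (λ b → Below b L) bs → pairUp L bs ≡ (L , bs)
pairUp-low []       []       = refl
pairUp-low (b ∷ bs) (p ∷ ps) rewrite removeFirstBelow-nothing b p | pairUp-low bs ps = refl

-- Right letters are processed in increasing order, so the head `h` comes last. The others lie below
-- the whole left factor, stay unpaired, and leave its largest letter `x` for `h`.
pairUp-high : ∀ {x L h} bs → val x < val h → All (λ b → Below b (x ∷ L)) bs →
              pairUp (x ∷ L) (bs ∷ʳ h) ≡ (L , bs)
pairUp-high []       x<h []       rewrite <ᵇ-true x<h = refl
pairUp-high {x} {L} {h} (b ∷ bs) x<h (p ∷ ps)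
  rewrite removeFirstBelow-nothing b p | pairUp-high {x} {L} {h} bs x<h ps = refl

lastL-∷ʳ : ∀ xs {x} → lastL (xs ∷ʳ x) ≡ just x
lastL-∷ʳ []           = refl
lastL-∷ʳ (_ ∷ [])     = refl
lastL-∷ʳ (_ ∷ y ∷ xs) = lastL-∷ʳ (y ∷ xs)

lastL-reverse : ∀ x xs → lastL (reverse (x ∷ xs)) ≡ just x
lastL-reverse x xs = trans (cong lastL (L.unfold-reverse x xs)) (lastL-∷ʳ (reverse xs))

insertDec-∷ʳ : ∀ y {L} → Below y L → insertDec y L ≡ L ∷ʳ y
insertDec-∷ʳ y [] = refl
insertDec-∷ʳ y {l ∷ L} (p ∷ ps)
  rewrite <ᵇ-false (<⇒≯ (key-< (primed y) (primed l) p)) = cong (l ∷_) (insertDec-∷ʳ y ps)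

insertDec-∷ : ∀ y {R} → Above y R → insertDec y R ≡ y ∷ R
insertDec-∷ y [] = refl
insertDec-∷ y {l ∷ R} (p ∷ ps) rewrite <ᵇ-true (key-< (primed l) (primed y) p) = refl

removeVal-head : ∀ y R → removeVal (val y) (y ∷ R) ≡ R
removeVal-head y R rewrite ≡ᵇ-true {val y} refl = refl

removeVal-skip : ∀ {v} l R → val l ≢ v → removeVal v (l ∷ R) ≡ l ∷ removeVal v R
removeVal-skip l R n rewrite ≡ᵇ-false n = refl

initOf : Letter → List Letter → List Letter
initOf x []      = []
initOf x (y ∷ l) = x ∷ initOf y l

lastOf : Letter → List Letter → Letter
lastOf x []      = x
lastOf x (y ∷ l) = lastOf y l

init-last : ∀ x L → x ∷ L ≡ initOf x L ∷ʳ lastOf x L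
init-last x []      = refl
init-last x (y ∷ L) = cong (x ∷_) (init-last y L)

lastL-lastOf : ∀ x L → lastL (x ∷ L) ≡ just (lastOf x L)
lastL-lastOf x []      = refl
lastL-lastOf x (y ∷ L) = lastL-lastOf y L

lastOf-All : ∀ {P : Letter → Set} x L → All P (x ∷ L) → P (lastOf x L)
lastOf-All x []      (p ∷ []) = p
lastOf-All x (y ∷ L) (_ ∷ ps) = lastOf-All y L ps

lastOf-min : ∀ x L → Decr (x ∷ L) → All (λ l → val (lastOf x L) ≤ val l) (x ∷ L)
lastOf-min x []      _        = ≤-refl ∷ []
lastOf-min x (y ∷ L) (p ∷ ps) = <⇒≤ (lastOf-All y L p) ∷ lastOf-min y L ps

removeVal-last : ∀ x L → Decr (x ∷ L) → removeVal (val (lastOf x L)) (x ∷ L) ≡ initOf x L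
removeVal-last x []      _        = removeVal-head x []
removeVal-last x (y ∷ L) (p ∷ ps) =
  trans (removeVal-skip x (y ∷ L) (>⇒≢ (lastOf-All y L p))) (cong (x ∷_) (removeVal-last y L ps))

-- In words of the class every letter of the second factor but possibly its
-- first lies below all of the first factor, and the crystal operators reduce
-- to the following two functions; no letter is ever shifted, that is, t = 0.
raiseSecond : List Letter → Letter → List Letter → Maybe (List Letter × List Letter)
raiseSecond L h []      = nothing
raiseSecond L h (y ∷ R) = just (L ∷ʳ y , h ∷ R)

raisePair : List Letter → List Letter → Maybe (List Letter × List Letter)
raisePair L       []      = nothing
raisePair []      (y ∷ R) = just (y ∷ [] , R)
raisePair (x ∷ L) (h ∷ R) =
  if val h <ᵇ val x then just ((x ∷ L) ∷ʳ h , R) else raiseSecond (x ∷ L) h R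

lowerSecond : Letter → List Letter → Letter → List Letter → Maybe (List Letter × List Letter)
lowerSecond x []       h R = nothing
lowerSecond x (x′ ∷ L) h R = just (x ∷ initOf x′ L , h ∷ lastOf x′ L ∷ R)

lowerPair : List Letter → List Letter → Maybe (List Letter × List Letter)
lowerPair []      R       = nothing
lowerPair (x ∷ L) []      = just (initOf x L , lastOf x L ∷ [])
lowerPair (x ∷ L) (h ∷ R) =
  if val h <ᵇ val x then just (initOf x L , lastOf x L ∷ h ∷ R) else lowerSecond x L h R

-- The relative positions of two consecutive factors that can occur; `pairOK` derives them from the
-- interval shape.
data PairOK : List Letter → List Letter → Set where
  empty : ∀ {R} → PairOK [] R
  low   : ∀ {x L R} → All (λ r → Below r (x ∷ L)) R → PairOK (x ∷ L) R
  high  : ∀ {x L h R} → Above h (x ∷ L) → All (λ r → Below r (x ∷ L)) R → PairOK (x ∷ L) (h ∷ R)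

All-reverse : ∀ {P : Letter → Set} {xs} → All P xs → All P (reverse xs)
All-reverse [] = []
All-reverse {P} {x ∷ xs} (p ∷ ps) =
  subst (All P) (sym (L.unfold-reverse x xs)) (LAllₚ.∷ʳ⁺ (All-reverse ps) p)

pairing-high : ∀ {x L h R} → Above h (x ∷ L) → All (λ r → Below r (x ∷ L)) R →
               pairing (x ∷ L) (h ∷ R) ≡ (L , reverse R)
pairing-high {x} {L} {h} {R} (x<h ∷ _) ps =
  trans (cong (pairUp (x ∷ L)) (L.unfold-reverse h R)) (pairUp-high (reverse R) x<h (All-reverse ps))

pairing-low : ∀ {L R} → All (λ r → Below r L) R → pairing L R ≡ (L , reverse R)
pairing-low {R = R} ps = pairUp-low (reverse R) (All-reverse ps)

above-suc : ∀ {y R} → Above y R → All (λ l → val l ≢ suc (val y)) R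
above-suc = LAll.map (λ p → <⇒≢ (m<n⇒m<1+n p))

-- The moved letter y is the head of R, or its second letter under a head h with y < x < h. In
-- either case y + 1 does not occur in R, so t = 0.
ePair-raisePair : ∀ {L R} → Decr R → PairOK L R → ePair L R ≡ raisePair L R
ePair-raisePair {[]} {[]} _ empty = refl
ePair-raisePair {[]} {y ∷ R} (p ∷ _) empty =
  trans (ePair-just [] (y ∷ R)
          (trans (cong (lastL ∘ proj₂) (pairing-low {R = y ∷ R} (LAll.universal (λ _ → []) _))) (lastL-reverse y R))
          (hasVal-false (y ∷ R) (<⇒≢ (n<1+n _) ∷ above-suc {y} p)))
    (cong (λ R → just (y ∷ [] , R)) (removeVal-head y R))
ePair-raisePair {x ∷ L} {[]} _ (low ps) = refl
ePair-raisePair {x ∷ L} {h ∷ R} (p ∷ _) (low ps@((h<x ∷ h<L) ∷ _)) rewrite <ᵇ-true h<x =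
  trans (ePair-just (x ∷ L) (h ∷ R)
          (trans (cong (lastL ∘ proj₂) (pairing-low ps)) (lastL-reverse h R))
          (hasVal-false (h ∷ R) (<⇒≢ (n<1+n _) ∷ above-suc {h} p)))
    (cong just (cong₂ _,_ (insertDec-∷ʳ h (h<x ∷ h<L)) (removeVal-head h R)))
ePair-raisePair {x ∷ L} {h ∷ []} _ (high q@(x<h ∷ _) ps) rewrite <ᵇ-false (<⇒≯ x<h) =
  ePair-nothing (x ∷ L) (h ∷ []) (cong (lastL ∘ proj₂) (pairing-high q ps))
ePair-raisePair {x ∷ L} {h ∷ y ∷ R} (_ ∷ p ∷ _) (high q@(x<h ∷ _) ps@((y<x ∷ y<L) ∷ _)) rewrite <ᵇ-false (<⇒≯ x<h) =
  trans (ePair-just (x ∷ L) (h ∷ y ∷ R)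
          (trans (cong (lastL ∘ proj₂) (pairing-high q ps)) (lastL-reverse y R))
          (hasVal-false (h ∷ y ∷ R) (>⇒≢ (≤-<-trans y<x x<h) ∷ <⇒≢ (n<1+n _) ∷ above-suc {y} p)))
    (cong just (cong₂ _,_ (insertDec-∷ʳ y (y<x ∷ y<L))
      (trans (removeVal-skip h (y ∷ R) (>⇒≢ (<-trans y<x x<h))) (cong (h ∷_) (removeVal-head y R)))))

-- The moved letter is the last and smallest of L, so no run of letters lies below it and t = 0. If
-- `x` is alone and paired with `h`, nothing can move.
fPair-lowerPair : ∀ {L R} → Decr L → PairOK L R → fPair L R ≡ lowerPair L R
fPair-lowerPair {[]} {R} _ empty =
  fPair-nothing [] R (cong (lastL ∘ proj₁) (pairing-low {R = R} (LAll.universal (λ _ → []) _)))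
fPair-lowerPair {x ∷ L} {R} d (low ps) = trans
  (fPair-just (x ∷ L) R (trans (cong (lastL ∘ proj₁) (pairing-low ps)) (lastL-lastOf x L)) (lastOf-min x L d))
  (trans (cong just (cong₂ _,_ (removeVal-last x L d)
           (insertDec-∷ (lastOf x L) (LAll.map (lastOf-All x L) ps)))) (sym (eq R ps)))
  where
    eq : ∀ R → All (λ r → Below r (x ∷ L)) R → lowerPair (x ∷ L) R ≡ just (initOf x L , lastOf x L ∷ R)
    eq []      _                = refl
    eq (h ∷ R) ((h<x ∷ _) ∷ _) rewrite <ᵇ-true h<x = refl
fPair-lowerPair {x ∷ []} {h ∷ R} d (high q@(x<h ∷ _) ps) rewrite <ᵇ-false (<⇒≯ x<h) =
  fPair-nothing (x ∷ []) (h ∷ R) (cong (lastL ∘ proj₁) (pairing-high q ps))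
fPair-lowerPair {x ∷ x′ ∷ L} {h ∷ R} d (high q@(x<h ∷ x′<h) ps) rewrite <ᵇ-false (<⇒≯ x<h) = trans
  (fPair-just (x ∷ x′ ∷ L) (h ∷ R)
    (trans (cong (lastL ∘ proj₁) (pairing-high q ps)) (lastL-lastOf x′ L)) (lastOf-min x (x′ ∷ L) d))
  (cong just (cong₂ _,_ (removeVal-last x (x′ ∷ L) d) eq))
  where
    z = lastOf x′ L
    eq : insertDec z (h ∷ R) ≡ h ∷ z ∷ R
    eq rewrite <ᵇ-false (<⇒≯ (key-< (primed z) (primed h) (lastOf-All x′ L x′<h))) =
      cong (h ∷_) (insertDec-∷ z (LAll.map (λ { (_ ∷ r) → lastOf-All x′ L r }) ps))

-- `first` only shifts the boundary between the factors and leaves the word unchanged. `second` also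
-- turns B h y into B y h, where B is the last letter of the left factor and y < B < h: one relation
-- BCA ~ BAC.
data RaiseStep : (L R L′ R′ : List Letter) → Set where
  first  : ∀ {L y R} → Below y L → Above y R → RaiseStep L (y ∷ R) (L ∷ʳ y) R
  second : ∀ {x L h y R} → Above h (x ∷ L) → Below y (x ∷ L) → Above y R →
           RaiseStep (x ∷ L) (h ∷ y ∷ R) ((x ∷ L) ∷ʳ y) (h ∷ R)

raisePair-step : ∀ {L R L′ R′} → Decr R → PairOK L R → raisePair L R ≡ just (L′ , R′) → RaiseStep L R L′ R′
raisePair-step {[]} {y ∷ R} (p ∷ _) empty refl = first [] p
raisePair-step {x ∷ L} {h ∷ R} (p ∷ _) (low (ps@(h<x ∷ _) ∷ _)) e rewrite <ᵇ-true h<x with e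
... | refl = first ps p
raisePair-step {x ∷ L} {h ∷ y ∷ R} (_ ∷ p ∷ _) (high q@(x<h ∷ _) (y< ∷ _)) e rewrite <ᵇ-false (<⇒≯ x<h) with e
... | refl = second q y< p
raisePair-step {x ∷ L} {h ∷ []} _ (high q@(x<h ∷ _) []) e rewrite <ᵇ-false (<⇒≯ x<h) with e
... | ()

Decr-∷ʳ⁻ : ∀ L {y} → Decr (L ∷ʳ y) → Decr L × Below y L
Decr-∷ʳ⁻ []      _        = [] , []
Decr-∷ʳ⁻ (x ∷ L) (p ∷ ps) with Decr-∷ʳ⁻ L ps | LAllₚ.++⁻ L p
... | d , b | q , (y<x ∷ []) = q ∷ d , y<x ∷ b

Decr-∷ʳ⁺ : ∀ {L y} → Decr L → Below y L → Decr (L ∷ʳ y)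
Decr-∷ʳ⁺ []       []       = [] ∷ []
Decr-∷ʳ⁺ (p ∷ ps) (b ∷ bs) = LAllₚ.++⁺ p (b ∷ []) ∷ Decr-∷ʳ⁺ ps bs

-- Lowering is recorded as a raising step read backwards, so invariance has to be proved for one
-- relation only.
lowerPair-step : ∀ {L R L′ R′} → Decr L → PairOK L R → lowerPair L R ≡ just (L′ , R′) → RaiseStep L′ R′ L R
lowerPair-step {x ∷ L} {R} d (low ps) e = go R ps e
  where
    y = lastOf x L
    b : Below y (initOf x L)
    b = proj₂ (Decr-∷ʳ⁻ (initOf x L) (subst Decr (init-last x L) d))
    res : ∀ R → All (λ r → Below r (x ∷ L)) R → RaiseStep (initOf x L) (y ∷ R) (x ∷ L) R
    res R ps = subst (λ l → RaiseStep (initOf x L) (y ∷ R) l R) (sym (init-last x L))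
                 (first b (LAll.map (lastOf-All x L) ps))
    go : ∀ R {L′ R′} → All (λ r → Below r (x ∷ L)) R → lowerPair (x ∷ L) R ≡ just (L′ , R′) → RaiseStep L′ R′ (x ∷ L) R
    go [] ps refl = res [] ps
    go (h ∷ R) ps@((h<x ∷ _) ∷ _) e rewrite <ᵇ-true h<x with e
    ... | refl = res (h ∷ R) ps
lowerPair-step {x ∷ []} {h ∷ R} d (high q@(x<h ∷ _) ps) e rewrite <ᵇ-false (<⇒≯ x<h) with e
... | ()
lowerPair-step {x ∷ x′ ∷ L} {h ∷ R} d@(p ∷ d′) (high q@(x<h ∷ x′<h) ps) e rewrite <ᵇ-false (<⇒≯ x<h) with e
... | refl = subst (λ l → RaiseStep (x ∷ initOf x′ L) (h ∷ y ∷ R) (x ∷ l) (h ∷ R)) (sym (init-last x′ L))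
               (second (x<h ∷ proj₁ (LAllₚ.++⁻ (initOf x′ L) (subst (Above h) (init-last x′ L) x′<h)))
                 (lastOf-All x′ L p ∷ proj₂ (Decr-∷ʳ⁻ (initOf x′ L) (subst Decr (init-last x′ L) d′)))
                 (LAll.map (λ { (_ ∷ r) → lastOf-All x′ L r }) ps))
  where y = lastOf x′ L

RaiseStep-Decr : ∀ {L R L′ R′} → RaiseStep L R L′ R′ → Decr L → Decr R → Decr L′ × Decr R′
RaiseStep-Decr (first b a)    dl (_ ∷ dr) = Decr-∷ʳ⁺ dl b , dr
RaiseStep-Decr (second _ b _) dl ((_ ∷ h>) ∷ _ ∷ dr) = Decr-∷ʳ⁺ dl b , h> ∷ dr

RaiseStep-Decr⁻ : ∀ {L R L′ R′} → RaiseStep L R L′ R′ → Decr L′ → Decr R′ → Decr L × Decr R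
RaiseStep-Decr⁻ (first {L} b a) dl dr = proj₁ (Decr-∷ʳ⁻ L dl) , a ∷ dr
RaiseStep-Decr⁻ (second {x} {L} (x<h ∷ _) (y<x ∷ _) a) dl (h> ∷ dr) =
  proj₁ (Decr-∷ʳ⁻ (x ∷ L) dl) , (<-trans y<x x<h ∷ h>) ∷ a ∷ dr

module _ {D : Spec} where

  ClassW-split₂ : ∀ pre x L {v} → ClassW D (pre ++ (x ∷ L) ++ v) → Rest D (ClassW D) (pre ++ x ∷ L) v
  ClassW-split₂ []        x L c = ClassW-split D x L c
  ClassW-split₂ (y ∷ pre) x L {v} c =
    ClassW-split D y (pre ++ x ∷ L) (subst (λ w → ClassW D (y ∷ w)) (sym (L.++-assoc pre (x ∷ L) v)) c)

  -- After `x ∷ L` the head `h` is a new maximum or a new minimum. The later letters of R are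
  -- smaller than `h` and outside the interval, hence in both cases below all of `x ∷ L`.
  pairOK : ∀ pre L R post → ClassW D (pre ++ L ++ R ++ post) → Decr R → PairOK L R
  pairOK pre []      R       post c d = empty
  pairOK pre (x ∷ L) []      post c d = low []
  pairOK pre (x ∷ L) (h ∷ R) post c (h> ∷ d) with ClassW-split₂ pre x L c
  ... | rest {a} {hi} a<hi s i _ with LAllₚ.++⁻ʳ pre i | s
  ...   | ins | up t = high (LAll.map (λ { (_ , q) → ≤-<-trans q (iv-suc D hi) }) ins)
          (LAll.zipWith (λ { (r<h , inj₁ r<) → LAll.map (λ { (q , _) → <-≤-trans r< q }) ins
                           ; (r<h , inj₂ r>) → contradiction r<h (<⇒≯ r>) })
             (h> , LAllₚ.++⁻ˡ R (Sh-out D t)))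
  ...   | ins | dn t = low (LAll.map (λ r≤h → LAll.map (λ { (q , _) → ≤-<-trans r≤h (<-≤-trans (iv-suc D _) q) }) ins)
                               (≤-refl ∷ LAll.map <⇒≤ h>))

  RaiseStep-ClassW : ∀ pre {L R L′ R′} post → RaiseStep L R L′ R′ →
                     (ClassW D (pre ++ L ++ R ++ post) → ClassW D (pre ++ L′ ++ R′ ++ post)) ×
                     (ClassW D (pre ++ L′ ++ R′ ++ post) → ClassW D (pre ++ L ++ R ++ post))
  RaiseStep-ClassW pre post (first {L} {y} {R} _ _) =
    subst (λ w → ClassW D (pre ++ w)) (sym (L.++-assoc L (y ∷ []) (R ++ post))) ,
    subst (λ w → ClassW D (pre ++ w)) (L.++-assoc L (y ∷ []) (R ++ post))
  RaiseStep-ClassW pre post (second {x} {L} {h} {y} {R} <h y< _) =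
    (λ c → subst (ClassW D) (sym e₂) (ClassW-bca D _ _ y B h y<B B<h (subst (ClassW D) e₁ c))) ,
    (λ c → subst (ClassW D) (sym e₁) (ClassW-bac D _ _ y B h y<B B<h (subst (ClassW D) e₂ c)))
    where
      B = lastOf x L
      y<B : val y < val B
      y<B = lastOf-All x L y<
      B<h : val B < val h
      B<h = lastOf-All x L <h
      split : ∀ w → pre ++ (x ∷ L) ++ w ≡ (pre ++ initOf x L) ++ B ∷ w
      split w = trans (cong (λ l → pre ++ l ++ w) (init-last x L))
                  (trans (cong (pre ++_) (L.++-assoc (initOf x L) (B ∷ []) w)) (sym (L.++-assoc pre (initOf x L) (B ∷ w))))
      e₁ = split (h ∷ y ∷ R ++ post)
      e₂ : pre ++ ((x ∷ L) ∷ʳ y) ++ h ∷ R ++ post ≡ (pre ++ initOf x L) ++ B ∷ y ∷ h ∷ R ++ post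
      e₂ = trans (cong (λ l → pre ++ x ∷ l) (L.++-assoc L (y ∷ []) (h ∷ R ++ post))) (split (y ∷ h ∷ R ++ post))

-- Operators at a position of a factorization

PairOp : Set
PairOp = List Letter → List Letter → Maybe (List Letter × List Letter)

-- Recursion along the vector in place of `getF` and `setF`, so that the part of the word already
-- passed can be carried through an induction.
pairAt : PairOp → ∀ {n} → ℕ → Fact n → Maybe (Fact n)
pairAt F (suc zero)    (L ∷ R ∷ v) = M.map (λ p → proj₁ p ∷ proj₂ p ∷ v) (F L R)
pairAt F (suc (suc i)) (x ∷ v)     = M.map (x ∷_) (pairAt F (suc i) v)
pairAt F _             _           = nothing

opAt-pairAt : ∀ (F : PairOp) {n} i (a : Fact n) →
  (if (1 ≤ᵇ i) ∧ (i <ᵇ n) then applyPair i a (F (getF a i) (getF a (suc i))) else nothing) ≡ pairAt F i a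
opAt-pairAt F zero          a           = refl
opAt-pairAt F (suc zero)    []          = refl
opAt-pairAt F (suc (suc i)) []          = refl
opAt-pairAt F (suc zero)    (L ∷ [])    = refl
opAt-pairAt F (suc zero)    (L ∷ R ∷ v) with F L R
... | nothing = refl
... | just _  = refl
opAt-pairAt F {suc n} (suc (suc i)) (x ∷ v)
  with suc i <ᵇ n | F (getF v (suc i)) (getF v (suc (suc i))) | opAt-pairAt F (suc i) v
... | false | _       | e = cong (M.map (x ∷_)) e
... | true  | nothing | e = cong (M.map (x ∷_)) e
... | true  | just _  | e = cong (M.map (x ∷_)) e

eOp-pairAt : ∀ {n} i (a : Fact n) → eOp i a ≡ pairAt ePair i a
eOp-pairAt = opAt-pairAt ePair

fOp-pairAt : ∀ {n} i (a : Fact n) → fOp i a ≡ pairAt fPair i a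
fOp-pairAt = opAt-pairAt fPair

-- `pre` holds the letters of the factors already passed; membership in the class concerns the whole
-- word.
ClassF : Spec → List Letter → ∀ {n} → Fact n → Set
ClassF D pre v = VAll.All Decr v × ClassW D (pre ++ word v)

ClassF-tail : ∀ {D pre x n} {v : Fact n} → ClassF D pre (x ∷ v) → ClassF D (pre ++ x) v
ClassF-tail {D} {pre} {x} {v = v} (_ ∷ ds , c) = ds , subst (ClassW D) (sym (L.++-assoc pre x (word v))) c

data StepAt : ∀ {n} → ℕ → Fact n → Fact n → Set where
  here  : ∀ {n L R L′ R′} {v : Fact n} → RaiseStep L R L′ R′ → StepAt 1 (L ∷ R ∷ v) (L′ ∷ R′ ∷ v)
  there : ∀ {n i x} {v v′ : Fact n} → StepAt (suc i) v v′ → StepAt (suc (suc i)) (x ∷ v) (x ∷ v′)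

pairAt-raise : ∀ {D pre n} i (v : Fact n) → ClassF D pre v → pairAt ePair i v ≡ pairAt raisePair i v
pairAt-raise zero          v           c = refl
pairAt-raise (suc zero)    []          c = refl
pairAt-raise (suc zero)    (L ∷ [])    c = refl
pairAt-raise {pre = pre} (suc zero) (L ∷ R ∷ v) (_ ∷ dr ∷ _ , c) =
  cong (M.map _) (ePair-raisePair dr (pairOK pre L R (word v) c dr))
pairAt-raise (suc (suc i)) []          c = refl
pairAt-raise {D} {pre} (suc (suc i)) (x ∷ v) c =
  cong (M.map (x ∷_)) (pairAt-raise (suc i) v (ClassF-tail {D} {pre} c))

pairAt-lower : ∀ {D pre n} i (v : Fact n) → ClassF D pre v → pairAt fPair i v ≡ pairAt lowerPair i v
pairAt-lower zero          v           c = refl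
pairAt-lower (suc zero)    []          c = refl
pairAt-lower (suc zero)    (L ∷ [])    c = refl
pairAt-lower {pre = pre} (suc zero) (L ∷ R ∷ v) (dl ∷ dr ∷ _ , c) =
  cong (M.map _) (fPair-lowerPair dl (pairOK pre L R (word v) c dr))
pairAt-lower (suc (suc i)) []          c = refl
pairAt-lower {D} {pre} (suc (suc i)) (x ∷ v) c =
  cong (M.map (x ∷_)) (pairAt-lower (suc i) v (ClassF-tail {D} {pre} c))

map-just : ∀ {A B : Set} (f : A → B) m {b} → M.map f m ≡ just b → ∃ λ a → m ≡ just a × f a ≡ b
map-just f (just a) refl = a , refl , refl

raise-StepAt : ∀ {D pre n} i (v : Fact n) {v′} → ClassF D pre v → pairAt raisePair i v ≡ just v′ → StepAt i v v′
raise-StepAt {pre = pre} (suc zero) (L ∷ R ∷ v) (_ ∷ dr ∷ _ , c) e with map-just _ (raisePair L R) e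
... | _ , e′ , refl = here (raisePair-step dr (pairOK pre L R (word v) c dr) e′)
raise-StepAt {D} {pre} (suc (suc i)) (x ∷ v) c e with map-just (x ∷_) (pairAt raisePair (suc i) v) e
... | _ , e′ , refl = there (raise-StepAt (suc i) v (ClassF-tail {D} {pre} c) e′)

lower-StepAt : ∀ {D pre n} i (v : Fact n) {v′} → ClassF D pre v → pairAt lowerPair i v ≡ just v′ → StepAt i v′ v
lower-StepAt {pre = pre} (suc zero) (L ∷ R ∷ v) (dl ∷ dr ∷ _ , c) e with map-just _ (lowerPair L R) e
... | _ , e′ , refl = here (lowerPair-step dl (pairOK pre L R (word v) c dr) e′)
lower-StepAt {D} {pre} (suc (suc i)) (x ∷ v) c e with map-just (x ∷_) (pairAt lowerPair (suc i) v) e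
... | _ , e′ , refl = there (lower-StepAt (suc i) v (ClassF-tail {D} {pre} c) e′)

StepAt-Decr : ∀ {n i} {v v′ : Fact n} → StepAt i v v′ →
              (VAll.All Decr v → VAll.All Decr v′) × (VAll.All Decr v′ → VAll.All Decr v)
StepAt-Decr (here s) =
  (λ { (dl ∷ dr ∷ ds) → let p = RaiseStep-Decr s dl dr in proj₁ p ∷ proj₂ p ∷ ds }) ,
  (λ { (dl ∷ dr ∷ ds) → let p = RaiseStep-Decr⁻ s dl dr in proj₁ p ∷ proj₂ p ∷ ds })
StepAt-Decr (there s) =
  (λ { (d ∷ ds) → d ∷ proj₁ (StepAt-Decr s) ds }) , (λ { (d ∷ ds) → d ∷ proj₂ (StepAt-Decr s) ds })

StepAt-ClassW : ∀ {D} pre {n i} {v v′ : Fact n} → StepAt i v v′ →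
                (ClassW D (pre ++ word v) → ClassW D (pre ++ word v′)) ×
                (ClassW D (pre ++ word v′) → ClassW D (pre ++ word v))
StepAt-ClassW pre (here {v = v} s) = RaiseStep-ClassW pre (word v) s
StepAt-ClassW {D} pre (there {x = x} {v} {v′} s) =
  (λ c → subst (ClassW D) (L.++-assoc pre x (word v′)) (proj₁ p (subst (ClassW D) (sym (L.++-assoc pre x (word v))) c))) ,
  (λ c → subst (ClassW D) (L.++-assoc pre x (word v)) (proj₂ p (subst (ClassW D) (sym (L.++-assoc pre x (word v′))) c)))
  where p = StepAt-ClassW {D} (pre ++ x) s

firstVal : List Letter → ℕ
firstVal []      = 0
firstVal (l ∷ _) = val l

firstVal-++ : ∀ u {v v′} → firstVal v ≡ firstVal v′ → firstVal (u ++ v) ≡ firstVal (u ++ v′)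
firstVal-++ []      e = e
firstVal-++ (_ ∷ _) e = refl

-- Neither kind of step touches the first letter of the word. Hence the relabelling, which depends
-- on that letter, is the same before and after e_i or f_i.
StepAt-firstVal : ∀ {n i} {v v′ : Fact n} → StepAt i v v′ → firstVal (word v) ≡ firstVal (word v′)
StepAt-firstVal (here {v = v} (first {L} {y} {R} _ _)) = cong firstVal (sym (L.++-assoc L (y ∷ []) (R ++ word v)))
StepAt-firstVal (here (second _ _ _)) = refl
StepAt-firstVal (there {x = x} s) = firstVal-++ x (StepAt-firstVal s)

-- Phrased for the Boolean tests themselves, which can then be rewritten inside `raisePair` and
-- `lowerPair`.
OrderPreserving : (Letter → Letter) → Set
OrderPreserving r = ∀ l l′ → (val (r l) <ᵇ val (r l′)) ≡ (val l <ᵇ val l′)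

mapF : (Letter → Letter) → ∀ {n} → Fact n → Fact n
mapF r = V.map (map r)

mapP : (Letter → Letter) → List Letter × List Letter → List Letter × List Letter
mapP r (L , R) = map r L , map r R

raisePair-map : ∀ {r} → OrderPreserving r → ∀ L R → raisePair (map r L) (map r R) ≡ M.map (mapP r) (raisePair L R)
raisePair-map op []      []      = refl
raisePair-map op (x ∷ L) []      = refl
raisePair-map op []      (y ∷ R) = refl
raisePair-map {r} op (x ∷ L) (h ∷ R) rewrite op h x with val h <ᵇ val x | R
... | true  | R      = cong (λ l → just (r x ∷ l , map r R)) (sym (L.map-++ r L (h ∷ [])))
... | false | []     = refl
... | false | y ∷ R  = cong (λ l → just (r x ∷ l , r h ∷ map r R)) (sym (L.map-++ r L (y ∷ [])))

map-initOf : ∀ r x L → initOf (r x) (map r L) ≡ map r (initOf x L)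
map-initOf r x []      = refl
map-initOf r x (y ∷ L) = cong (r x ∷_) (map-initOf r y L)

map-lastOf : ∀ r x L → lastOf (r x) (map r L) ≡ r (lastOf x L)
map-lastOf r x []      = refl
map-lastOf r x (y ∷ L) = map-lastOf r y L

lowerPair-map : ∀ {r} → OrderPreserving r → ∀ L R → lowerPair (map r L) (map r R) ≡ M.map (mapP r) (lowerPair L R)
lowerPair-map     op []      R  = refl
lowerPair-map {r} op (x ∷ L) [] rewrite map-initOf r x L | map-lastOf r x L = refl
lowerPair-map {r} op (x ∷ L) (h ∷ R) rewrite op h x with val h <ᵇ val x | L
... | true  | L rewrite map-initOf r x L | map-lastOf r x L = refl
... | false | []     = refl
... | false | x′ ∷ L rewrite map-initOf r x′ L | map-lastOf r x′ L = refl

pairAt-map : ∀ {F : PairOp} {r} → (∀ L R → F (map r L) (map r R) ≡ M.map (mapP r) (F L R)) →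
             ∀ {n} i (v : Fact n) → pairAt F i (mapF r v) ≡ M.map (mapF r) (pairAt F i v)
pairAt-map e zero          v        = refl
pairAt-map e (suc zero)    []       = refl
pairAt-map e (suc zero)    (L ∷ []) = refl
pairAt-map {F} {r} e (suc zero) (L ∷ R ∷ v) rewrite e L R with F L R
... | nothing = refl
... | just _  = refl
pairAt-map e (suc (suc i)) []       = refl
pairAt-map {F} {r} e (suc (suc i)) (x ∷ v) rewrite pairAt-map {F} {r} e (suc i) v with pairAt F (suc i) v
... | nothing = refl
... | just _  = refl

word-mapF : ∀ r {n} (v : Fact n) → word (mapF r v) ≡ map r (word v)
word-mapF r []      = refl
word-mapF r (x ∷ v) = trans (cong (map r x ++_) (word-mapF r v)) (sym (L.map-++ r x (word v)))

getF-mapF : ∀ r {n} (v : Fact n) i → getF (mapF r v) i ≡ map r (getF v i)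
getF-mapF r []      i             = refl
getF-mapF r (x ∷ v) zero          = refl
getF-mapF r (x ∷ v) (suc zero)    = refl
getF-mapF r (x ∷ v) (suc (suc i)) = getF-mapF r v (suc i)

map-cong-All : ∀ {P : Letter → Set} {f h : Letter → Letter} → (∀ l → P l → f l ≡ h l) →
               ∀ {w} → All P w → map f w ≡ map h w
map-cong-All e []       = refl
map-cong-All e (p ∷ ps) = cong₂ _∷_ (e _ p) (map-cong-All e ps)

mapF-cong-All : ∀ {P : Letter → Set} {f h : Letter → Letter} → (∀ l → P l → f l ≡ h l) →
                ∀ {n} (v : Fact n) → All P (word v) → mapF f v ≡ mapF h v
mapF-cong-All e []      _ = refl
mapF-cong-All e (x ∷ v) p =
  cong₂ _∷_ (map-cong-All e (LAllₚ.++⁻ˡ x p)) (mapF-cong-All e v (LAllₚ.++⁻ʳ x p))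

mapF-id-All : ∀ {P : Letter → Set} {f : Letter → Letter} → (∀ l → P l → f l ≡ l) →
              ∀ {n} (v : Fact n) → All P (word v) → mapF f v ≡ v
mapF-id-All e []      _ = refl
mapF-id-All e (x ∷ v) p =
  cong₂ _∷_ (trans (map-cong-All e (LAllₚ.++⁻ˡ x p)) (L.map-id x)) (mapF-id-All e v (LAllₚ.++⁻ʳ x p))

-- Relabelling the canonical words

module Embedding (D : Spec) where

  C : Spec
  C = canon (k D) (1≤k D)

  -- c₀ is the index of the first letter of the word, whose prime is free; the
  -- prime of any other letter belongs to the gap on its side towards c₀.
  embed : ℕ → Letter → Letter
  embed c₀ (lt c p) = lt (iv D c) (if c ≡ᵇ c₀ then p else (if c₀ <ᵇ c then g D (c ∸ 1) else g D c))

  embed-first : ∀ c p → embed c (lt c p) ≡ lt (iv D c) p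
  embed-first c p rewrite ≡ᵇ-true {c} refl = refl

  embed-above : ∀ {c₀ c} p → c₀ ≤ c → embed c₀ (lt (suc c) p) ≡ lt (iv D (suc c)) (g D c)
  embed-above p le rewrite ≡ᵇ-false (>⇒≢ (s≤s le)) | <ᵇ-true (s≤s le) = refl

  embed-below : ∀ {c₀ c} p → c < c₀ → embed c₀ (lt c p) ≡ lt (iv D c) (g D c)
  embed-below p c<c₀ rewrite ≡ᵇ-false (<⇒≢ c<c₀) | <ᵇ-false (<⇒≯ c<c₀) = refl

  -- When the first index passes between the neighbours a+1 and a+2, every other index stays on the
  -- same side of it. The barred operators need this.
  embed-shift : ∀ {a l} → val l ≤ a ⊎ suc (suc a) < val l → embed (suc a) l ≡ embed (suc (suc a)) l
  embed-shift {a} {lt c p} (inj₁ c≤a) =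
    trans (embed-below p (s≤s c≤a)) (sym (embed-below p (m<n⇒m<1+n (s≤s c≤a))))
  embed-shift {a} {lt (suc c) p} (inj₂ (s≤s a<c)) =
    trans (embed-above p (<⇒≤ a<c)) (sym (embed-above p a<c))

  embed-order : ∀ c₀ → OrderPreserving (embed c₀)
  embed-order c₀ l l′ with val l <? val l′
  ... | yes p = trans (<ᵇ-true (iv-mono-< D p)) (sym (<ᵇ-true p))
  ... | no p = trans (<ᵇ-false (p ∘ iv-cancel-< D)) (sym (<ᵇ-false p))

  embed-Sh : ∀ {a hi u} c₀ → a < c₀ → c₀ ≤ hi → Sh C a hi u → Sh D a hi (map (embed c₀) u)
  embed-Sh c₀ a< ≤hi done = done
  embed-Sh {a} {hi} c₀ a< ≤hi (up {u = u} s) =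
    subst (λ l → Sh D a hi (l ∷ map (embed c₀) u)) (sym (embed-above false ≤hi)) (up (embed-Sh c₀ a< (m≤n⇒m≤1+n ≤hi) s))
  embed-Sh {suc a} {hi} c₀ a< ≤hi (dn {u = u} s) =
    subst (λ l → Sh D (suc a) hi (l ∷ map (embed c₀) u)) (sym (embed-below false a<)) (dn (embed-Sh c₀ (<⇒≤ a<) ≤hi s))

  embed-ClassW : ∀ {w} → ClassW C w → ClassW D (map (embed (firstVal w)) w)
  embed-ClassW (start {a} {p} {u} s) =
    subst (λ l → ClassW D (l ∷ map (embed (suc a)) u)) (sym (embed-first (suc a) p)) (start (embed-Sh (suc a) (n<1+n a) ≤-refl s))

  ψ : ∀ {n} → Fact n → Fact n
  ψ b = mapF (embed (firstVal (word b))) b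

  Can : ∀ {n} → Fact n → Set
  Can = ClassF C []

  map-Decr : ∀ c₀ {n} {v : Fact n} → VAll.All Decr v → VAll.All Decr (mapF (embed c₀) v)
  map-Decr c₀ []       = []
  map-Decr c₀ (d ∷ ds) = go d ∷ map-Decr c₀ ds
    where
      go : ∀ {l} → Decr l → Decr (map (embed c₀) l)
      go []       = []
      go (p ∷ ps) = LAllₚ.map⁺ (LAll.map (iv-mono-< D) p) ∷ go ps

  ψ-ClassF : ∀ {n} {b : Fact n} → Can b → ClassF D [] (ψ b)
  ψ-ClassF {b = b} (d , c) =
    map-Decr _ d , subst (ClassW D) (sym (word-mapF _ b)) (embed-ClassW c)

  -- Closure of the class under `op` is included so that the property passes to composites, as the
  -- conjugates by `σ` require.
  Compatible : ∀ {n} → (Fact n → Maybe (Fact n)) → Set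
  Compatible {n} op = ∀ (b : Fact n) → Can b →
    op (ψ b) ≡ M.map ψ (op b) × (∀ {b′} → op b ≡ just b′ → Can b′)

  eOp-compatible : ∀ {n} i → Compatible {n} (eOp i)
  eOp-compatible i b c@(d , cw) = eq , λ e → closed (trans (sym eq₀) e)
    where
      r = embed (firstVal (word b))
      eq₀ : eOp i b ≡ pairAt raisePair i b
      eq₀ = trans (eOp-pairAt i b) (pairAt-raise i b c)
      eq₁ : eOp i (ψ b) ≡ M.map (mapF r) (pairAt raisePair i b)
      eq₁ = trans (eOp-pairAt i (ψ b)) (trans (pairAt-raise i (ψ b) (ψ-ClassF {b = b} c))
              (pairAt-map {raisePair} {r} (raisePair-map (embed-order (firstVal (word b)))) i b))
      closed : ∀ {b′} → pairAt raisePair i b ≡ just b′ → Can b′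
      closed e = let s = raise-StepAt i b c e in
        proj₁ (StepAt-Decr s) d , proj₁ (StepAt-ClassW {C} [] s) cw
      same : ∀ m → pairAt raisePair i b ≡ m → M.map (mapF r) m ≡ M.map ψ m
      same nothing   e = refl
      same (just b′) e = cong (λ c₀ → just (mapF (embed c₀) b′)) (StepAt-firstVal (raise-StepAt i b c e))
      eq : eOp i (ψ b) ≡ M.map ψ (eOp i b)
      eq = trans eq₁ (trans (same _ refl) (cong (M.map ψ) (sym eq₀)))

  fOp-compatible : ∀ {n} i → Compatible {n} (fOp i)
  fOp-compatible i b c@(d , cw) = eq , λ e → closed (trans (sym eq₀) e)
    where
      r = embed (firstVal (word b))
      eq₀ : fOp i b ≡ pairAt lowerPair i b
      eq₀ = trans (fOp-pairAt i b) (pairAt-lower i b c)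
      eq₁ : fOp i (ψ b) ≡ M.map (mapF r) (pairAt lowerPair i b)
      eq₁ = trans (fOp-pairAt i (ψ b)) (trans (pairAt-lower i (ψ b) (ψ-ClassF {b = b} c))
              (pairAt-map {lowerPair} {r} (lowerPair-map (embed-order (firstVal (word b)))) i b))
      closed : ∀ {b′} → pairAt lowerPair i b ≡ just b′ → Can b′
      closed e = let s = lower-StepAt i b c e in
        proj₂ (StepAt-Decr s) d , proj₂ (StepAt-ClassW {C} [] s) cw
      same : ∀ m → pairAt lowerPair i b ≡ m → M.map (mapF r) m ≡ M.map ψ m
      same nothing   e = refl
      same (just b′) e = cong (λ c₀ → just (mapF (embed c₀) b′)) (sym (StepAt-firstVal (lower-StepAt i b c e)))
      eq : fOp i (ψ b) ≡ M.map ψ (fOp i b)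
      eq = trans eq₁ (trans (same _ refl) (cong (M.map ψ) (sym eq₀)))

<ᵇ-cancel : ∀ {a b} → (a <ᵇ b) ≡ true → a < b
<ᵇ-cancel {a} {b} e with a <? b
... | yes p = p
... | no p = contradiction (trans (sym e) (<ᵇ-false p)) λ ()

-- Compatibility of all crystal operators with the relabelling

module Operators (D : Spec) where
  open Embedding D

  -- The letters of `r` are smaller than `m`, hence all new minima. So the first letter above `m` is
  -- the next maximum, and it can be taken out without disturbing them.
  remove-up : ∀ {a hi m y v} r → a < m → m ≤ hi → All (λ l → val l < m) r → m < val y →
              Sh C a hi (r ++ y ∷ v) → y ≡ un (suc hi) × Sh C a (suc hi) (r ++ v)
  remove-up []      a<m m≤hi []       m<y (up s) = refl , s
  remove-up []      a<m m≤hi []       m<y (dn s) = contradiction a<m (<⇒≯ m<y)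
  remove-up (l ∷ r) a<m m≤hi (p ∷ ps) m<y (up s) = contradiction (<-≤-trans p m≤hi) (<⇒≯ (n<1+n _))
  remove-up (l ∷ r) a<m m≤hi (p ∷ ps) m<y (dn s) with remove-up r (<⇒≤ a<m) m≤hi ps m<y s
  ... | e , t = e , dn t

  insert-up : ∀ {a hi m v} r → m ≤ hi → All (λ l → val l < m) r →
              Sh C a (suc hi) (r ++ v) → Sh C a hi (r ++ un (suc hi) ∷ v)
  insert-up []      m≤hi []       s      = up s
  insert-up (l ∷ r) m≤hi (p ∷ ps) (up s) = contradiction (<-≤-trans p m≤hi) (<⇒≯ (m<n⇒m<1+n (n<1+n _)))
  insert-up (l ∷ r) m≤hi (p ∷ ps) (dn s) = dn (insert-up r m≤hi ps s)

  embed-shift-F : ∀ {a n} (v : Fact n) → Sh C a (suc (suc a)) (word v) →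
                  mapF (embed (suc a)) v ≡ mapF (embed (suc (suc a))) v
  embed-shift-F v s = mapF-cong-All
    (λ { l (inj₁ p) → embed-shift (inj₁ (≤-pred p)) ; l (inj₂ p) → embed-shift (inj₂ p) }) v (Sh-out C s)

  private
    variable
      n : ℕ

  -- The heads of the two factors are the neighbours a+1 and a+2. The operator puts a+2 first: the
  -- free prime passes to it, while the other prime stays with the gap between the two.
  ebar1-front : ∀ {x y r R} {w : Fact n} → Can ((x ∷ r) ∷ (y ∷ R) ∷ w) → val x < val y →
    let e = embed (val x) ; b′ = (lt (val y) (primed x) ∷ lt (val x) (primed y) ∷ r) ∷ R ∷ w in
    (lt (iv D (val y)) (primed (e x)) ∷ lt (iv D (val x)) (primed (e y)) ∷ map e r) ∷ map e R ∷ mapF e w ≡ ψ b′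
    × Can b′
  ebar1-front {x = lt .(suc a) p} {y} {r} {R} {w} ((x>r ∷ dr) ∷ (_ ∷ dR) ∷ ds , start {a} s) x<y
    with remove-up r (n<1+n a) ≤-refl x>r x<y s
  ... | refl , t =
    cong₂ _∷_
      (cong₂ _∷_ (trans (cong (lt (iv D (suc (suc a))) ∘ primed) (embed-first (suc a) p)) (sym (embed-first (suc (suc a)) p)))
        (cong₂ _∷_ (trans (cong (lt (iv D (suc a)) ∘ primed) (embed-above false ≤-refl)) (sym (embed-below false (n<1+n (suc a)))))
          (cong V.head shift)))
      (cong V.tail shift) ,
    ((n<1+n (suc a) ∷ LAll.map m<n⇒m<1+n x>r) ∷ x>r ∷ dr) ∷ dR ∷ ds , start (dn t)
    where shift = embed-shift-F (r ∷ R ∷ w) t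

  -- The reverse exchange: y, the next minimum, becomes the first letter, and x returns as the next
  -- maximum, which `insert-up` places behind the minima in `r`.
  fbar1-front : ∀ {x y r M} {w : Fact n} → Can ((x ∷ y ∷ r) ∷ M ∷ w) → Above x M →
    let e = embed (val x) ; b′ = (lt (val y) (primed x) ∷ r) ∷ (lt (val x) (primed y) ∷ M) ∷ w in
    (lt (iv D (val y)) (primed (e x)) ∷ map e r) ∷ (lt (iv D (val x)) (primed (e y)) ∷ map e M) ∷ mapF e w ≡ ψ b′
    × Can b′
  fbar1-front {x = lt .(suc a) p} (((y<x ∷ _) ∷ _) ∷ _ , start {a} (up s)) x>M = contradiction y<x (<⇒≯ (n<1+n _))
  fbar1-front {x = lt _ p} {r = r} {M} {w} ((_ ∷ y>r ∷ dr) ∷ dM ∷ ds , start (dn {a} t)) x>M =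
    cong₂ _∷_
      (cong₂ _∷_ (trans (cong (lt (iv D (suc a)) ∘ primed) (embed-first (suc (suc a)) p)) (sym (embed-first (suc a) p)))
        (cong V.head shift))
      (cong₂ _∷_
        (cong₂ _∷_ (trans (cong (lt (iv D (suc (suc a))) ∘ primed) (embed-below false (n<1+n (suc a)))) (sym (embed-above false ≤-refl)))
          (cong (V.head ∘ V.tail) shift))
        (cong (V.tail ∘ V.tail) shift)) ,
    (y>r ∷ dr) ∷ (x>M ∷ dM) ∷ ds , start (insert-up r ≤-refl y>r t)
    where shift = sym (embed-shift-F (r ∷ M ∷ w) t)

  guarded-compatible : ∀ {p q} {X Y : Fact n} → p ≡ q → (q ≡ true → X ≡ ψ Y × Can Y) →
    (if p then just X else nothing) ≡ M.map ψ (if q then just Y else nothing) ×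
    (∀ {b′} → (if q then just Y else nothing) ≡ just b′ → Can b′)
  guarded-compatible {q = false} refl f = refl , λ ()
  guarded-compatible {q = true}  refl f = cong just (proj₁ (f refl)) , λ { refl → proj₂ (f refl) }

  ebar1-compatible : Compatible {n} ebar1
  ebar1-compatible []                        _ = refl , λ ()
  ebar1-compatible (A ∷ [])                  _ = refl , λ ()
  ebar1-compatible ([] ∷ [] ∷ w)             _ = refl , λ ()
  ebar1-compatible ((x ∷ r) ∷ [] ∷ w)        _ = refl , λ ()
  ebar1-compatible ([] ∷ (y ∷ R) ∷ w) (_ ∷ (_ ∷ d) ∷ ds , c) = refl , λ { refl → ([] ∷ []) ∷ d ∷ ds , c }
  ebar1-compatible ((x ∷ r) ∷ (y ∷ R) ∷ w) c =
    guarded-compatible (embed-order (val x) x y) (λ e → ebar1-front c (<ᵇ-cancel e))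

  fbar1-compatible : Compatible {n} fbar1
  fbar1-compatible []                             _ = refl , λ ()
  fbar1-compatible (A ∷ [])                       _ = refl , λ ()
  fbar1-compatible ([] ∷ M ∷ w)                   _ = refl , λ ()
  fbar1-compatible ((x ∷ []) ∷ [] ∷ w) (_ ∷ _ ∷ ds , c) = refl , λ { refl → [] ∷ ([] ∷ []) ∷ ds , c }
  fbar1-compatible ((x ∷ []) ∷ (m ∷ M) ∷ w) (_ ∷ (m> ∷ d) ∷ ds , c) =
    guarded-compatible (embed-order (val x) m x) λ e → let p = <ᵇ-cancel e in
      refl , [] ∷ ((p ∷ LAll.map (λ q → <-trans q p) m>) ∷ m> ∷ d) ∷ ds , c
  fbar1-compatible ((x ∷ y ∷ r) ∷ [] ∷ w) c =
    let e , c′ = fbar1-front c [] in cong just e , λ { refl → c′ }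
  fbar1-compatible ((x ∷ y ∷ r) ∷ (m ∷ M) ∷ w) c@(_ ∷ (m> ∷ _) ∷ _ , _) =
    guarded-compatible (embed-order (val x) m x) λ e → let p = <ᵇ-cancel e in
      fbar1-front c (p ∷ LAll.map (λ q → <-trans q p) m>)

  fpr1-compatible : Compatible {n} fpr1
  fpr1-compatible []             _ = refl , λ ()
  fpr1-compatible ([] ∷ w)       _ = refl , λ ()
  fpr1-compatible ((lt v true ∷ r) ∷ w) _ rewrite ≡ᵇ-true {v} refl = refl , λ ()
  fpr1-compatible ((lt v false ∷ r) ∷ w) ((p ∷ d) ∷ ds , c) rewrite ≡ᵇ-true {v} refl =
    refl , λ { refl → (p ∷ d) ∷ ds , ClassW-prime C c }

  epr1-compatible : Compatible {n} epr1
  epr1-compatible []             _ = refl , λ ()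
  epr1-compatible ([] ∷ w)       _ = refl , λ ()
  epr1-compatible ((lt v false ∷ r) ∷ w) _ rewrite ≡ᵇ-true {v} refl = refl , λ ()
  epr1-compatible ((lt v true ∷ r) ∷ w) ((p ∷ d) ∷ ds , c) rewrite ≡ᵇ-true {v} refl =
    refl , λ { refl → (p ∷ d) ∷ ds , ClassW-prime C c }

  nothing-compatible : Compatible {n} (λ _ → nothing)
  nothing-compatible b c = refl , λ ()

  >=>-compatible : ∀ {g h : Fact n → Maybe (Fact n)} → Compatible g → Compatible h → Compatible (g >=> h)
  >=>-compatible {g = g} {h} cg ch b c rewrite proj₁ (cg b c) with g b | proj₂ (cg b c)
  ... | nothing | _  = refl , λ ()
  ... | just b′ | cl = ch b′ (cl refl)

  iterM-compatible : ∀ {g : Fact n → Maybe (Fact n)} m → Compatible g → Compatible (iterM m g)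
  iterM-compatible zero cg b c = refl , λ { refl → c }
  iterM-compatible {g = g} (suc m) cg b c rewrite proj₁ (cg b c) with g b | proj₂ (cg b c)
  ... | nothing | _  = refl , λ ()
  ... | just b′ | cl = iterM-compatible m cg b′ (cl refl)

  length-getF-ψ : ∀ (b : Fact n) i → length (getF (ψ b) i) ≡ length (getF b i)
  length-getF-ψ b i = trans (cong length (getF-mapF _ b i)) (L.length-map _ (getF b i))

  σ-compatible : ∀ i → Compatible {n} (σ i)
  σ-compatible i b c rewrite length-getF-ψ b i | length-getF-ψ b (suc i)
    with length (getF b (suc i)) ≤ᵇ length (getF b i)
  ... | true  = iterM-compatible (length (getF b i) ∸ length (getF b (suc i))) (fOp-compatible i) b c
  ... | false = iterM-compatible (length (getF b (suc i)) ∸ length (getF b i)) (eOp-compatible i) b c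

  conjugate₂-compatible : ∀ {g : Fact n → Maybe (Fact n)} i j → Compatible g →
                          Compatible (σ i >=> σ j >=> g >=> σ j >=> σ i)
  conjugate₂-compatible i j cg =
    >=>-compatible (σ-compatible i) (>=>-compatible (σ-compatible j) (>=>-compatible cg
      (>=>-compatible (σ-compatible j) (σ-compatible i))))

  ebarOp-compatible : ∀ i → Compatible {n} (ebarOp i)
  ebarOp-compatible zero          = nothing-compatible
  ebarOp-compatible (suc zero)    = ebar1-compatible
  ebarOp-compatible (suc (suc i)) = conjugate₂-compatible (suc i) (suc (suc i)) (ebarOp-compatible (suc i))

  fbarOp-compatible : ∀ i → Compatible {n} (fbarOp i)
  fbarOp-compatible zero          = nothing-compatible
  fbarOp-compatible (suc zero)    = fbar1-compatible
  fbarOp-compatible (suc (suc i)) = conjugate₂-compatible (suc i) (suc (suc i)) (fbarOp-compatible (suc i))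

  eprOp-compatible : ∀ i → Compatible {n} (eprOp i)
  eprOp-compatible zero          = nothing-compatible
  eprOp-compatible (suc zero)    = epr1-compatible
  eprOp-compatible (suc (suc i)) =
    >=>-compatible (σ-compatible (suc i)) (>=>-compatible (eprOp-compatible (suc i)) (σ-compatible (suc i)))

  fprOp-compatible : ∀ i → Compatible {n} (fprOp i)
  fprOp-compatible zero          = nothing-compatible
  fprOp-compatible (suc zero)    = fpr1-compatible
  fprOp-compatible (suc (suc i)) =
    >=>-compatible (σ-compatible (suc i)) (>=>-compatible (fprOp-compatible (suc i)) (σ-compatible (suc i)))

  raise-compatible : ∀ j → Compatible {n} (raise j)
  raise-compatible (ix i)  = eOp-compatible i
  raise-compatible (bar i) = ebarOp-compatible i
  raise-compatible (prm i) = eprOp-compatible i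

  lower-compatible : ∀ j → Compatible {n} (lower j)
  lower-compatible (ix i)  = fOp-compatible i
  lower-compatible (bar i) = fbarOp-compatible i
  lower-compatible (prm i) = fprOp-compatible i

-- The inverse relabelling

module Inverse (D : Spec) where
  open Embedding D

  rankTo : ℕ → ℕ → ℕ
  rankTo zero    v = 0
  rankTo (suc f) v = if iv D (suc f) ≤ᵇ v then suc f else rankTo f v

  rankTo-iv : ∀ f {c} → c ≤ f → rankTo f (iv D c) ≡ c
  rankTo-iv zero z≤n = refl
  rankTo-iv (suc f) c≤ with m≤n⇒m<n∨m≡n c≤
  ... | inj₂ refl rewrite ≤ᵇ-true (≤-refl {iv D (suc f)}) = refl
  ... | inj₁ (s≤s c≤f) rewrite ≤ᵇ-false (<⇒≱ (iv-mono-< D (s≤s c≤f))) = rankTo-iv f c≤f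

  -- The search may start from `v` because an entry is at least as large as its index, by `iv-≥`.
  rank : ℕ → ℕ
  rank v = rankTo v v

  rank-iv : ∀ c → rank (iv D c) ≡ c
  rank-iv c = rankTo-iv (iv D c) (iv-≥ D c)

  unembed : ℕ → Letter → Letter
  unembed x₀ (lt v p) = lt (rank v) (if v ≡ᵇ x₀ then p else false)

  unembed-first : ∀ c p → unembed (iv D c) (lt (iv D c) p) ≡ lt c p
  unembed-first c p rewrite ≡ᵇ-true {iv D c} refl | rank-iv c = refl

  unembed-other : ∀ {c c₀} p → c ≢ c₀ → unembed (iv D c₀) (lt (iv D c) p) ≡ un c
  unembed-other {c} p n rewrite ≡ᵇ-false (n ∘ iv-injective D) | rank-iv c = refl

  unembed-Sh : ∀ {a hi u} c₀ → a < c₀ → c₀ ≤ hi → Sh D a hi u →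
    Sh C a hi (map (unembed (iv D c₀)) u) × All (λ l → embed c₀ (unembed (iv D c₀) l) ≡ l) u
  unembed-Sh c₀ a< ≤hi done = done , []
  unembed-Sh {a} {hi} c₀ a< ≤hi (up {u = u} s) =
    let t , es = unembed-Sh c₀ a< (m≤n⇒m≤1+n ≤hi) s
        e = unembed-other (g D hi) (>⇒≢ (s≤s ≤hi))
    in subst (λ l → Sh C a hi (l ∷ map (unembed (iv D c₀)) u)) (sym e) (up t) ,
       trans (cong (embed c₀) e) (embed-above false ≤hi) ∷ es
  unembed-Sh {suc a} {hi} c₀ a< ≤hi (dn {u = u} s) =
    let t , es = unembed-Sh c₀ (<⇒≤ a<) ≤hi s
        e = unembed-other (g D (suc a)) (<⇒≢ a<)
    in subst (λ l → Sh C (suc a) hi (l ∷ map (unembed (iv D c₀)) u)) (sym e) (dn t) ,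
       trans (cong (embed c₀) e) (embed-below false a<) ∷ es

  unembed-ClassW : ∀ {w} → ClassW D w →
    let w′ = map (unembed (firstVal w)) w in
    ClassW C w′ × All (λ l → embed (firstVal w′) (unembed (firstVal w) l) ≡ l) w
  unembed-ClassW (start {a} {p} {u} s) rewrite rank-iv (suc a) | ≡ᵇ-true {iv D (suc a)} refl =
    let t , es = unembed-Sh (suc a) (n<1+n a) ≤-refl s in
    start t , trans (cong (embed (suc a)) (unembed-first (suc a) p)) (embed-first (suc a) p) ∷ es

  φ : ∀ {n} → Fact n → Fact n
  φ a = mapF (unembed (firstVal (word a))) a

  mapF-∘ : ∀ (f h : Letter → Letter) {n} (v : Fact n) → mapF f (mapF h v) ≡ mapF (f ∘ h) v
  mapF-∘ f h []      = refl
  mapF-∘ f h (x ∷ v) = cong₂ _∷_ (sym (L.map-∘ x)) (mapF-∘ f h v)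

  unembed-Decr : ∀ x₀ c₀ {n} {v : Fact n} → All (λ l → embed c₀ (unembed x₀ l) ≡ l) (word v) →
                 VAll.All Decr v → VAll.All Decr (mapF (unembed x₀) v)
  unembed-Decr x₀ c₀ {v = []} es [] = []
  unembed-Decr x₀ c₀ {v = x ∷ v} es (d ∷ ds) =
    go (LAllₚ.++⁻ˡ x es) d ∷ unembed-Decr x₀ c₀ (LAllₚ.++⁻ʳ x es) ds
    where
      go : ∀ {l} → All (λ l → embed c₀ (unembed x₀ l) ≡ l) l → Decr l → Decr (map (unembed x₀) l)
      go []       []       = []
      go (e ∷ es) (p ∷ ps) = LAllₚ.map⁺ (LAll.zipWith (λ (e′ , q) → iv-cancel-< D
        (subst₂ _<_ (sym (cong val e′)) (sym (cong val e)) q)) (es , p)) ∷ go es ps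

  φ-Can : ∀ {n} {a : Fact n} → ClassF D [] a → Can (φ a)
  φ-Can {a = a} (d , c) = let c′ , es = unembed-ClassW c in
    unembed-Decr _ _ es d , subst (ClassW C) (sym (word-mapF _ a)) c′

  ψ-φ : ∀ {n} {a : Fact n} → ClassF D [] a → ψ (φ a) ≡ a
  ψ-φ {a = a} (d , c) = trans (mapF-∘ _ _ a)
    (mapF-id-All (λ l e → trans (cong (λ w → embed (firstVal w) (unembed (firstVal (word a)) l)) (word-mapF _ a)) e)
      a (proj₂ (unembed-ClassW c)))

  Sh-unprimed : ∀ {a hi u} → Sh C a hi u → All (λ l → primed l ≡ false) u
  Sh-unprimed done   = []
  Sh-unprimed (up s) = refl ∷ Sh-unprimed s
  Sh-unprimed (dn s) = refl ∷ Sh-unprimed s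

  unembed-embed : ∀ c₀ l → val l ≡ c₀ ⊎ primed l ≡ false → unembed (iv D c₀) (embed c₀ l) ≡ l
  unembed-embed c₀ (lt .c₀ p) (inj₁ refl) =
    trans (cong (unembed (iv D c₀)) (embed-first c₀ p)) (unembed-first c₀ p)
  unembed-embed c₀ (lt c false) (inj₂ refl) with c ≟ c₀
  ... | yes refl = trans (cong (unembed (iv D c₀)) (embed-first c₀ false)) (unembed-first c₀ false)
  ... | no n     = unembed-other _ n

  unembed-embed-word : ∀ {w} → ClassW C w →
    All (λ l → unembed (firstVal (map (embed (firstVal w)) w)) (embed (firstVal w) l) ≡ l) w
  unembed-embed-word (start {a} {p} s) =
    unembed-embed (suc a) (lt (suc a) p) (inj₁ refl) ∷
    LAll.map (λ {l} e → unembed-embed (suc a) l (inj₂ e)) (Sh-unprimed s)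

  φ-ψ : ∀ {n} {b : Fact n} → Can b → φ (ψ b) ≡ b
  φ-ψ {b = b} (d , c) = trans (mapF-∘ _ _ b)
    (mapF-id-All (λ l e → trans (cong (λ w → unembed (firstVal w) (embed (firstVal (word b)) l)) (word-mapF _ b)) e)
      b (unembed-embed-word c))

-- Strict decrease of keys and of values

Decr-StrictDec : ∀ {l} → Decr l → StrictDec l
Decr-StrictDec []             = tt
Decr-StrictDec {_ ∷ []} _     = tt
Decr-StrictDec {x ∷ y ∷ _} ((p ∷ _) ∷ d) = key-< (primed y) (primed x) p , Decr-StrictDec d

Distinct : List Letter → Set
Distinct = AllPairs (λ a b → val a ≢ val b)

-- Keys allow a value to be followed by its own primed form; distinctness of the values excludes
-- this.
StrictDec-Decr : ∀ l {v} → StrictDec l → Distinct (l ++ v) → Decr l × Distinct v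
StrictDec-Decr []          _        d        = [] , d
StrictDec-Decr (x ∷ [])    _        (_ ∷ d)  = [] ∷ [] , d
StrictDec-Decr (x ∷ y ∷ l) (k , sd) ((n ∷ _) ∷ d) with StrictDec-Decr (y ∷ l) sd d
... | d′@(p ∷ _) , dv = (y<x ∷ LAll.map (λ q → <-trans q y<x) p) ∷ d′ , dv
  where y<x = ≤∧≢⇒< (key-cancel (primed y) (primed x) k) (n ∘ sym)

StrictDec-Decr-F : ∀ {n} {a : Fact n} → VAll.All StrictDec a → Distinct (word a) → VAll.All Decr a
StrictDec-Decr-F []                 _ = []
StrictDec-Decr-F {a = x ∷ _} (s ∷ ss) d =
  let d₁ , d₂ = StrictDec-Decr x s d in d₁ ∷ StrictDec-Decr-F ss d₂

module _ {D : Spec} where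

  Sh-distinct : ∀ {a hi u} → a < hi → Sh D a hi u → Distinct u
  Sh-distinct a<hi done = []
  Sh-distinct {a} {hi} a<hi (up s) =
    LAll.map (λ {l} → In-Out D {l = lt (iv D (suc hi)) false} {l} (iv-mono-≤ D (s≤s (<⇒≤ a<hi)) , ≤-refl)) (Sh-out D s)
    ∷ Sh-distinct (m<n⇒m<1+n a<hi) s
  Sh-distinct {suc a} {hi} a<hi (dn s) =
    LAll.map (λ {l} → In-Out D {l = lt (iv D (suc a)) false} {l} (≤-refl , iv-mono-≤ D (<⇒≤ a<hi))) (Sh-out D s)
    ∷ Sh-distinct (<⇒≤ a<hi) s

  ClassW-distinct : ∀ {w} → ClassW D w → Distinct w
  ClassW-distinct (start {a} s) =
    LAll.map (λ {l} → In-Out D {l = lt (iv D (suc a)) false} {l} (≤-refl , ≤-refl)) (Sh-out D s)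
    ∷ Sh-distinct (n<1+n a) s

  ClassF-intro : ∀ {n} {a : Fact n} → VAll.All StrictDec a → ClassW D (word a) → ClassF D [] a
  ClassF-intro s c = StrictDec-Decr-F s (ClassW-distinct c) , c

-- The composition of the tableau and its hook shape

δ : ℕ → ℕ → ℕ
δ x p = if x ≡ᵇ p then 1 else 0

count : (ℕ → ℕ) → ℕ → ℕ → ℕ
count J p zero    = 0
count J p (suc m) = δ (J (suc m)) p + count J p m

total : (ℕ → ℕ) → (ℕ → ℕ) → ℕ → ℕ
total f J zero    = 0
total f J (suc m) = f (J (suc m)) + total f J m

-- The composition with parts k, 1, ..., 1 at the positions J 1, J 2, ..., J k.
hook : ℕ → (ℕ → ℕ) → ℕ → ℕ
hook k J p = count J p k + (if p ≡ᵇ J 1 then k ∸ 1 else 0)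

δ-refl : ∀ x → δ x x ≡ 1
δ-refl x rewrite ≡ᵇ-true {x} refl = refl

δ-≢ : ∀ {x p} → x ≢ p → δ x p ≡ 0
δ-≢ n rewrite ≡ᵇ-false n = refl

Range : ℕ → ℕ → Set
Range k c = 1 ≤ c × c ≤ k

count-zero : ∀ {J p} m → (∀ {c} → Range m c → J c ≢ p) → count J p m ≡ 0
count-zero zero    n = refl
count-zero (suc m) n = cong₂ _+_ (δ-≢ (n (s≤s z≤n , ≤-refl))) (count-zero m λ (p , q) → n (p , m≤n⇒m≤1+n q))

count-positive : ∀ {J c} m → Range m c → 1 ≤ count J (J c) m
count-positive {J} {suc c} (suc m) (p , q) with m≤n⇒m<n∨m≡n q
... | inj₂ refl rewrite δ-refl (J (suc c)) = s≤s z≤n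
... | inj₁ (s≤s q′) = ≤-trans (count-positive m (p , q′)) (m≤n+m _ (δ (J (suc m)) (J (suc c))))

count-find : ∀ {J p} m → 1 ≤ count J p m → ∃ λ c → Range m c × J c ≡ p
count-find {J} {p} (suc m) h with J (suc m) ≟ p
... | yes e = suc m , (s≤s z≤n , ≤-refl) , e
... | no n with count-find m (subst (λ x → 1 ≤ x + count J p m) (δ-≢ n) h)
...   | c , (q , r) , e = c , (q , m≤n⇒m≤1+n r) , e

IncreasingOn : ℕ → (ℕ → ℕ) → Set
IncreasingOn k J = ∀ {c d} → 1 ≤ c → c < d → d ≤ k → J c < J d

DistinctOn : ℕ → (ℕ → ℕ) → Set
DistinctOn k J = ∀ {c d} → 1 ≤ c → c < d → d ≤ k → J c ≢ J d

distinctOn : ∀ {k J} → IncreasingOn k J → DistinctOn k J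
distinctOn inc a b c = <⇒≢ (inc a b c)

count-≤1 : ∀ {J p} m → DistinctOn m J → count J p m ≤ 1
count-≤1 zero inc = z≤n
count-≤1 {J} {p} (suc m) inc with J (suc m) ≟ p
... | no n rewrite δ-≢ n = count-≤1 m (λ a b c → inc a b (m≤n⇒m≤1+n c))
... | yes refl rewrite δ-refl (J (suc m))
    | count-zero {J} {J (suc m)} m (λ (a , b) → inc a (s≤s b) ≤-refl) = ≤-refl

upSum : (ℕ → ℕ) → ℕ → ℕ
upSum f m = sum (applyUpTo f m)

upSum-cong : ∀ {f h} m → (∀ q → f q ≡ h q) → upSum f m ≡ upSum h m
upSum-cong zero    e = refl
upSum-cong (suc m) e = cong₂ _+_ (e 0) (upSum-cong m (e ∘ suc))

upSum-+ : ∀ f h m → upSum (λ q → f q + h q) m ≡ upSum f m + upSum h m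
upSum-+ f h zero    = refl
upSum-+ f h (suc m) = trans (cong (f 0 + h 0 +_) (upSum-+ (f ∘ suc) (h ∘ suc) m))
  (+-interchange (f 0) (h 0) (upSum (f ∘ suc) m) (upSum (h ∘ suc) m))

upSum-zero : ∀ {f} m → (∀ q → f q ≡ 0) → upSum f m ≡ 0
upSum-zero zero    e = refl
upSum-zero (suc m) e = cong₂ _+_ (e 0) (upSum-zero m (e ∘ suc))

upSum-single : ∀ {f} m x → x < m → (∀ q → q ≢ x → f q ≡ 0) → upSum f m ≡ f x
upSum-single {f} (suc m) zero    _         e =
  trans (cong (f 0 +_) (upSum-zero m (λ q → e (suc q) λ ()))) (+-identityʳ (f 0))
upSum-single {f} (suc m) (suc x) (s≤s x<m) e = trans (cong (_+ upSum (f ∘ suc) m) (e 0 λ ()))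
  (upSum-single m x x<m (λ q n → e (suc q) (n ∘ suc-injective)))

-- Summing by value equals summing by index when all values lie in 1, ..., m. With f = 1 it counts
-- the entries, with f = id it compares sums of positions.
upSum-count : ∀ f J k m → (∀ {c} → Range k c → 1 ≤ J c × J c ≤ m) →
              upSum (λ q → f (suc q) * count J (suc q) k) m ≡ total f J k
upSum-count f J zero    m r = upSum-zero m (λ q → *-zeroʳ (f (suc q)))
upSum-count f J (suc k) m r = trans
  (upSum-cong m (λ q → *-distribˡ-+ (f (suc q)) (δ (J (suc k)) (suc q)) (count J (suc q) k)))
  (trans (upSum-+ (λ q → f (suc q) * δ (J (suc k)) (suc q)) _ m)
    (cong₂ _+_ (top (J (suc k)) (r (s≤s z≤n , ≤-refl))) (upSum-count f J k m (λ (a , b) → r (a , m≤n⇒m≤1+n b)))))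
  where
    top : ∀ j → 1 ≤ j × j ≤ m → upSum (λ q → f (suc q) * δ j (suc q)) m ≡ f j
    top (suc x) (_ , x<m) = trans
      (upSum-single m x x<m (λ q n → trans (cong (f (suc q) *_) (δ-≢ (n ∘ sym ∘ suc-injective))) (*-zeroʳ (f (suc q)))))
      (trans (cong (f (suc x) *_) (δ-refl (suc x))) (*-identityʳ (f (suc x))))

total-one : ∀ J k → total (λ _ → 1) J k ≡ k
total-one J zero    = refl
total-one J (suc k) = cong suc (total-one J k)

module _ {D : Spec} where

  countVal-∷ : ∀ p l u → countVal p (l ∷ u) ≡ δ (val l) p + countVal p u
  countVal-∷ p l u with val l ≡ᵇ p
  ... | true  = refl
  ... | false = refl

  -- The letters of `u` are the entries with indices outside a+1, ..., hi; the term for `hi` is kept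
  -- on the left to avoid subtraction.
  countVal-Sh : ∀ {a hi u} p → Sh D a hi u →
                countVal p u + count (iv D) p hi ≡ count (iv D) p (k D) + count (iv D) p a
  countVal-Sh p done = sym (+-identityʳ _)
  countVal-Sh {a} {hi} p (up {u = u} s) = trans
    (cong (_+ count (iv D) p hi) (trans (countVal-∷ p (lt (iv D (suc hi)) (g D hi)) u) (+-comm (δ (iv D (suc hi)) p) (countVal p u))))
    (trans (+-assoc (countVal p u) _ _) (countVal-Sh p s))
  countVal-Sh {suc a} {hi} p (dn {u = u} s) = trans
    (cong (_+ count (iv D) p hi) (countVal-∷ p (lt (iv D (suc a)) (g D (suc a))) u))
    (trans (+-assoc (δ (iv D (suc a)) p) (countVal p u) _)
    (trans (cong (δ (iv D (suc a)) p +_) (countVal-Sh p s))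
    (trans (sym (+-assoc d (count (iv D) p (k D)) _))
    (trans (cong (_+ count (iv D) p a) (+-comm d (count (iv D) p (k D)))) (+-assoc (count (iv D) p (k D)) d _)))))
    where d = δ (iv D (suc a)) p

  countVal-ClassW : ∀ {w} p → ClassW D w → countVal p w ≡ count (iv D) p (k D)
  countVal-ClassW p (start {a} {q} {u} s) = trans (countVal-∷ p (lt (iv D (suc a)) q) u)
    (+-cancelʳ-≡ (count (iv D) p a) _ _ (trans
      (trans (cong (_+ count (iv D) p a) (+-comm (δ (iv D (suc a)) p) (countVal p u)))
        (+-assoc (countVal p u) (δ (iv D (suc a)) p) _)) (countVal-Sh p s)))

  length-Sh : ∀ {a hi u} → Sh D a hi u → length u + hi ≡ k D + a
  length-Sh done = sym (+-identityʳ _)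
  length-Sh (up {hi = hi} {u} s) = trans (sym (+-suc (length u) hi)) (length-Sh s)
  length-Sh (dn {a} s) = trans (cong suc (length-Sh s)) (sym (+-suc (k D) a))

  length-ClassW : ∀ {w} → ClassW D w → length w ≡ k D
  length-ClassW (start {a} {u = u} s) =
    +-cancelʳ-≡ a _ _ (trans (sym (+-suc (length u) a)) (length-Sh s))

  minFold : ℕ → List Letter → ℕ
  minFold x u = foldr (λ l m → val l ⊓ m) x u

  minFold-≥ : ∀ {a hi u x} → Sh D a hi u → iv D 1 ≤ x → iv D 1 ≤ minFold x u
  minFold-≥ done   le = le
  minFold-≥ (up s) le = ⊓-glb (iv-mono-≤ D (s≤s z≤n)) (minFold-≥ s le)
  minFold-≥ (dn s) le = ⊓-glb (iv-mono-≤ D (s≤s z≤n)) (minFold-≥ s le)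

  -- If a > 0 the smallest entry still has to occur in `u`; if a = 0 the bound must come from the
  -- starting value.
  minFold-≤ : ∀ {a hi u x} → Sh D a hi u → (a ≡ 0 → x ≤ iv D 1) → minFold x u ≤ iv D 1
  minFold-≤ done   le = le refl
  minFold-≤ (up s) le = ≤-trans (m⊓n≤n _ _) (minFold-≤ s le)
  minFold-≤ {suc zero}    (dn s) le = m⊓n≤m _ _
  minFold-≤ {suc (suc a)} (dn s) le = ≤-trans (m⊓n≤n _ _) (minFold-≤ s λ ())

  minVal-ClassW : ∀ {w} → ClassW D w → minVal w ≡ iv D 1
  minVal-ClassW (start {a} s) =
    ≤-antisym (minFold-≤ s (λ { refl → ≤-refl })) (minFold-≥ s (iv-mono-≤ D (s≤s z≤n)))

  maxVal-≥ : ∀ T → All (λ l → val l ≤ maxVal T) T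
  maxVal-≥ []      = []
  maxVal-≥ (l ∷ T) = m≤m⊔n _ _ ∷ LAll.map (λ p → ≤-trans p (m≤n⊔m (val l) _)) (maxVal-≥ T)

  countVal-zero : ∀ {p T} → All (λ l → val l ≢ p) T → countVal p T ≡ 0
  countVal-zero []       = refl
  countVal-zero {p} {l ∷ T} (n ∷ ns) = trans (countVal-∷ p l T) (cong₂ _+_ (δ-≢ n) (countVal-zero ns))

  alphaO-ClassW : ∀ {T} → ClassW D T →
    alphaO T ≡ applyUpTo (λ q → hook (k D) (iv D) (suc q)) (maxVal T)
  alphaO-ClassW {T} c = trans (L.map-cong eq (upTo (maxVal T))) (L.map-upTo _ (maxVal T))
    where
      eq : ∀ q → countVal (suc q) T + (if suc q ≡ᵇ minVal T then length T ∸ 1 else 0) ≡ hook (k D) (iv D) (suc q)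
      eq q rewrite countVal-ClassW (suc q) c | minVal-ClassW c | length-ClassW c = refl

  iv-bounded : ∀ {T} → ClassW D T → ∀ {c} → Range (k D) c → iv D c ≤ maxVal T
  iv-bounded {T} cl {c} r = ≮⇒≥ λ m<iv → <⇒≱
    (subst (1 ≤_) (sym (countVal-ClassW (iv D c) cl)) (count-positive (k D) r))
    (≤-reflexive (countVal-zero (LAll.map (λ le → <⇒≢ (≤-<-trans le m<iv)) (maxVal-≥ T))))

at-applyUpTo : ∀ h m q → q < m → at (applyUpTo h m) (suc q) ≡ h q
at-applyUpTo h (suc m) zero    _         = refl
at-applyUpTo h (suc m) (suc q) (s≤s q<m) = at-applyUpTo (h ∘ suc) m q q<m

at-applyUpTo-≥ : ∀ h m q → m ≤ q → at (applyUpTo h m) (suc q) ≡ 0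
at-applyUpTo-≥ h zero    q       _         = refl
at-applyUpTo-≥ h (suc m) (suc q) (s≤s m≤q) = at-applyUpTo-≥ (h ∘ suc) m q m≤q

hook-zero : ∀ {k J p} → 1 ≤ k → (∀ {c} → Range k c → J c ≢ p) → hook k J p ≡ 0
hook-zero {k} {J} {p} 1≤k n rewrite count-zero {J} k n | ≡ᵇ-false (n (≤-refl , 1≤k) ∘ sym) = refl

hook-first : ∀ {k J} → 1 ≤ k → IncreasingOn k J → hook k J (J 1) ≡ k
hook-first {k} {J} 1≤k inc rewrite ≡ᵇ-true {J 1} refl
  | ≤-antisym (count-≤1 {J} {J 1} k (distinctOn inc)) (count-positive k (≤-refl , 1≤k)) = m+[n∸m]≡n 1≤k

hook-other : ∀ {k J p} → p ≢ J 1 → hook k J p ≡ count J p k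
hook-other n rewrite ≡ᵇ-false n = +-identityʳ _

at-alphaO : ∀ {D T} → ClassW D T → ∀ p → 1 ≤ p → at (alphaO T) p ≡ hook (k D) (iv D) p
at-alphaO {D} {T} c (suc q) _ with q <? maxVal T
... | yes q< = trans (cong (λ α → at α (suc q)) (alphaO-ClassW c)) (at-applyUpTo _ (maxVal T) q q<)
... | no q≮ = trans (trans (cong (λ α → at α (suc q)) (alphaO-ClassW c)) (at-applyUpTo-≥ _ (maxVal T) q (≮⇒≥ q≮)))
    (sym (hook-zero (1≤k D) λ r → <⇒≢ (s≤s (≤-trans (iv-bounded c r) (≮⇒≥ q≮)))))

ones : ℕ → ℕ → List ℕ
ones a z = replicate a 1 ++ replicate z 0

insertN-0 : ∀ a z → insertN 0 (ones a z) ≡ ones a (suc z)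
insertN-0 zero    zero    = refl
insertN-0 zero    (suc z) = cong (0 ∷_) (insertN-0 zero z)
insertN-0 (suc a) z       = cong (1 ∷_) (insertN-0 a z)

insertN-1 : ∀ a z → insertN 1 (ones a z) ≡ ones (suc a) z
insertN-1 zero    zero    = refl
insertN-1 zero    (suc z) = refl
insertN-1 (suc a) z       = cong (1 ∷_) (insertN-1 a z)

insertN-top : ∀ a z → insertN (suc a) (ones a z) ≡ suc a ∷ ones a z
insertN-top zero    z = insertN-1 0 z
insertN-top (suc a) z = refl

lambdaOf-binary : ∀ h m → (∀ q → h q ≤ 1) → ∃ λ z → lambdaOf (applyUpTo h m) ≡ ones (upSum h m) z
lambdaOf-binary h zero    le = 0 , refl
lambdaOf-binary h (suc m) le with lambdaOf-binary (h ∘ suc) m (le ∘ suc) | h 0 | le 0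
... | z , e | 0 | _ = suc z , trans (cong (insertN 0) e) (insertN-0 (upSum (h ∘ suc) m) z)
... | z , e | 1 | _ = z , trans (cong (insertN 1) e) (insertN-1 (upSum (h ∘ suc) m) z)
... | _ | suc (suc _) | s≤s ()

-- Sorting inserts from the right: the parts after `s` become ones and zeros, the large part goes on
-- top, the remaining zeros go to the end. The total sum determines the number of ones.
lambdaOf-hook : ∀ h m s a → s < m → (∀ q → q < s → h q ≡ 0) → h s ≡ suc a → (∀ q → s < q → h q ≤ 1) →
                upSum h m ≡ suc a + a → ∃ λ z → lambdaOf (applyUpTo h m) ≡ suc a ∷ ones a z
lambdaOf-hook h (suc m) zero a _ _ e le es
  with lambdaOf-binary (h ∘ suc) m (λ q → le (suc q) (s≤s z≤n))
... | z , eq = z , trans (cong₂ insertN e (trans eq (cong (λ b → ones b z)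
                     (+-cancelˡ-≡ (suc a) _ _ (trans (cong (_+ upSum (h ∘ suc) m) (sym e)) es))))) (insertN-top a z)
lambdaOf-hook h (suc m) (suc s) a (s≤s s<m) ze e le es
  with lambdaOf-hook (h ∘ suc) m s a s<m (λ q q<s → ze (suc q) (s≤s q<s)) e (λ q s<q → le (suc q) (s≤s s<q))
         (trans (sym (cong (_+ upSum (h ∘ suc) m) (ze 0 (s≤s z≤n)))) es)
... | z , eq = suc z , trans (cong₂ insertN (ze 0 (s≤s z≤n)) eq) (cong (suc a ∷_) (insertN-0 a z))

at-ones : ∀ a z i → i < a → at (ones a z) (suc i) ≡ 1
at-ones (suc a) z zero    _         = refl
at-ones (suc a) z (suc i) (s≤s i<a) = at-ones a z i i<a

at-ones-≥ : ∀ a z i → a ≤ i → at (ones a z) (suc i) ≡ 0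
at-ones-≥ zero    zero    i       _         = refl
at-ones-≥ zero    (suc z) zero    _         = refl
at-ones-≥ zero    (suc z) (suc i) _         = at-ones-≥ zero z i z≤n
at-ones-≥ (suc a) z       (suc i) (s≤s a≤i) = at-ones-≥ a z i a≤i

lambdaOf-IsHook : ∀ {D T} → ClassW D T → IsHook (k D) (lambdaOf (alphaO T))
lambdaOf-IsHook {D} {T} cl = go (k D) (iv D 1) refl refl
  where
    h : ℕ → ℕ
    h q = hook (k D) (iv D) (suc q)
    inc : IncreasingOn (k D) (iv D)
    inc _ c<d _ = iv-mono-< D c<d
    sum-count : upSum (λ q → count (iv D) (suc q) (k D)) (maxVal T) ≡ k D
    sum-count = trans (upSum-cong (maxVal T) (λ q → sym (*-identityˡ _)))
      (trans (upSum-count (λ _ → 1) (iv D) (k D) (maxVal T)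
               (λ { {suc c} r → iv-positive D c , iv-bounded cl r ; {zero} (() , _) }))
             (total-one (iv D) (k D)))
    -- Naming `k` and `iv 1` brings them into the forms `suc a` and `suc s`, so that k - 1 is a and
    -- the large part has list index s.
    go : ∀ n i → k D ≡ n → iv D 1 ≡ i → IsHook n (lambdaOf (alphaO T))
    go zero _ e _ = contradiction (1≤k D) (<⇒≱ (s≤s (≤-reflexive e)))
    go (suc a) zero _ e = contradiction (iv-positive D 0) (<⇒≱ (s≤s (≤-reflexive e)))
    go (suc a) (suc s) ek ei with lambdaOf-hook h (maxVal T) s a s<m ze es le sm
      where
        s<m : s < maxVal T
        s<m = subst (_≤ maxVal T) ei (iv-bounded cl (≤-refl , 1≤k D))
        ze : ∀ q → q < s → h q ≡ 0
        ze q q<s = hook-zero (1≤k D) λ { {suc c} _ → >⇒≢ (<-≤-trans (subst (suc q <_) (sym ei) (s≤s q<s))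
                                          (iv-mono-≤ D (s≤s z≤n))) ; {zero} (() , _) }
        es : h s ≡ suc a
        es = trans (cong (hook (k D) (iv D)) (sym ei)) (trans (hook-first (1≤k D) inc) ek)
        le : ∀ q → s < q → h q ≤ 1
        le q s<q = ≤-trans (≤-reflexive (hook-other {k D} {iv D} (λ e → >⇒≢ s<q (suc-injective (trans e ei)))))
                     (count-≤1 {iv D} (k D) (distinctOn inc))
        -- The counts contribute k, and the extra term at the first entry contributes k - 1.
        sm : upSum h (maxVal T) ≡ suc a + a
        sm = trans (upSum-+ (λ q → count (iv D) (suc q) (k D)) _ (maxVal T))
          (cong₂ _+_ (trans sum-count ek)
            (trans (upSum-single (maxVal T) s s<m
                     (λ q n → cong (λ b → if b then k D ∸ 1 else 0) (≡ᵇ-false (λ e → n (suc-injective (trans e ei))))))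
              (trans (cong (λ b → if b then k D ∸ 1 else 0) (≡ᵇ-true (sym ei))) (cong (_∸ 1) ek))))
    ... | z , e = subst (λ α → IsHook (suc a) (lambdaOf α)) (sym (alphaO-ClassW cl))
                    (subst (IsHook (suc a)) (sym e)
                      (refl , (λ { (suc (suc i)) _ (s≤s i<a) → at-ones a z i i<a ; (suc zero) (s≤s ()) _ }) ,
                        (λ { (suc (suc i)) (s≤s a≤i) → at-ones-≥ a z i (≤-pred a≤i) ; (suc zero) (s≤s ()) })))

-- Reduced words of u(α)

actAt : ℕ → ℕ → ℕ
actAt zero    x = x
actAt (suc j) x = swap (suc j) x

-- `foldr` makes the last letter act first, as in `applyWord`. The letter 0 acts trivially there
-- too; it can occur in `js` until minimality excludes it.
posOf : List ℕ → ℕ → ℕ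
posOf js c = foldr actAt c js

actAt-involutive : ∀ j x → actAt j (actAt j x) ≡ x
actAt-involutive zero    x = refl
actAt-involutive (suc j) x = swap-involutive (suc j) x

actAt-injective : ∀ j {x y} → actAt j x ≡ actAt j y → x ≡ y
actAt-injective j {x} {y} e =
  trans (sym (actAt-involutive j x)) (trans (cong (actAt j) e) (actAt-involutive j y))

actAt-positive : ∀ j {x} → 1 ≤ x → 1 ≤ actAt j x
actAt-positive zero    p = p
actAt-positive (suc j) p = swap-positive (suc j) (s≤s z≤n) p

posOf-positive : ∀ js {c} → 1 ≤ c → 1 ≤ posOf js c
posOf-positive []       p = p
posOf-positive (j ∷ js) p = actAt-positive j (posOf-positive js p)

posOf-injective : ∀ js {x y} → posOf js x ≡ posOf js y → x ≡ y
posOf-injective []       e = e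
posOf-injective (j ∷ js) e = posOf-injective js (actAt-injective j e)

posOf-distinct : ∀ js {k} → DistinctOn k (posOf js)
posOf-distinct js _ c<d _ e = <⇒≢ c<d (posOf-injective js e)

at-length : ∀ α q → length α ≤ q → at α (suc q) ≡ 0
at-length []      q       _         = refl
at-length (x ∷ α) (suc q) (s≤s l≤q) = at-length α q l≤q

at-zero : ∀ α → at α 0 ≡ 0
at-zero []      = refl
at-zero (_ ∷ _) = refl

at-sAct : ∀ j α p → 1 ≤ p → at (sAct j α) p ≡ at α (actAt j p)
at-sAct zero    α p       _ = refl
at-sAct (suc j) α (suc q) _ with q <? length α ⊔ suc (suc j)
... | yes q<m = trans (cong (λ β → at β (suc q)) (L.map-upTo _ (length α ⊔ suc (suc j)))) (at-applyUpTo _ _ q q<m)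
... | no q≮m = trans
        (trans (cong (λ β → at β (suc q)) (L.map-upTo _ (length α ⊔ suc (suc j)))) (at-applyUpTo-≥ _ _ q m≤q))
        (sym (trans (cong (at α) (swap-above (s≤s (≤-trans (m≤n⊔m (length α) _) m≤q))))
          (at-length α q (≤-trans (m≤m⊔n (length α) _) m≤q))))
  where m≤q = ≮⇒≥ q≮m

≡ᵇ-actAt : ∀ j x p → (actAt j x ≡ᵇ p) ≡ (x ≡ᵇ actAt j p)
≡ᵇ-actAt j x p with x ≟ actAt j p
... | yes e = trans (≡ᵇ-true (trans (cong (actAt j) e) (actAt-involutive j p))) (sym (≡ᵇ-true e))
... | no n  = trans (≡ᵇ-false (λ e → n (trans (sym (actAt-involutive j x)) (cong (actAt j) e)))) (sym (≡ᵇ-false n))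

count-actAt : ∀ j J p m → count (actAt j ∘ J) p m ≡ count J (actAt j p) m
count-actAt j J p zero    = refl
count-actAt j J p (suc m) =
  cong₂ _+_ (cong (λ b → if b then 1 else 0) (≡ᵇ-actAt j (J (suc m)) p)) (count-actAt j J p m)

hook-actAt : ∀ k j J p → hook k (actAt j ∘ J) p ≡ hook k J (actAt j p)
hook-actAt k j J p =
  cong₂ _+_ (count-actAt j J p k) (cong (λ b → if b then k ∸ 1 else 0) (sym (≡ᵇ-actAt j p (J 1))))

at-applyWord : ∀ {k β} → (∀ p → 1 ≤ p → at β p ≡ hook k id p) →
               ∀ js p → 1 ≤ p → at (applyWord js β) p ≡ hook k (posOf js) p
at-applyWord e []       p 1≤p = e p 1≤p
at-applyWord {k} {β} e (j ∷ js) p 1≤p = trans (at-sAct j (applyWord js β) p 1≤p)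
  (trans (at-applyWord {k} {β} e js (actAt j p) (actAt-positive j 1≤p)) (sym (hook-actAt k j (posOf js) p)))

IsHook-hook : ∀ {k lam} → 1 ≤ k → IsHook k lam → ∀ p → 1 ≤ p → at lam p ≡ hook k id p
IsHook-hook {k} 1≤k (h₁ , h₂ , h₃) p 1≤p with p ≟ 1 | p ≤? k
... | yes refl | _ = trans h₁ (sym (hook-first {k} {id} 1≤k (λ _ c<d _ → c<d)))
... | no n | yes p≤k = trans (h₂ p (≤∧≢⇒< 1≤p (n ∘ sym)) p≤k)
        (sym (trans (hook-other {k} {id} n)
          (≤-antisym (count-≤1 {id} k (λ _ c<d _ → <⇒≢ c<d)) (count-positive {id} k (1≤p , p≤k)))))
... | no n | no p≰k = trans (h₃ p (≰⇒> p≰k)) (sym (hook-zero {k} {id} 1≤k (λ (_ , c≤k) → <⇒≢ (≤-<-trans c≤k (≰⇒> p≰k)))))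

count-cong : ∀ {J I} m p → (∀ {c} → Range m c → J c ≡ I c) → count J p m ≡ count I p m
count-cong zero    p e = refl
count-cong (suc m) p e = cong₂ _+_ (cong (λ x → δ x p) (e (s≤s z≤n , ≤-refl)))
  (count-cong m p λ (a , b) → e (a , m≤n⇒m≤1+n b))

hook-cong : ∀ {k J I} → 1 ≤ k → (∀ {c} → Range k c → J c ≡ I c) → ∀ p → hook k J p ≡ hook k I p
hook-cong {k} 1≤k e p =
  cong₂ _+_ (count-cong k p e) (cong (λ x → if p ≡ᵇ x then k ∸ 1 else 0) (e (≤-refl , 1≤k)))

count-zero⇒hook-zero : ∀ {k J p} → 1 ≤ k → count J p k ≡ 0 → hook k J p ≡ 0
count-zero⇒hook-zero {k} {J} 1≤k e =
  hook-zero {k} {J} 1≤k λ { r refl → <⇒≢ (count-positive {J} k r) (sym e) }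

-- A place is vacant exactly when its part is zero, and the counts are 0 or 1, so the composition
-- determines the set of occupied places.
hook⇒count : ∀ {k J I} → 1 ≤ k → DistinctOn k J → DistinctOn k I → ∀ p →
             hook k J p ≡ hook k I p → count J p k ≡ count I p k
hook⇒count {k} {J} {I} 1≤k dJ dI p e
  with count J p k in eJ | count I p k in eI | count-≤1 {J} {p} k dJ | count-≤1 {I} {p} k dI
... | 0 | 0 | _ | _ = refl
... | 1 | 1 | _ | _ = refl
... | suc (suc _) | _ | s≤s () | _
... | _ | suc (suc _) | _ | s≤s ()
... | 0 | 1 | _ | _ = contradiction
        (trans (sym eI) (m+n≡0⇒m≡0 (count I p k) (trans (sym e′) (count-zero⇒hook-zero {k} {J} 1≤k eJ)))) λ ()
  where
    e′ : hook k J p ≡ hook k I p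
    e′ = trans (cong (_+ (if p ≡ᵇ J 1 then k ∸ 1 else 0)) eJ) (trans e (cong (_+ (if p ≡ᵇ I 1 then k ∸ 1 else 0)) (sym eI)))
... | 1 | 0 | _ | _ = contradiction
        (trans (sym eJ) (m+n≡0⇒m≡0 (count J p k) (trans e′ (count-zero⇒hook-zero {k} {I} 1≤k eI)))) λ ()
  where
    e′ : hook k J p ≡ hook k I p
    e′ = trans (cong (_+ (if p ≡ᵇ J 1 then k ∸ 1 else 0)) eJ) (trans e (cong (_+ (if p ≡ᵇ I 1 then k ∸ 1 else 0)) (sym eI)))

total-≥ : ∀ J k {c} → Range k c → J c ≤ total id J k
total-≥ J zero {suc c} (_ , ())
total-≥ J (suc k) (a , b) with m≤n⇒m<n∨m≡n b
... | inj₂ refl     = m≤m+n _ _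
... | inj₁ (s≤s b′) = ≤-trans (total-≥ J k (a , b′)) (m≤n+m _ (J (suc k)))

total-count : ∀ {k J I} → (∀ {c} → Range k c → 1 ≤ J c) → (∀ {c} → Range k c → 1 ≤ I c) →
              (∀ p → 1 ≤ p → count J p k ≡ count I p k) → total id J k ≡ total id I k
total-count {k} {J} {I} pJ pI e = trans
  (sym (upSum-count id J k m (λ r → pJ r , ≤-trans (total-≥ J k r) (m≤m+n _ _))))
  (trans (upSum-cong m (λ q → cong (suc q *_) (e (suc q) (s≤s z≤n))))
    (upSum-count id I k m (λ r → pI r , ≤-trans (total-≥ I k r) (m≤n+m _ (total id J k)))))
  where m = total id J k + total id I k

swap-δ : ∀ j x → swap j x + δ x (suc j) ≡ x + δ x j
swap-δ j x with swapView j x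
... | isL refl e rewrite e | δ-≢ (<⇒≢ (n<1+n x)) | δ-refl x = trans (+-identityʳ (suc x)) (sym (+-comm x 1))
... | isR refl e rewrite e | δ-refl (suc j) | δ-≢ (1+n≢n {j}) = trans (+-comm j 1) (sym (+-identityʳ (suc j)))
... | other p q e rewrite e | δ-≢ q | δ-≢ p = refl

-- The letter j raises a part standing at j by one place and lowers a part standing at j+1 by one.
-- Both effects enter additively, which avoids subtraction.
total-swap : ∀ j J m → total id (swap j ∘ J) m + count J (suc j) m ≡ total id J m + count J j m
total-swap j J zero    = refl
total-swap j J (suc m) = trans (+-interchange (swap j x) (total id (swap j ∘ J) m) (δ x (suc j)) (count J (suc j) m))
  (trans (cong₂ _+_ (swap-δ j x) (total-swap j J m)) (+-interchange x (δ x j) (total id J m) (count J j m)))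
  where x = J (suc m)

total-posOf : ∀ k js → total id (posOf js) k ≤ total id id k + length js
total-posOf k []             = m≤m+n _ _
total-posOf k (zero ∷ js)    = ≤-trans (total-posOf k js) (+-monoʳ-≤ (total id id k) (n≤1+n (length js)))
total-posOf k (suc j ∷ js)   = ≤-trans (m≤m+n _ (count (posOf js) (suc (suc j)) k))
  (≤-trans (≤-reflexive (total-swap (suc j) (posOf js) k))
    (≤-trans (+-mono-≤ (total-posOf k js) (count-≤1 {posOf js} k (posOf-distinct js)))
      (≤-reflexive (trans (+-assoc (total id id k) (length js) 1) (cong (total id id k +_) (+-comm (length js) 1))))))

-- Every letter of the word moves one of the k nonzero parts up into an empty place.
data Climb (k : ℕ) : List ℕ → Set where
  []   : Climb k []
  move : ∀ {j js c} → 1 ≤ j → Range k c → posOf js c ≡ j → (∀ {d} → Range k d → posOf js d ≢ suc j) →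
         Climb k js → Climb k (j ∷ js)

actAt-swap : ∀ {j} → 1 ≤ j → ∀ x → actAt j x ≡ swap j x
actAt-swap {suc j} _ x = refl

-- `swap j` reverses the order of j and j+1 only, and this pair is excluded by y ≠ j+1. So the parts
-- never overtake each other in a climb.
swap-increasing : ∀ {j x y} → x < y → y ≢ suc j → swap j x < swap j y
swap-increasing {j} {x} {y} x<y y≢ with swapView j x | swapView j y
... | _ | isR e _ = contradiction e y≢
... | isL refl ex | isL refl _ = contradiction x<y (<-irrefl refl)
... | isL refl ex | other _ _ ey rewrite ex | ey = ≤∧≢⇒< x<y (y≢ ∘ sym)
... | isR refl ex | isL refl _ = contradiction x<y (<⇒≯ (n<1+n _))
... | isR refl ex | other _ _ ey rewrite ex | ey = <⇒≤ x<y
... | other _ _ ex | isL refl ey rewrite ex | ey = m<n⇒m<1+n x<y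
... | other _ _ ex | other _ _ ey rewrite ex | ey = x<y

Climb-increasing : ∀ {k js} → Climb k js → IncreasingOn k (posOf js)
Climb-increasing [] _ c<d _ = c<d
Climb-increasing (move {j} {js} 1≤j _ _ vacant cl) {c} {d} 1≤c c<d d≤k =
  subst₂ _<_ (sym (actAt-swap 1≤j _)) (sym (actAt-swap 1≤j _))
    (swap-increasing (Climb-increasing cl 1≤c c<d d≤k) (vacant (≤-trans 1≤c (<⇒≤ c<d) , d≤k)))

-- One letter raises the sum of the positions of the parts by at most 1, with
-- equality only for a move into an empty place.
climb? : ∀ k js → Climb k js ⊎ total id (posOf js) k < total id id k + length js
climb? k [] = inj₁ []
climb? k (zero ∷ js) = inj₂ (≤-<-trans (total-posOf k js) (+-monoʳ-< (total id id k) (n<1+n (length js))))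
climb? k (suc j ∷ js) = go (climb? k js)
  where
    J = posOf js
    S : ℕ
    S = total id (posOf (suc j ∷ js)) k
    eq : S + count J (suc (suc j)) k ≡ total id J k + count J (suc j) k
    eq = total-swap (suc j) J k
    flat : S ≤ total id J k → S < total id id k + length (suc j ∷ js)
    flat le = ≤-<-trans (≤-trans le (total-posOf k js)) (+-monoʳ-< (total id id k) (n<1+n (length js)))
    go : Climb k js ⊎ total id J k < total id id k + length js →
         Climb k (suc j ∷ js) ⊎ S < total id id k + length (suc j ∷ js)
    go (inj₂ S<) = inj₂ (≤-<-trans
      (≤-trans (m≤m+n S (count J (suc (suc j)) k)) (≤-trans (≤-reflexive eq)
        (+-monoʳ-≤ (total id J k) (count-≤1 {J} k (posOf-distinct js)))))
      (subst₂ _<_ (+-comm 1 (total id J k)) (sym (+-suc (total id id k) (length js))) (s≤s S<)))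
    go (inj₁ cl) with 1 ≤? count J (suc j) k | 1 ≤? count J (suc (suc j)) k
    ... | no z | _ = inj₂ (flat (≤-trans (m≤m+n S _) (≤-reflexive (trans eq
            (trans (cong (total id J k +_) (n<1⇒n≡0 (≰⇒> z))) (+-identityʳ _))))))
    ... | yes _ | yes p = inj₂ (flat (+-cancelʳ-≤ 1 S (total id J k) (≤-trans (+-monoʳ-≤ S p)
            (≤-trans (≤-reflexive eq) (+-monoʳ-≤ (total id J k) (count-≤1 {J} k (posOf-distinct js)))))))
    ... | yes p | no z with count-find {J} k p
    ...   | c , r , e = inj₁ (move (s≤s z≤n) r e
              (λ { r′ refl′ → z (subst (λ x → 1 ≤ count J x k) refl′ (count-positive {J} k r′)) }) cl)

-- Read from the right these are the letters a, a+1, ..., t+a-1, which carry position a to t+a.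
climbFrom : ℕ → ℕ → List ℕ
climbFrom a zero    = []
climbFrom a (suc t) = (t + a) ∷ climbFrom a t

climbFrom-below : ∀ a t {x} → x < a → posOf (climbFrom a t) x ≡ x
climbFrom-below a zero    x<a = refl
climbFrom-below a (suc t) {x} x<a rewrite climbFrom-below a t x<a =
  trans (actAt-swap (≤-trans (≤-trans (s≤s z≤n) x<a) (m≤n+m a t)) x) (swap-below (<-≤-trans x<a (m≤n+m a t)))

climbFrom-above : ∀ a t {x} → 1 ≤ a → t + a < x → posOf (climbFrom a t) x ≡ x
climbFrom-above a zero    1≤a <x = refl
climbFrom-above a (suc t) {x} 1≤a <x rewrite climbFrom-above a t 1≤a (<⇒≤ <x) =
  trans (actAt-swap (≤-trans 1≤a (m≤n+m a t)) x) (swap-above <x)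

climbFrom-start : ∀ a t → 1 ≤ a → posOf (climbFrom a t) a ≡ t + a
climbFrom-start a zero    1≤a = refl
climbFrom-start a (suc t) 1≤a rewrite climbFrom-start a t 1≤a =
  trans (actAt-swap (≤-trans 1≤a (m≤n+m a t)) (t + a)) (swap-l (t + a))

length-climbFrom : ∀ a t → length (climbFrom a t) ≡ t
length-climbFrom a zero    = refl
length-climbFrom a (suc t) = cong suc (length-climbFrom a t)

posOf-++ : ∀ xs ys c → posOf (xs ++ ys) c ≡ posOf xs (posOf ys c)
posOf-++ xs ys c = L.foldr-++ actAt c xs ys

module _ (D : Spec) where

  -- An explicit competitor for the minimality of `js`. The last part climbs first, so every part
  -- meets only vacant places, and the length is the sum of all i_c - c.
  ladder : ℕ → List ℕ
  ladder zero    = []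
  ladder (suc m) = ladder m ++ climbFrom (suc m) (iv D (suc m) ∸ suc m)

  ladder-above : ∀ m {x} → iv D m < x → posOf (ladder m) x ≡ x
  ladder-above zero    _   = refl
  ladder-above (suc m) {x} <x = trans (posOf-++ (ladder m) _ x)
    (trans (cong (posOf (ladder m)) (climbFrom-above (suc m) _ (s≤s z≤n)
             (subst (_< x) (sym (m∸n+n≡m (iv-≥ D (suc m)))) <x)))
      (ladder-above m (<-trans (iv-suc D m) <x)))

  ladder-iv : ∀ m {c} → Range m c → posOf (ladder m) c ≡ iv D c
  ladder-iv zero    {suc c} (_ , ())
  ladder-iv (suc m) {c} (1≤c , c≤) with m≤n⇒m<n∨m≡n c≤
  ... | inj₁ c<@(s≤s c≤m) = trans (posOf-++ (ladder m) _ c)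
        (trans (cong (posOf (ladder m)) (climbFrom-below (suc m) (iv D (suc m) ∸ suc m) c<)) (ladder-iv m (1≤c , c≤m)))
  ... | inj₂ refl = trans (posOf-++ (ladder m) _ c)
        (trans (cong (posOf (ladder m))
                 (trans (climbFrom-start (suc m) _ (s≤s z≤n)) (m∸n+n≡m (iv-≥ D (suc m)))))
          (ladder-above m (iv-suc D m)))

  ladder-length : ∀ m → length (ladder m) + total id id m ≡ total id (iv D) m
  ladder-length zero    = refl
  ladder-length (suc m) = trans (cong (_+ (suc m + total id id m))
      (trans (L.length-++ (ladder m)) (trans (cong (length (ladder m) +_) (length-climbFrom (suc m) t)) (+-comm _ t))))
    (trans (+-interchange t (length (ladder m)) (suc m) (total id id m))
      (cong₂ _+_ (m∸n+n≡m (iv-≥ D (suc m))) (ladder-length m)))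
    where t = iv D (suc m) ∸ suc m

-- Downward induction from the index k, with e = k - c. If J c = I d with d > c, then J (c+1) > I d
-- ≥ I (c+1), against the bound already known at c+1.
agree-≤ : ∀ {k J I} → IncreasingOn k J → IncreasingOn k I → (∀ {c} → Range k c → ∃ λ d → Range k d × I d ≡ J c) →
          ∀ e c → 1 ≤ c → e + c ≡ k → J c ≤ I c
agree-≤ {k} {J} {I} iJ iI find zero c 1≤c refl with find (1≤c , ≤-refl)
... | d , (1≤d , d≤c) , eq with m≤n⇒m<n∨m≡n d≤c
...   | inj₂ refl = ≤-reflexive (sym eq)
...   | inj₁ d<c  = subst (_≤ I c) eq (<⇒≤ (iI 1≤d d<c ≤-refl))
agree-≤ {k} {J} {I} iJ iI find (suc e) c 1≤c refl with find (1≤c , <⇒≤ (s≤s (m≤n+m c e)))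
... | d , (1≤d , d≤k) , eq with <-cmp d c
...   | tri≈ _ refl _ = ≤-reflexive (sym eq)
...   | tri< d<c _ _ = subst (_≤ I c) eq (<⇒≤ (iI 1≤d d<c (<⇒≤ (s≤s (m≤n+m c e)))))
...   | tri> _ _ c<d = contradiction (agree-≤ {k} {J} {I} iJ iI find e (suc c) (s≤s z≤n) (+-suc e c))
          (<⇒≱ (≤-<-trans (I≤ (m≤n⇒m<n∨m≡n c<d)) (subst (_< J (suc c)) (sym eq) (iJ 1≤c (n<1+n c) (s≤s (m≤n+m c e))))))
  where
    I≤ : suc c < d ⊎ suc c ≡ d → I (suc c) ≤ I d
    I≤ (inj₁ p)    = <⇒≤ (iI (s≤s z≤n) p d≤k)
    I≤ (inj₂ refl) = ≤-refl

count-agree : ∀ {k J I} → IncreasingOn k J → IncreasingOn k I → (∀ p → 1 ≤ p → count J p k ≡ count I p k) →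
              (∀ {c} → Range k c → 1 ≤ J c × 1 ≤ I c) → ∀ {c} → Range k c → J c ≡ I c
count-agree {k} {J} {I} iJ iI e pos {c} (1≤c , c≤k) = ≤-antisym
  (agree-≤ {k} {J} {I} iJ iI (λ r → count-find {I} k (subst (1 ≤_) (e _ (proj₁ (pos r))) (count-positive {J} k r)))
     (k ∸ c) c 1≤c (m∸n+n≡m c≤k))
  (agree-≤ {k} {I} {J} iI iJ (λ r → count-find {J} k (subst (1 ≤_) (sym (e _ (proj₂ (pos r)))) (count-positive {I} k r)))
     (k ∸ c) c 1≤c (m∸n+n≡m c≤k))

-- By minimality `js` is at most as long as the ladder, whose length is the total rise of the
-- positions. A word that wastes a letter would fall short of this rise, although it reaches the
-- same places.
redWord-climb : ∀ {D T js} → ClassW D T → IsRedWordU (alphaO T) js →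
                Climb (k D) js × (∀ {c} → Range (k D) c → posOf js c ≡ iv D c)
redWord-climb {D} {T} {js} cl (js≈ , minimal) = climb , count-agree {K} {posOf js} {iv D}
    (Climb-increasing climb) incI same-count (λ r → posOf-positive js (proj₁ r) , pos r)
  where
    K = k D
    incI : IncreasingOn K (iv D)
    incI _ c<d _ = iv-mono-< D c<d
    pos : ∀ {c} → Range K c → 1 ≤ iv D c
    pos {suc c} _ = iv-positive D c
    base : ∀ p → 1 ≤ p → at (lambdaOf (alphaO T)) p ≡ hook K id p
    base = IsHook-hook {K} {lambdaOf (alphaO T)} (1≤k D) (lambdaOf-IsHook cl)
    same-count : ∀ p → 1 ≤ p → count (posOf js) p K ≡ count (iv D) p K
    same-count p 1≤p = hook⇒count {K} {posOf js} {iv D} (1≤k D) (posOf-distinct js) (distinctOn incI) p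
      (trans (sym (at-applyWord {K} {lambdaOf (alphaO T)} base js p 1≤p)) (trans (js≈ p) (at-alphaO cl p 1≤p)))
    ks = ladder D K
    ks≈ : applyWord ks (lambdaOf (alphaO T)) ≈c alphaO T
    ks≈ zero    = trans (at-zero (applyWord ks (lambdaOf (alphaO T)))) (sym (at-zero (alphaO T)))
    ks≈ (suc p) = trans (at-applyWord {K} {lambdaOf (alphaO T)} base ks (suc p) (s≤s z≤n))
      (trans (hook-cong {K} {posOf ks} {iv D} (1≤k D) (ladder-iv D K) (suc p)) (sym (at-alphaO cl (suc p) (s≤s z≤n))))
    climb : Climb K js
    climb with climb? K js
    ... | inj₁ c  = c
    ... | inj₂ S< = contradiction S< (≤⇒≯ (≤-trans (+-monoʳ-≤ (total id id K) (minimal ks ks≈))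
            (≤-reflexive (trans (+-comm (total id id K) (length ks)) (trans (ladder-length D K)
              (sym (total-count {K} {posOf js} {iv D} (λ r → posOf-positive js (proj₁ r)) pos same-count)))))))

-- Demazure operators as flag conditions

FlagAt : (ℕ → Letter → Set) → ∀ {n} → ℕ → Fact n → Set
FlagAt P i []      = ⊤
FlagAt P i (x ∷ v) = All (P i) x × FlagAt P (suc i) v

FlagAt-map : ∀ {P Q : ℕ → Letter → Set} {n} t {v : Fact n} →
             (∀ i {l} → t ≤ i → P i l → Q i l) → FlagAt P t v → FlagAt Q t v
FlagAt-map t {[]}    f _        = tt
FlagAt-map t {x ∷ v} f (p , ps) =
  LAll.map (f t ≤-refl) p , FlagAt-map (suc t) (λ i t<i → f i (<⇒≤ t<i)) ps

FlagAt-zip : ∀ {P : Letter → Set} {Q R : ℕ → Letter → Set} → (∀ i {l} → P l → Q i l → R i l) →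
             ∀ {n} t (v : Fact n) → All P (word v) → FlagAt Q t v → FlagAt R t v
FlagAt-zip f t []      _  _        = tt
FlagAt-zip f t (x ∷ v) ps (q , qs) =
  LAll.zipWith (λ (a , b) → f t a b) (LAllₚ.++⁻ˡ x ps , q) , FlagAt-zip f (suc t) v (LAllₚ.++⁻ʳ x ps) qs

FlagAt-mapF⁺ : ∀ {P : ℕ → Letter → Set} r {n} t (v : Fact n) → FlagAt (λ i l → P i (r l)) t v → FlagAt P t (mapF r v)
FlagAt-mapF⁺ r t []      _        = tt
FlagAt-mapF⁺ r t (x ∷ v) (p , ps) = LAllₚ.map⁺ p , FlagAt-mapF⁺ r (suc t) v ps

FlagAt-mapF⁻ : ∀ {P : ℕ → Letter → Set} r {n} t (v : Fact n) → FlagAt P t (mapF r v) → FlagAt (λ i l → P i (r l)) t v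
FlagAt-mapF⁻ r t []      _        = tt
FlagAt-mapF⁻ r t (x ∷ v) (p , ps) = LAllₚ.map⁻ p , FlagAt-mapF⁻ r (suc t) v ps

FlagAt-lookup : ∀ {P : ℕ → Letter → Set} {n} t (v : Fact n) → FlagAt P t v → ∀ i → All (P (t + toℕ i)) (V.lookup v i)
FlagAt-lookup {P} t (x ∷ v) (p , ps) F.zero    = subst (λ s → All (P s) x) (sym (+-identityʳ t)) p
FlagAt-lookup {P} t (x ∷ v) (p , ps) (F.suc i) =
  subst (λ s → All (P s) (V.lookup v i)) (sym (+-suc t (toℕ i))) (FlagAt-lookup (suc t) v ps i)

FlagAt-tabulate : ∀ {P : ℕ → Letter → Set} {n} t (v : Fact n) → (∀ i → All (P (t + toℕ i)) (V.lookup v i)) → FlagAt P t v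
FlagAt-tabulate {P} t []      f = tt
FlagAt-tabulate {P} t (x ∷ v) f = subst (λ s → All (P s) x) (+-identityʳ t) (f F.zero) ,
  FlagAt-tabulate (suc t) v (λ i → subst (λ s → All (P s) (V.lookup v i)) (+-suc t (toℕ i)) (f (F.suc i)))

RaiseStep-All⁻ : ∀ {P Q : Letter → Set} {L R L′ R′} → (∀ {l} → P l → Q l) → RaiseStep L R L′ R′ →
                 All P L′ → All Q R′ → All P L × All Q R
RaiseStep-All⁻ f (first {L} _ _) pl qr with LAllₚ.++⁻ L pl
... | p , (y ∷ []) = p , f y ∷ qr
RaiseStep-All⁻ f (second {x} {L} _ _ _) pl (h ∷ qr) with LAllₚ.++⁻ (x ∷ L) pl
... | p , (y ∷ []) = p , h ∷ f y ∷ qr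

RaiseStep-All⁺ : ∀ {P Q : Letter → Set} {L R L′ R′} → (∀ {l} → Q l → P l) → RaiseStep L R L′ R′ →
                 All P L → All Q R → All P L′ × All Q R′
RaiseStep-All⁺ f (first _ _)    pl (y ∷ qr)     = LAllₚ.++⁺ pl (f y ∷ []) , qr
RaiseStep-All⁺ f (second _ _ _) pl (h ∷ y ∷ qr) = LAllₚ.++⁺ pl (f y ∷ []) , h ∷ qr

-- `t + m ≡ suc j` says that relative place m, in a vector numbered from t, is factor j of the
-- whole. The moved letter passes between factors j+1 and j, so only these two conditions need
-- comparing.
StepAt-FlagAt⁻ : ∀ {P j} → (∀ {l} → P j l → P (suc j) l) → ∀ {n m} t {v v′ : Fact n} → t + m ≡ suc j →
                 StepAt m v v′ → FlagAt P t v′ → FlagAt P t v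
StepAt-FlagAt⁻ f t e (here s) (pl , pr , ps) with suc-injective (trans (+-comm 1 t) e)
... | refl = let pl′ , pr′ = RaiseStep-All⁻ f s pl pr in pl′ , pr′ , ps
StepAt-FlagAt⁻ f t e (there s) (p , ps) = p , StepAt-FlagAt⁻ f (suc t) (trans (sym (+-suc t _)) e) s ps

StepAt-FlagAt⁺ : ∀ {P j} → (∀ {l} → P (suc j) l → P j l) → ∀ {n m} t {v v′ : Fact n} → t + m ≡ suc j →
                 StepAt m v v′ → FlagAt P t v → FlagAt P t v′
StepAt-FlagAt⁺ f t e (here s) (pl , pr , ps) with suc-injective (trans (+-comm 1 t) e)
... | refl = let pl′ , pr′ = RaiseStep-All⁺ f s pl pr in pl′ , pr′ , ps
StepAt-FlagAt⁺ f t e (there s) (p , ps) = p , StepAt-FlagAt⁺ f (suc t) (trans (sym (+-suc t _)) e) s ps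

module Demazure (D : Spec) {wλ : ℕ → ℕ} (wλ-transp : wλ ≗⁺ transp 1 (suc (k D))) where
  open Embedding D

  Sh-range : ∀ {a hi u} → a < hi → Sh C a hi u → All (Range (k D) ∘ val) u
  Sh-range a<hi done   = []
  Sh-range a<hi (up s) = (s≤s z≤n , Sh-bound C s) ∷ Sh-range (m<n⇒m<1+n a<hi) s
  Sh-range a<hi (dn s) = (s≤s z≤n , ≤-trans (<⇒≤ a<hi) (Sh-bound C s)) ∷ Sh-range (<⇒≤ a<hi) s

  ClassW-range : ∀ {w} → ClassW C w → All (Range (k D) ∘ val) w
  ClassW-range (start {a} s) = (s≤s z≤n , Sh-bound C s) ∷ Sh-range (n<1+n a) s

  RF-Can : ∀ {n} {b : Fact n} → RF n wλ b → Can b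
  RF-Can (s , i) = ClassF-intro s (InvWordO-canon (1≤k D) wλ-transp i)

  Can-RF : ∀ {n} {b : Fact n} → Can b → RF n wλ b
  Can-RF (d , c) = VAll.map Decr-StrictDec d , canon-InvWordO (1≤k D) wλ-transp c

  -- The range is part of the condition because `J` is controlled on 1, ..., k only.
  Allowed : (ℕ → ℕ) → ℕ → Letter → Set
  Allowed J i l = Range (k D) (val l) × i ≤ J (val l)

  eOp-StepAt : ∀ {n} j {b b′ : Fact n} → Can b → eOp j b ≡ just b′ → StepAt j b b′
  eOp-StepAt j {b} c e =
    raise-StepAt j b c (trans (sym (trans (eOp-pairAt j b) (pairAt-raise j b c))) e)

  module Move (J : ℕ → ℕ) (inc : IncreasingOn (k D) J) {j c₀ : ℕ} (r₀ : Range (k D) c₀) (J₀ : J c₀ ≡ j)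
              (vacant : ∀ {d} → Range (k D) d → J d ≢ suc j) where

    J′ : ℕ → ℕ
    J′ c = swap j (J c)

    weaken : ∀ i {l} → Allowed J i l → Allowed J′ i l
    weaken i {l} (r , p) with swapView j (J (val l))
    ... | isL e e′   = r , ≤-trans p (subst₂ _≤_ (sym e) (sym e′) (n≤1+n j))
    ... | isR e _    = contradiction e (vacant r)
    ... | other _ _ e = r , subst (i ≤_) (sym e) p

    -- Within the range J and J′ differ at c₀ alone, with bounds j and j+1. The only case to exclude
    -- is the letter c₀ in factor j+1.
    strengthen : ∀ i {l} → val l ≢ c₀ ⊎ i ≢ suc j → Allowed J′ i l → Allowed J i l
    strengthen i {l} h (r , p) with swapView j (J (val l))
    ... | isR e _     = contradiction e (vacant r)
    ... | other _ _ e = r , subst (i ≤_) e p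
    ... | isL e e′ with h
    ...   | inj₂ n = r , subst (i ≤_) (sym e) (≤-pred (≤∧≢⇒< (subst (i ≤_) e′ p) n))
    ...   | inj₁ n with <-cmp (val l) c₀
    ...     | tri< lt′ _ _ = contradiction (trans e (sym J₀)) (<⇒≢ (inc (proj₁ r) lt′ (proj₂ r₀)))
    ...     | tri≈ _ q _   = contradiction q n
    ...     | tri> _ _ gt  = contradiction (trans e (sym J₀)) (>⇒≢ (inc (proj₁ r₀) gt (proj₂ r)))

    -- After the move place j is vacant, so factors j and j+1 carry the same condition, and it
    -- passes from e_j b back to b.
    up-one : ∀ {l} → Allowed J′ j l → Allowed J′ (suc j) l
    up-one {l} (r , p) = r , ≤∧≢⇒< p λ e → vacant r (swap-injective j (trans (sym e) (sym (swap-r j))))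

    down-one : ∀ {l} → Allowed J′ (suc j) l → Allowed J′ j l
    down-one (r , p) = r , <⇒≤ p

    Dem⇒Allowed : ∀ {n} m {b b′ : Fact n} → Can b → iterM m (eOp j) b ≡ just b′ →
                  FlagAt (Allowed J) 1 b′ → FlagAt (Allowed J′) 1 b
    Dem⇒Allowed zero c refl fl = FlagAt-map 1 (λ i {l} _ → weaken i {l}) fl
    Dem⇒Allowed (suc m) {b} c e fl with eOp j b in eq
    ... | just b₁ = StepAt-FlagAt⁻ {Allowed J′} {j} (λ {l} → up-one {l}) 1 refl (eOp-StepAt j c eq)
                      (Dem⇒Allowed m (proj₂ (eOp-compatible j b c) eq) e fl)

    -- The length of factor m+1 drops by one with each move; it is the fuel of `Allowed⇒Dem`.
    Stuck⊎Moves : ∀ {n} → ℕ → ℕ → Fact n → Set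
    Stuck⊎Moves m t v = FlagAt (Allowed J) t v ⊎
      ∃ λ v′ → pairAt raisePair m v ≡ just v′ × length (getF v (suc m)) ≡ suc (length (getF v′ (suc m)))

    progress : ∀ {n} pre m t (v : Fact n) → 1 ≤ m → t + m ≡ suc j → ClassF C pre v →
               FlagAt (Allowed J′) t v → Stuck⊎Moves m t v
    progress pre m t [] _ _ _ _ = inj₁ tt
    progress pre (suc (suc m)) t (x ∷ v) _ e c (p , ps)
      with progress (pre ++ x) (suc m) (suc t) v (s≤s z≤n) (trans (sym (+-suc t (suc m))) e)
             (ClassF-tail {C} {pre} c) ps
    ... | inj₁ fl = inj₁ (LAll.map (λ {l} → strengthen t {l} (inj₂ λ { refl → m+1+n≢m t e })) p , fl)
    ... | inj₂ (v′ , e′ , len) = inj₂ (x ∷ v′ , cong (M.map (x ∷_)) e′ , len)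
    progress pre (suc zero) t v@(_ ∷ _) _ e c fl with suc-injective (trans (+-comm 1 t) e)
    ... | refl = go v c fl
      where
        below : ∀ {L} → All (Allowed J′ t) L → All (Allowed J t) L
        below = LAll.map (λ {l} → strengthen t {l} (inj₂ (1+n≢n ∘ sym)))
        beyond : ∀ {n} {w : Fact n} → FlagAt (Allowed J′) (suc (suc t)) w → FlagAt (Allowed J) (suc (suc t)) w
        beyond = FlagAt-map (suc (suc t)) (λ i {l} t<i → strengthen i {l} (inj₂ (>⇒≢ t<i)))
        go : ∀ {n} (v : Fact n) → ClassF C pre v → FlagAt (Allowed J′) t v → Stuck⊎Moves 1 t v
        go []           _ _            = inj₁ tt
        go (L ∷ [])     _ (p , _)      = inj₁ (below p , tt)
        go (L ∷ [] ∷ v) _ (p , _ , ps) = inj₁ (below p , [] , beyond ps)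
        go ([] ∷ (h ∷ R) ∷ v) _ _      = inj₂ (_ , refl , refl)
        go ((x ∷ L) ∷ (h ∷ R) ∷ v) (_ ∷ dr ∷ _ , c) (p , q , ps) with pairOK pre (x ∷ L) (h ∷ R) (word v) c dr
        ... | low ((h<x ∷ _) ∷ _) = inj₂ (_ , cong (M.map _) eq , refl)
          where
            eq : raisePair (x ∷ L) (h ∷ R) ≡ just ((x ∷ L) ∷ʳ h , R)
            eq rewrite <ᵇ-true h<x = refl
        go ((x ∷ L) ∷ (h ∷ y ∷ R) ∷ v) _ _ | high (x<h ∷ _) _ = inj₂ (_ , cong (M.map _) eq , refl)
          where
            eq : raisePair (x ∷ L) (h ∷ y ∷ R) ≡ just ((x ∷ L) ∷ʳ y , h ∷ R)
            eq rewrite <ᵇ-false (<⇒≯ x<h) = refl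
        -- The stuck head is not c₀: x in factor j gives j ≤ J x, whereas x < h = c₀ would give J x
        -- < J c₀ = j.
        go ((x ∷ L) ∷ (h ∷ []) ∷ v) _ (p@(px ∷ _) , ph ∷ [] , ps) | high (x<h ∷ _) _ =
          inj₁ (below p , strengthen (suc t) {h} (inj₁ λ h≡ → late (strengthen t {x} (inj₂ (1+n≢n ∘ sym)) px) h≡) ph ∷ [] , beyond ps)
          where
            late : Allowed J t x → val h ≢ c₀
            late ((1≤x , _) , t≤) refl = <⇒≱ (inc 1≤x x<h (proj₂ r₀)) (subst (_≤ J (val x)) (sym J₀) t≤)

    -- Applying e_j until it is undefined empties factor j+1, up to a possible
    -- head lying above factor j; only the letter c₀ had to leave, and it is no
    -- such head, being below every letter that factor j may contain.
    Allowed⇒Dem : ∀ {n} m {b : Fact n} → 1 ≤ j → m ≡ length (getF b (suc j)) → Can b → FlagAt (Allowed J′) 1 b →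
                  ∃ λ i → ∃ λ b′ → iterM i (eOp j) b ≡ just b′ × Can b′ × FlagAt (Allowed J) 1 b′
    Allowed⇒Dem m {b} 1≤j len c fl with progress [] j 1 b 1≤j refl c fl
    ... | inj₁ fl′ = 0 , b , refl , c , fl′
    Allowed⇒Dem zero    1≤j len c fl | inj₂ (b₁ , e , dec) = contradiction (trans len dec) λ ()
    Allowed⇒Dem (suc m) {b} 1≤j len c fl | inj₂ (b₁ , e , dec)
      with trans (trans (eOp-pairAt j b) (pairAt-raise j b c)) e
    ... | e′ with Allowed⇒Dem m 1≤j (suc-injective (trans len dec)) (proj₂ (eOp-compatible j b c) e′)
                   (StepAt-FlagAt⁺ {Allowed J′} {j} (λ {l} → down-one {l}) 1 refl (eOp-StepAt j c e′) fl)
    ...   | i , b′ , it , c′ , fl′ = suc i , b′ , trans (step-iter e′) it , c′ , fl′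
      where
        step-iter : eOp j b ≡ just b₁ → iterM (suc i) (eOp j) b ≡ iterM i (eOp j) b₁
        step-iter q rewrite q = refl

  -- The induction starts at J = id, where being allowed is boundedness by the standard flag; each
  -- letter then composes J with one transposition.
  BRFα⇒Allowed : ∀ {n js} → Climb (k D) js → ∀ {b : Fact n} → BRFα n wλ js b → Can b × FlagAt (Allowed (posOf js)) 1 b
  BRFα⇒Allowed [] {b} (rf , bd) = RF-Can rf ,
    FlagAt-zip (λ i r p → r , p) 1 b (ClassW-range (proj₂ (RF-Can rf))) (FlagAt-tabulate 1 b bd)
  BRFα⇒Allowed (move {suc j} {js} 1≤j r₀ J₀ vacant cl) {b} (rf , m , b′ , it , x) = RF-Can rf ,
    Move.Dem⇒Allowed (posOf js) (Climb-increasing cl) r₀ J₀ vacant m (RF-Can rf) it (proj₂ (BRFα⇒Allowed cl x))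

  Allowed⇒BRFα : ∀ {n js} → Climb (k D) js → ∀ {b : Fact n} → Can b → FlagAt (Allowed (posOf js)) 1 b → BRFα n wλ js b
  Allowed⇒BRFα [] {b} c fl = Can-RF c , FlagAt-lookup 1 b (FlagAt-map 1 (λ i _ → proj₂) fl)
  Allowed⇒BRFα (move {suc j} {js} 1≤j r₀ J₀ vacant cl) {b} c fl =
    let i , b′ , it , c′ , fl′ = Move.Allowed⇒Dem (posOf js) (Climb-increasing cl) r₀ J₀ vacant _ {b} 1≤j refl c fl
    in Can-RF c , i , b′ , it , Allowed⇒BRFα cl c′ fl′

  ψ-bounded : ∀ {n js} {b : Fact n} → (∀ {c} → Range (k D) c → posOf js c ≡ iv D c) →
              FlagAt (Allowed (posOf js)) 1 b → Bounded (ψ b)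
  ψ-bounded {b = b} pos fl = FlagAt-lookup 1 (ψ b) (FlagAt-mapF⁺ {λ i l → i ≤ val l} (embed (firstVal (word b))) 1 b
    (FlagAt-map 1 (λ i {l} _ (r , p) → subst (i ≤_) (pos r) p) fl))

  bounded-ψ : ∀ {n js} {b : Fact n} → (∀ {c} → Range (k D) c → posOf js c ≡ iv D c) → Can b →
              Bounded (ψ b) → FlagAt (Allowed (posOf js)) 1 b
  bounded-ψ {b = b} pos c bd = FlagAt-zip (λ i {l} r p → r , subst (i ≤_) (sym (pos r)) p) 1 b
    (ClassW-range (proj₂ c)) (FlagAt-mapF⁻ {λ i l → i ≤ val l} (embed (firstVal (word b))) 1 b (FlagAt-tabulate 1 (ψ b) bd))

theorem5p11 : ∀ (n : ℕ) (z : ℕ → ℕ) (T : List Letter) →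
    OneRowOReduced z T → NoDescentsAbove n z →
    ∀ (wλ : ℕ → ℕ) → IsDominantPerm (lambdaOf (alphaO T)) wλ →
    ∀ (js : List ℕ) → IsRedWordU (alphaO T) js →
    CrystalIso (BRFT n z T) (BRFα n wλ js)
theorem5p11 n z T oT _ wλ dom js red with specOf oT
... | D , cT = record
  { φ = φ ; ψ = ψ
  ; φ-into = λ a x → Allowed⇒BRFα climb (φ-Can (class x))
      (bounded-ψ {js = js} pos (φ-Can (class x)) (subst Bounded (sym (ψ-φ (class x))) (proj₂ x)))
  ; ψ-into = λ b y → let c , fl = BRFα⇒Allowed climb y ; d , cw = ψ-ClassF {b = b} c in
      ((VAll.map Decr-StrictDec d , ClassW-InvWordO D value cw) , ClassW-connected D cw cT) , ψ-bounded {js = js} {b} pos fl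
  ; ψ∘φ = λ a x → ψ-φ (class x)
  ; φ∘ψ = λ b y → φ-ψ (proj₁ (BRFα⇒Allowed climb y))
  ; wt-φ = λ a _ → weight-mapF (unembed (firstVal (word a))) a
  ; raise-φ = λ j _ a a′ x x′ → transport (raise j) (raise-compatible j) (class x) (class x′)
  ; lower-φ = λ j _ a a′ x x′ → transport (lower j) (lower-compatible j) (class x) (class x′)
  }
  where
    open Embedding D
    open Inverse D
    open Operators D
    open Demazure D (dominant-transp {lam = lambdaOf (alphaO T)} (1≤k D) (lambdaOf-IsHook cT) dom)
    climb : Climb (k D) js
    climb = proj₁ (redWord-climb {js = js} cT red)
    pos : ∀ {c} → Range (k D) c → posOf js c ≡ iv D c
    pos = proj₂ (redWord-climb {js = js} cT red)
    value : ∀ x → 1 ≤ x → reached D 0 (k D ∸ 1) x ≡ z x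
    value = InvWordO-value D cT (proj₂ (proj₂ (proj₂ (proj₂ (proj₂ oT)))))
    -- Membership comes from the equivalence with T; the values are then distinct, so the factors
    -- decrease in value as well as in key.
    class : ∀ {a} → BRFT n z T a → ClassF D [] a
    class (((s , _) , eqv) , _) = ClassF-intro s (ClassW-∼O D (Eq.symmetric _ eqv) cT)
    weight-mapF : ∀ r {m} (v : Fact m) → weight (mapF r v) ≡ weight v
    weight-mapF r []      = refl
    weight-mapF r (x ∷ v) = cong₂ _∷_ (L.length-map r x) (weight-mapF r v)
    -- Compatibility is stated for ψ. It passes to φ because a = ψ (φ a), and `φ-ψ` identifies the
    -- result of the operator on φ a.
    transport : ∀ (op : Fact n → Maybe (Fact n)) → Compatible op → ∀ {a a′} → ClassF D [] a → ClassF D [] a′ →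
                (op a ≡ just a′) ⇔ (op (φ a) ≡ just (φ a′))
    transport op comp {a} {a′} c c′ = mk⇔ to λ e → trans eq (trans (cong (M.map ψ) e) (cong just (ψ-φ c′)))
      where
        eq : op a ≡ M.map ψ (op (φ a))
        eq = trans (cong op (sym (ψ-φ c))) (proj₁ (comp (φ a) (φ-Can c)))
        to : op a ≡ just a′ → op (φ a) ≡ just (φ a′)
        to e with map-just ψ (op (φ a)) (trans (sym eq) e)
        ... | b′ , e′ , refl = trans e′ (cong just (sym (φ-ψ (proj₂ (comp (φ a) (φ-Can c)) e′))))
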